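{- Suppose that $K$ is a (non-trivially) valued field of equi-characteristic $0$ whose theory, in some language $\mathcal L\supset\{+,\cdot,\mathcal O_K\}$, is $0$-h-minimal. Then $K$ is Henselian.
   Context: Valued fields: valuations are arbitrary non-trivial Krull valuations. $K$ has valuation ring $\mathcal O_K\subsetneq K$; equi-characteristic $0$ means that $K$ and its residue field have characteristic $0$. The value group is written multiplicatively, $\Gamma_K^\times=K^\times/\mathcal O_K^\times$, $\Gamma_K=\Gamma_K^\times\cup\{0\}$, with valuation $|\cdot|\colon K\to\Gamma_K$, $|0|=0$, ordered so that $\mathcal O_K=\{x:|x|\le 1\}$. Leading terms: $\mathrm{RV}=K^\times/(1+\{x:|x|<1\})\ \cup\{0\}$ and $\mathrm{rv}\colon K\to\mathrm{RV}$ is the quotient map on $K^\times$ extended by $0\mapsto 0$. Elements of $\mathrm{RV}$ are imaginary elements and may be used as parameters. "$A$-definable" means definable with parameters from $A$. Preparation: a finite non-empty set $C\subset K$ $1$-prepares $X\subset K$ if whether $x\in K$ lies in $X$ depends only on the tuple $(\mathrm{rv}(x-c))_{c\in C}$. $0$-h-minimality: a theory $\mathcal T$ of valued fields of equi-characteristic $0$ in a language containing $\{+,\cdot,\mathcal O_K\}$ is $0$-h-minimal if for every model $K\models\mathcal T$ and every $A\subset K$, every $(A\cup\mathrm{RV})$-definable set $X\subset K$ can be $1$-prepared by a finite $A$-definable set $C\subset K$. -}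

module Defs where

open import Level using (Level; suc)
open import Algebra.Bundles using (CommutativeRing; RawRing)
open import Algebra.Structures using (IsCommutativeRing)
import Algebra.Definitions.RawMonoid as RawMonoidDefinitions
open import Data.Empty.Polymorphic using (⊥)
open import Data.Fin using (Fin)
open import Data.List using (List; []; _∷_)
open import Data.List.Relation.Unary.All using (All)
import Data.List.Membership.Setoid as SetoidMembership
open import Data.Nat as ℕ using (ℕ)
open import Data.Product using (Σ; Σ-syntax; ∃-syntax; _×_; _,_; proj₁; proj₂)
open import Data.Sum using (_⊎_)
open import Data.Vec as Vec using (Vec; []; _∷_)
open import Data.Vec.Relation.Binary.Pointwise.Inductive using (Pointwise)
import Data.Vec.Relation.Unary.All as VecAll
open import Function.Bundles using (_⇔_)
open import Relation.Binary.Bundles using (Setoid)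
open import Relation.Nullary using (¬_)
open import Relation.Unary using (Pred)

------------------------------------------------------------------------
-- Valued fields

CharacteristicZero : ∀ {a ℓ} → RawRing a ℓ → Set ℓ
CharacteristicZero R = ∀ n → ¬ (ℕ.suc n ·1 ≈ 0#)
  where
  open RawRing R
  _·1 : ℕ → Carrier
  n ·1 = RawMonoidDefinitions._×_ +-rawMonoid n 1#

-- A field with a proper valuation ring 𝒪, i.e. a non-trivial Krull
-- valuation up to equivalence.
record IsValuedField {u} (R : CommutativeRing u u)
                     (𝒪 : Pred (CommutativeRing.Carrier R) u) : Set u where
  open CommutativeRing R
  field
    1≉0       : ¬ (1# ≈ 0#)
    inverse   : ∀ x → ¬ (x ≈ 0#) → ∃[ y ] x * y ≈ 1#
    𝒪-resp-≈  : ∀ {x y} → x ≈ y → 𝒪 x → 𝒪 y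
    𝒪-0       : 𝒪 0#
    𝒪-1       : 𝒪 1#
    𝒪-+       : ∀ {x y} → 𝒪 x → 𝒪 y → 𝒪 (x + y)
    𝒪-*       : ∀ {x y} → 𝒪 x → 𝒪 y → 𝒪 (x * y)
    𝒪-neg     : ∀ {x} → 𝒪 x → 𝒪 (- x)
    valuation : ∀ x y → x * y ≈ 1# → 𝒪 x ⊎ 𝒪 y
    proper    : ∃[ x ] ¬ 𝒪 x

record ValuedField u : Set (suc u) where
  field
    commutativeRing : CommutativeRing u u
    𝒪               : Pred (CommutativeRing.Carrier commutativeRing) u
    isValuedField   : IsValuedField commutativeRing 𝒪
  open CommutativeRing commutativeRing public
  open IsValuedField isValuedField public

module _ {u} (K : ValuedField u) where
  open ValuedField K
  open SetoidMembership setoid using (_∈_)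

  -- Γ_K is represented by elements of K: the class of x in
  -- K^×/𝒪^× ∪ {0} is at most that of y exactly when x ∈ 𝒪 y.
  ∣_∣≤∣_∣ ∣_∣<∣_∣ ∣_∣≡∣_∣ : Carrier → Carrier → Set u
  ∣ x ∣≤∣ y ∣ = ∃[ a ] 𝒪 a × x ≈ a * y
  ∣ x ∣<∣ y ∣ = ∣ x ∣≤∣ y ∣ × ¬ ∣ y ∣≤∣ x ∣
  ∣ x ∣≡∣ y ∣ = ∣ x ∣≤∣ y ∣ × ∣ y ∣≤∣ x ∣

  𝔪 : Pred Carrier u
  𝔪 x = ∣ x ∣<∣ 1# ∣

  -- 𝒪/𝔪
  residueField : RawRing u u
  residueField = record
    { Carrier = Σ Carrier 𝒪
    ; _≈_     = λ (x , _) (y , _) → 𝔪 (x - y)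
    ; _+_     = λ (x , p) (y , q) → x + y , 𝒪-+ p q
    ; _*_     = λ (x , p) (y , q) → x * y , 𝒪-* p q
    ; -_      = λ (x , p) → - x , 𝒪-neg p
    ; 0#      = 0# , 𝒪-0
    ; 1#      = 1# , 𝒪-1
    }

  EquiCharacteristicZero : Set u
  EquiCharacteristicZero =
    CharacteristicZero rawRing × CharacteristicZero residueField

  -- RV is the quotient of K by _≈RV_, so rv is the identity on
  -- representatives.
  RV : Set u
  RV = Carrier

  rv : Carrier → RV
  rv x = x

  _≈RV_ : RV → RV → Set u
  x ≈RV y = (x ≈ 0# × y ≈ 0#)
          ⊎ (¬ (x ≈ 0#) × ¬ (y ≈ 0#) × ∃[ m ] 𝔪 m × x ≈ (1# + m) * y)

  Finite : Pred Carrier u → Set u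
  Finite C = Σ[ cs ∈ List Carrier ] ∀ x → C x ⇔ x ∈ cs

  record OnePrepares (C X : Pred Carrier u) : Set u where
    field
      finite   : Finite C
      nonEmpty : ∃[ c ] C c
      prepares : ∀ x y → (∀ c → C c → rv (x - c) ≈RV rv (y - c)) → X x ⇔ X y

  -- Polynomials are lists of coefficients, constant term first.
  evalPoly : List Carrier → Carrier → Carrier
  evalPoly []      x = 0#
  evalPoly (a ∷ f) x = a + x * evalPoly f x

  derivative : List Carrier → List Carrier
  derivative []      = []
  derivative (_ ∷ f) = go 1 f
    where
    go : ℕ → List Carrier → List Carrier
    go n []      = []
    go n (b ∷ g) = RawMonoidDefinitions._×_ +-rawMonoid n b ∷ go (ℕ.suc n) g

  Henselian : Set u
  Henselian = ∀ (f : List Carrier) (a : Carrier) → All 𝒪 f → 𝒪 a →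
    ∣ evalPoly f a ∣<∣ 1# ∣ → ∣ evalPoly (derivative f) a ∣≡∣ 1# ∣ →
    ∃[ b ] 𝒪 b × evalPoly f b ≈ 0# × ∣ b - a ∣<∣ 1# ∣

------------------------------------------------------------------------
-- First-order logic over a language containing {+, ·, 𝒪}

record Language u : Set (suc u) where
  field
    Function : ℕ → Set u
    Relation : ℕ → Set u
    plus     : Function 2
    times    : Function 2
    valring  : Relation 1

module _ {u} (L : Language u) where
  open Language L

  data Term (n : ℕ) : Set u where
    var : Fin n → Term n
    app : ∀ {k} → Function k → Vec (Term n) k → Term n

  -- The remaining connectives are classically definable; all_ binds
  -- variable 0.
  data Formula (n : ℕ) : Set u where
    _≐_  : Term n → Term n → Formula n
    rel  : ∀ {k} → Relation k → Vec (Term n) k → Formula n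
    bot  : Formula n
    _⇒_  : Formula n → Formula n → Formula n
    all_ : Formula (ℕ.suc n) → Formula n

  Theory : Set (suc u)
  Theory = Pred (Formula 0) u

  -- Formulas in the language expanded by the imaginary sort RV and the
  -- map rv, with n variables of the field sort and m of sort RV.
  data RVTerm (n m : ℕ) : Set u where
    var   : Fin m → RVTerm n m
    rv[_] : Term n → RVTerm n m

  data RVFormula (n m : ℕ) : Set u where
    _≐_    : Term n → Term n → RVFormula n m
    _≐RV_  : RVTerm n m → RVTerm n m → RVFormula n m
    rel    : ∀ {k} → Relation k → Vec (Term n) k → RVFormula n m
    bot    : RVFormula n m
    _⇒_    : RVFormula n m → RVFormula n m → RVFormula n m
    all_   : RVFormula (ℕ.suc n) m → RVFormula n m
    allRV_ : RVFormula n (ℕ.suc m) → RVFormula n m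

  record Structure : Set (suc u) where
    field
      setoid : Setoid u u
    open Setoid setoid public
    field
      function      : ∀ {k} → Function k → Vec Carrier k → Carrier
      relation      : ∀ {k} → Relation k → Pred (Vec Carrier k) u
      function-cong : ∀ {k} (f : Function k) {xs ys} →
                      Pointwise _≈_ xs ys → function f xs ≈ function f ys
      relation-resp : ∀ {k} (R : Relation k) {xs ys} →
                      Pointwise _≈_ xs ys → relation R xs → relation R ys

module _ {u} {L : Language u} (M : Structure L) where
  open Language L
  open Structure M

  mutual
    evalTerm : ∀ {n} → Vec Carrier n → Term L n → Carrier
    evalTerm ρ (var i)    = Vec.lookup ρ i
    evalTerm ρ (app f ts) = function f (evalTerms ρ ts)

    evalTerms : ∀ {n k} → Vec Carrier n → Vec (Term L n) k → Vec Carrier k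
    evalTerms ρ []       = []
    evalTerms ρ (t ∷ ts) = evalTerm ρ t ∷ evalTerms ρ ts

  Satisfies : ∀ {n} → Vec Carrier n → Formula L n → Set u
  Satisfies ρ (s ≐ t)    = evalTerm ρ s ≈ evalTerm ρ t
  Satisfies ρ (rel R ts) = relation R (evalTerms ρ ts)
  Satisfies ρ bot        = ⊥
  Satisfies ρ (φ ⇒ ψ)    = Satisfies ρ φ → Satisfies ρ ψ
  Satisfies ρ (all φ)    = ∀ x → Satisfies (x ∷ ρ) φ

  Th : Theory L
  Th φ = Satisfies [] φ

  _⊨_ : Theory L → Set u
  _⊨_ T = ∀ φ → T φ → Satisfies [] φ

  Definable : (A X : Pred Carrier u) → Set u
  Definable A X = ∃[ n ] Σ[ φ ∈ Formula L (ℕ.suc n) ] Σ[ a ∈ Vec Carrier n ]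
    VecAll.All A a × (∀ x → X x ⇔ Satisfies (x ∷ a) φ)

  -- M is a valued field with respect to its own +, · and 𝒪; the
  -- constants and negation need not be symbols of the language.
  record IsValuedFieldStructure : Set u where
    field
      0# 1# : Carrier
      -_    : Carrier → Carrier
      isCommutativeRing :
        IsCommutativeRing _≈_ (λ x y → function plus (x ∷ y ∷ []))
                              (λ x y → function times (x ∷ y ∷ [])) -_ 0# 1#

    commutativeRing : CommutativeRing u u
    commutativeRing = record { isCommutativeRing = isCommutativeRing }

    field
      isValuedField :
        IsValuedField commutativeRing (λ x → relation valring (x ∷ []))

    valuedField : ValuedField u
    valuedField = record { isValuedField = isValuedField }

  module _ (V : IsValuedFieldStructure) where
    private
      K = IsValuedFieldStructure.valuedField V

    evalRVTerm : ∀ {n m} → Vec Carrier n → Vec (RV K) m → RVTerm L n m → RV K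
    evalRVTerm ρ σ (var i) = Vec.lookup σ i
    evalRVTerm ρ σ rv[ t ] = rv K (evalTerm ρ t)

    SatisfiesRV : ∀ {n m} → Vec Carrier n → Vec (RV K) m → RVFormula L n m → Set u
    SatisfiesRV ρ σ (s ≐ t)    = evalTerm ρ s ≈ evalTerm ρ t
    SatisfiesRV ρ σ (s ≐RV t)  = _≈RV_ K (evalRVTerm ρ σ s) (evalRVTerm ρ σ t)
    SatisfiesRV ρ σ (rel R ts) = relation R (evalTerms ρ ts)
    SatisfiesRV ρ σ bot        = ⊥
    SatisfiesRV ρ σ (φ ⇒ ψ)    = SatisfiesRV ρ σ φ → SatisfiesRV ρ σ ψ
    SatisfiesRV ρ σ (all φ)    = ∀ x → SatisfiesRV (x ∷ ρ) σ φ
    SatisfiesRV ρ σ (allRV φ)  = ∀ ξ → SatisfiesRV ρ (ξ ∷ σ) φ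

    -- (A ∪ RV)-definability of a subset of the field
    RVDefinable : (A X : Pred Carrier u) → Set u
    RVDefinable A X = ∃[ n ] ∃[ m ] Σ[ φ ∈ RVFormula L (ℕ.suc n) m ]
      Σ[ a ∈ Vec Carrier n ] Σ[ ξ ∈ Vec (RV K) m ]
      VecAll.All A a × (∀ x → X x ⇔ SatisfiesRV (x ∷ a) ξ φ)

------------------------------------------------------------------------
-- 0-h-minimality

-- Models are taken in the universe of the language.  By downward
-- Löwenheim–Skolem larger models would impose no further condition.
record ZeroHMinimal {u} {L : Language u} (T : Theory L) : Set (suc u) where
  open IsValuedFieldStructure using (valuedField)
  field
    valued   : (K : Structure L) → K ⊨ T → IsValuedFieldStructure K
    equiChar : (K : Structure L) (K⊨T : K ⊨ T) →
               EquiCharacteristicZero (valuedField (valued K K⊨T))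
    prepare  : (K : Structure L) (K⊨T : K ⊨ T) (A X : Pred (Structure.Carrier K) u) →
               RVDefinable K (valued K K⊨T) A X →
               ∃[ C ] Definable K A C × OnePrepares (valuedField (valued K K⊨T)) C X

{-# OPTIONS --safe #-}

-- Preparation says that a definable subset of K is a union of balls away from
-- finitely many points.  This yields a category theorem for boxes in K^n and
-- so some dimension theory inside K itself, without passing to elementary
-- extensions.  Suppose that F has an approximate simple root in a disc but no
-- root there.  By Newton approximation the values of F on the disc generate a
-- final segment Rad of the value group that is closed under products and has
-- no least element; everything happens at the scales in Rad.  The missing root
-- r has a minimal polynomial f of some degree N ≥ 2, at these scales.  The
-- elements of K(r) close to r have minimal polynomials f + c without roots in
-- K, and after a linear change of coordinates c depends on the element by a
-- map K^N → K^N close to the identity.  By dimension theory its image contains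
-- a line segment in the direction of the leading coefficient of c.  But moving
-- along this segment turns an approximate root in K of f + c into an exact
-- one.
module Submission where

open import Defs
open import Axiom.ExcludedMiddle using (ExcludedMiddle)
open import Algebra.Bundles using (CommutativeRing; RawRing)
import Algebra.Definitions.RawMonoid as RawMonoidDefinitions
import Algebra.Properties.Monoid.Mult as Mult
import Algebra.Properties.Ring as RingProperties
import Algebra.Properties.Semiring.Mult as SemiringMult
import Algebra.Solver.Ring as RingSolver
open import Algebra.Solver.Ring.AlmostCommutativeRing
  using (fromCommutativeRing; _-Raw-AlmostCommutative⟶_)
open import Data.Bool using (Bool; true; false; if_then_else_)
open import Data.Empty using (⊥; ⊥-elim)
import Data.Empty.Polymorphic as Poly⊥
open import Data.Fin using (Fin; zero; suc; fromℕ; _↑ˡ_; _↑ʳ_)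
open import Data.List as List using (List; []; _∷_)
import Data.List.Membership.Setoid as SetoidMembership
open import Data.List.Relation.Unary.All as All using (All; []; _∷_)
import Data.List.Relation.Unary.All.Properties as All
open import Data.List.Relation.Unary.Any as Any using (Any; here; there)
import Data.List.Relation.Unary.Any.Properties as Any
open import Data.Maybe using (Maybe; just; nothing)
open import Data.Nat as ℕ using (ℕ; zero; suc)
import Data.Nat.Properties as ℕ
open import Data.Product using (Σ; Σ-syntax; ∃; ∃-syntax; _×_; _,_; proj₁; proj₂)
open import Data.Sum using (_⊎_; inj₁; inj₂; [_,_]′)
open import Data.Unit.Polymorphic using (⊤; tt)
open import Data.Vec as Vec using (Vec; []; _∷_; lookup; _∷ʳ_; initLast)
import Data.Vec.Properties as Vec
import Data.Vec.Relation.Binary.Pointwise.Inductive as Pointwise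
import Data.Vec.Relation.Unary.All as VecAll
open import Function.Base using (_∘_; id; case_of_)
open import Function.Bundles using (_⇔_; mk⇔; Equivalence)
open import Level using () renaming (suc to lsuc)
open import Relation.Binary.PropositionalEquality as ≡ using (_≡_)
import Relation.Binary.Reasoning.Setoid as SetoidReasoning
open import Relation.Nullary using (¬_; yes; no)

-- The root r is never constructed. It would lie in the completion of the residue field of the
-- coarsening of the valuation with maximal ideal the complement of `Rad`. It is replaced by germs
-- of functions as `F` tends to its infimum, and an equation at r becomes a `Null` germ. Everything
-- is therefore known only modulo the complement of `Rad`, and cosets of it play the part of points.
-- Since no countability is at hand, the category theorem cannot come from nested balls: in
-- dimension one it is drawn from the preparation of a single set of first entry points.
--
-- The coordinates come from Taylor's formula: f(r - h) is about - f'(r) h, so for h = e(r) / f'(r)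
-- the correction c with f + c vanishing at r - h is about e. Residue characteristic zero enters
-- here, as f' has leading coefficient N, a unit, and so does not vanish at r. The degree being at
-- least 2 keeps the elements r - h out of `K`. The final clash is that f + c is injective near r,
-- having derivative close to f'(r), and yet vanishes both at an element of `K` and at an element
-- outside `K`.

module Classical (em : ∀ {ℓ} → ExcludedMiddle ℓ) where

  by-contradiction : ∀ {ℓ} {P : Set ℓ} → ¬ ¬ P → P
  by-contradiction {P = P} ¬¬p with em {P = P}
  ... | yes p = p
  ... | no ¬p = ⊥-elim (¬¬p ¬p)

  ¬∀⇒∃¬ : ∀ {a b} {A : Set a} {P : A → Set b} → ¬ (∀ x → P x) → ∃[ x ] ¬ P x
  ¬∀⇒∃¬ ¬∀ = by-contradiction λ ¬∃ → ¬∀ λ x → by-contradiction λ ¬p → ¬∃ (x , ¬p)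

-- A ring solver with integer coefficients, represented as formal
-- differences of natural numbers so that the morphism to the ring is simple.
module Solver {u} (R : CommutativeRing u u) where
  open CommutativeRing R
  open Mult +-monoid using (×-homo-+) renaming (_×_ to _∙_)
  open SemiringMult semiring using (×1-homo-*)
  open RingProperties ring using (-‿distribˡ-*; -‿distribʳ-*; -‿involutive; -‿+-comm)
  open SetoidReasoning setoid

  private

    coeff : RawRing _ _
    coeff = record
      { Carrier = ℕ × ℕ
      ; _≈_ = _≡_
      ; _+_ = λ (a , b) (c , d) → a ℕ.+ c , b ℕ.+ d
      ; _*_ = λ (a , b) (c , d) → a ℕ.* c ℕ.+ b ℕ.* d , a ℕ.* d ℕ.+ b ℕ.* c
      ; -_ = λ (a , b) → b , a
      ; 0# = 0 , 0
      ; 1# = 1 , 0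
      }

    ι : ℕ → Carrier
    ι n = n ∙ 1#

    ⟦_⟧ : ℕ × ℕ → Carrier
    ⟦ a , b ⟧ = ι a - ι b

    exchange : ∀ a b c d → (a + b) + (c + d) ≈ (a + c) + (b + d)
    exchange a b c d = begin
      (a + b) + (c + d) ≈⟨ +-assoc a b _ ⟩
      a + (b + (c + d)) ≈⟨ +-congˡ (+-assoc b c d) ⟨
      a + ((b + c) + d) ≈⟨ +-congˡ (+-congʳ (+-comm b c)) ⟩
      a + ((c + b) + d) ≈⟨ +-congˡ (+-assoc c b d) ⟩
      a + (c + (b + d)) ≈⟨ +-assoc a c _ ⟨
      (a + c) + (b + d) ∎

    +-homo : ∀ x y → ⟦ RawRing._+_ coeff x y ⟧ ≈ ⟦ x ⟧ + ⟦ y ⟧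
    +-homo (a , b) (c , d) = begin
      ι (a ℕ.+ c) - ι (b ℕ.+ d)         ≈⟨ +-cong (×-homo-+ 1# a c) (-‿cong (×-homo-+ 1# b d)) ⟩
      (ι a + ι c) - (ι b + ι d)         ≈⟨ +-congˡ (-‿+-comm (ι b) (ι d)) ⟨
      (ι a + ι c) + (- ι b + - ι d)     ≈⟨ exchange _ _ _ _ ⟩
      (ι a - ι b) + (ι c - ι d) ∎

    *-homo : ∀ x y → ⟦ RawRing._*_ coeff x y ⟧ ≈ ⟦ x ⟧ * ⟦ y ⟧
    *-homo (a , b) (c , d) = begin
      ι (a ℕ.* c ℕ.+ b ℕ.* d) - ι (a ℕ.* d ℕ.+ b ℕ.* c)
        ≈⟨ +-cong (×-homo-+ 1# (a ℕ.* c) _) (-‿cong (×-homo-+ 1# (a ℕ.* d) _)) ⟩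
      (ι (a ℕ.* c) + ι (b ℕ.* d)) - (ι (a ℕ.* d) + ι (b ℕ.* c))
        ≈⟨ +-cong (+-cong (×1-homo-* a c) (×1-homo-* b d))
                  (-‿cong (+-cong (×1-homo-* a d) (×1-homo-* b c))) ⟩
      (ι a * ι c + ι b * ι d) - (ι a * ι d + ι b * ι c)
        ≈⟨ +-congˡ (-‿+-comm _ _) ⟨
      (ι a * ι c + ι b * ι d) + (- (ι a * ι d) + - (ι b * ι c))
        ≈⟨ +-congˡ (+-cong (-‿distribʳ-* _ _) (-‿distribˡ-* _ _)) ⟩
      (ι a * ι c + ι b * ι d) + (ι a * - ι d + - ι b * ι c)
        ≈⟨ +-congˡ (+-comm _ _) ⟩
      (ι a * ι c + ι b * ι d) + (- ι b * ι c + ι a * - ι d)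
        ≈⟨ exchange _ _ _ _ ⟩
      (ι a * ι c + - ι b * ι c) + (ι b * ι d + ι a * - ι d)
        ≈⟨ +-cong (distribʳ _ _ _) (+-comm _ _) ⟨
      (ι a - ι b) * ι c + (ι a * - ι d + ι b * ι d)
        ≈⟨ +-congˡ (+-congˡ lem) ⟩
      (ι a - ι b) * ι c + (ι a * - ι d + - ι b * - ι d)
        ≈⟨ +-congˡ (distribʳ _ _ _) ⟨
      (ι a - ι b) * ι c + (ι a - ι b) * - ι d
        ≈⟨ distribˡ _ _ _ ⟨
      (ι a - ι b) * (ι c - ι d) ∎
      where
      lem : ι b * ι d ≈ - ι b * - ι d
      lem = begin
        ι b * ι d         ≈⟨ *-congʳ (-‿involutive (ι b)) ⟨
        - (- ι b) * ι d   ≈⟨ -‿distribˡ-* _ _ ⟨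
        - (- ι b * ι d)   ≈⟨ -‿distribʳ-* _ _ ⟩
        - ι b * - ι d ∎

    -‿homo : ∀ x → ⟦ RawRing.-_ coeff x ⟧ ≈ - ⟦ x ⟧
    -‿homo (a , b) = begin
      ι b - ι a         ≈⟨ +-comm _ _ ⟩
      - ι a + ι b       ≈⟨ +-congˡ (-‿involutive _) ⟨
      - ι a + - (- ι b) ≈⟨ -‿+-comm _ _ ⟩
      - (ι a - ι b) ∎

    -- ⟦_⟧ adjusted so that the constants 0 and 1 denote 0# and 1# on the nose.
    ⟦_⟧′ : ℕ × ℕ → Carrier
    ⟦ 0 , 0 ⟧′ = 0#
    ⟦ 1 , 0 ⟧′ = 1#
    ⟦ x ⟧′     = ⟦ x ⟧

    ⟦⟧′≈⟦⟧ : ∀ x → ⟦ x ⟧′ ≈ ⟦ x ⟧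
    ⟦⟧′≈⟦⟧ (0 , 0)           = sym (-‿inverseʳ 0#)
    ⟦⟧′≈⟦⟧ (1 , 0)           = sym (trans (+-congʳ (+-identityʳ 1#))
      (trans (+-congˡ (trans (sym (+-identityˡ _)) (-‿inverseʳ 0#))) (+-identityʳ 1#)))
    ⟦⟧′≈⟦⟧ (0 , suc _)       = refl
    ⟦⟧′≈⟦⟧ (1 , suc _)       = refl
    ⟦⟧′≈⟦⟧ (suc (suc _) , _) = refl

    morphism : coeff -Raw-AlmostCommutative⟶ fromCommutativeRing R
    morphism = record
      { ⟦_⟧ = ⟦_⟧′
      ; +-homo = λ x y → trans (⟦⟧′≈⟦⟧ (RawRing._+_ coeff x y))
          (trans (+-homo x y) (sym (+-cong (⟦⟧′≈⟦⟧ x) (⟦⟧′≈⟦⟧ y))))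
      ; *-homo = λ x y → trans (⟦⟧′≈⟦⟧ (RawRing._*_ coeff x y))
          (trans (*-homo x y) (sym (*-cong (⟦⟧′≈⟦⟧ x) (⟦⟧′≈⟦⟧ y))))
      ; -‿homo = λ x → trans (⟦⟧′≈⟦⟧ (RawRing.-_ coeff x))
          (trans (-‿homo x) (sym (-‿cong (⟦⟧′≈⟦⟧ x))))
      ; 0-homo = refl
      ; 1-homo = refl
      }

    _coeff≟_ : ∀ x y → Maybe (⟦ x ⟧′ ≈ ⟦ y ⟧′)
    (a , b) coeff≟ (c , d) with a ℕ.+ d ℕ.≟ c ℕ.+ b
    ... | no _  = nothing
    ... | yes p = just (trans (⟦⟧′≈⟦⟧ (a , b)) (trans (begin
      ι a - ι b                     ≈⟨ +-identityʳ _ ⟨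
      (ι a - ι b) + 0#              ≈⟨ +-congˡ (-‿inverseʳ (ι d)) ⟨
      (ι a - ι b) + (ι d - ι d)     ≈⟨ exchange _ _ _ _ ⟩
      (ι a + ι d) + (- ι b - ι d)   ≈⟨ +-congʳ (×-homo-+ 1# a d) ⟨
      ι (a ℕ.+ d) + (- ι b - ι d)   ≈⟨ +-congʳ (reflexive (≡.cong ι p)) ⟩
      ι (c ℕ.+ b) + (- ι b - ι d)   ≈⟨ +-cong (×-homo-+ 1# c b) (+-comm _ _) ⟩
      (ι c + ι b) + (- ι d - ι b)   ≈⟨ exchange _ _ _ _ ⟩
      (ι c - ι d) + (ι b - ι b)     ≈⟨ +-congˡ (-‿inverseʳ (ι b)) ⟩
      (ι c - ι d) + 0#              ≈⟨ +-identityʳ _ ⟩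
      ι c - ι d ∎) (sym (⟦⟧′≈⟦⟧ (c , d)))))

  open RingSolver coeff (fromCommutativeRing R) morphism _coeff≟_ public
    using (solve; prove; Polynomial; _:=_; _:+_; _:*_; _:-_; :-_; con)

  :0 :1 : ∀ {n} → Polynomial n
  :0 = con (0 , 0)
  :1 = con (1 , 0)

-- Valuation inequalities between elements of `K`.

module Order (em : ∀ {ℓ} → ExcludedMiddle ℓ) {u} (K : ValuedField u) where
  open ValuedField K hiding (zero)
  open Classical em
  open Solver commutativeRing

  infix 4 _≼_ _≺_ _⊀_

  _≼_ _≺_ : Carrier → Carrier → Set u
  _≼_ = ∣_∣≤∣_∣ K
  _≺_ = ∣_∣<∣_∣ K

  IntegersAreUnits : Set u
  IntegersAreUnits = ∀ n → 1# ≼ RawMonoidDefinitions._×_ +-rawMonoid (suc n) 1#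

  ≼-refl : ∀ {x} → x ≼ x
  ≼-refl {x} = 1# , 𝒪-1 , sym (*-identityˡ x)

  ≼-reflexive : ∀ {x y} → x ≈ y → x ≼ y
  ≼-reflexive x≈y = 1# , 𝒪-1 , trans x≈y (sym (*-identityˡ _))

  ≼-trans : ∀ {x y z} → x ≼ y → y ≼ z → x ≼ z
  ≼-trans {x} {y} {z} (a , p , q) (b , r , s) = a * b , 𝒪-* p r ,
    trans q (trans (*-congˡ s) (sym (*-assoc a b z)))

  ≼-resp : ∀ {x x′ y y′} → x ≈ x′ → y ≈ y′ → x ≼ y → x′ ≼ y′
  ≼-resp p q r = ≼-trans (≼-reflexive (sym p)) (≼-trans r (≼-reflexive q))

  ≺-resp : ∀ {x x′ y y′} → x ≈ x′ → y ≈ y′ → x ≺ y → x′ ≺ y′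
  ≺-resp p q (r , s) = ≼-resp p q r , s ∘ ≼-resp (sym q) (sym p)

  0≼ : ∀ {x} → 0# ≼ x
  0≼ {x} = 0# , 𝒪-0 , sym (zeroˡ x)

  ≼0⇒≈0 : ∀ {x} → x ≼ 0# → x ≈ 0#
  ≼0⇒≈0 (a , _ , p) = trans p (zeroʳ a)

  -- The junk value at 0 is 0.
  _⁻¹ : Carrier → Carrier
  x ⁻¹ with em {P = x ≈ 0#}
  ... | yes _   = 0#
  ... | no x≉0 = proj₁ (inverse x x≉0)

  ⁻¹-inverse : ∀ {x} → ¬ x ≈ 0# → x * x ⁻¹ ≈ 1#
  ⁻¹-inverse {x} x≉0 with em {P = x ≈ 0#}
  ... | yes x≈0 = ⊥-elim (x≉0 x≈0)
  ... | no p    = proj₂ (inverse x p)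

  *-cancelʳ : ∀ {x y z} → ¬ z ≈ 0# → x * z ≈ y * z → x ≈ y
  *-cancelʳ {x} {y} {z} z≉0 p = trans (sym (lem x)) (trans (*-congʳ p) (lem y))
    where
    lem : ∀ w → w * z * z ⁻¹ ≈ w
    lem w = trans (*-assoc w z _) (trans (*-congˡ (⁻¹-inverse z≉0)) (*-identityʳ w))

  ⁻¹-≉0 : ∀ {x} → ¬ x ≈ 0# → ¬ x ⁻¹ ≈ 0#
  ⁻¹-≉0 x≉0 p = 1≉0 (trans (sym (⁻¹-inverse x≉0)) (trans (*-congˡ p) (zeroʳ _)))

  divide : ∀ {x z} → ¬ z ≈ 0# → x * z ⁻¹ * z ≈ x
  divide {x} {z} z≉0 = trans (*-assoc x _ z)
    (trans (*-congˡ (trans (*-comm _ z) (⁻¹-inverse z≉0))) (*-identityʳ x))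

  ≼-total : ∀ x y → x ≼ y ⊎ y ≼ x
  ≼-total x y with em {P = y ≈ 0#} | em {P = x ≈ 0#}
  ... | yes y≈0 | _ = inj₂ (≼-resp (sym y≈0) refl 0≼)
  ... | no _ | yes x≈0 = inj₁ (≼-resp (sym x≈0) refl 0≼)
  ... | no y≉0 | no x≉0 = case valuation (x * y ⁻¹) (y * x ⁻¹) eq of λ where
      (inj₁ p) → inj₁ (_ , p , sym (divide y≉0))
      (inj₂ p) → inj₂ (_ , p , sym (divide x≉0))
    where
    eq : x * y ⁻¹ * (y * x ⁻¹) ≈ 1#
    eq = trans (solve 4 (λ a b c d → a :* b :* (c :* d) := (a :* d) :* (c :* b)) refl
                  x (y ⁻¹) y (x ⁻¹))
           (trans (*-cong (⁻¹-inverse x≉0) (⁻¹-inverse y≉0)) (*-identityʳ 1#))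

  _⊀_ : Carrier → Carrier → Set u
  x ⊀ y = ¬ (y ≼ x)

  ⊀⇒≺ : ∀ {x y} → x ⊀ y → x ≺ y
  ⊀⇒≺ {x} {y} p = [ id , ⊥-elim ∘ p ]′ (≼-total x y) , p

  ≺⇒≼ : ∀ {x y} → x ≺ y → x ≼ y
  ≺⇒≼ = proj₁

  ≺-≼-trans : ∀ {x y z} → x ≺ y → y ≼ z → x ≺ z
  ≺-≼-trans (p , q) r = ≼-trans p r , λ s → q (≼-trans r s)

  ≼-≺-trans : ∀ {x y z} → x ≼ y → y ≺ z → x ≺ z
  ≼-≺-trans p (q , r) = ≼-trans p q , λ s → r (≼-trans s p)

  ≺-trans : ∀ {x y z} → x ≺ y → y ≺ z → x ≺ z
  ≺-trans p q = ≺-≼-trans p (≺⇒≼ q)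

  ≺-irrefl : ∀ {x} → ¬ x ≺ x
  ≺-irrefl (p , q) = q p

  ≺⇒≉0 : ∀ {x y} → x ≺ y → ¬ y ≈ 0#
  ≺⇒≉0 (_ , q) y≈0 = q (≼-resp (sym y≈0) refl 0≼)

  0≺ : ∀ {x} → ¬ x ≈ 0# → 0# ≺ x
  0≺ x≉0 = 0≼ , λ p → x≉0 (≼0⇒≈0 p)

  +-≼ : ∀ {x y z} → x ≼ z → y ≼ z → x + y ≼ z
  +-≼ {z = z} (a , p , q) (b , r , s) = a + b , 𝒪-+ p r ,
    trans (+-cong q s) (sym (distribʳ z a b))

  -‿≼ : ∀ {x z} → x ≼ z → - x ≼ z
  -‿≼ {x} {z} (a , p , q) = - a , 𝒪-neg p ,
    trans (-‿cong q) (solve 2 (λ a z → :- (a :* z) := (:- a) :* z) refl a z)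

  ≼-‿ : ∀ {x z} → - x ≼ z → x ≼ z
  ≼-‿ {x} p = ≼-resp (solve 1 (λ x → :- (:- x) := x) refl x) refl (-‿≼ p)

  -‿-≼ : ∀ {x y z} → x ≼ z → y ≼ z → x - y ≼ z
  -‿-≼ p q = +-≼ p (-‿≼ q)

  +-≺ : ∀ {x y z} → x ≺ z → y ≺ z → x + y ≺ z
  +-≺ {x} {y} p q with ≼-total x y
  ... | inj₁ r = ≼-≺-trans (+-≼ r ≼-refl) q
  ... | inj₂ r = ≼-≺-trans (+-≼ ≼-refl r) p

  -‿≺ : ∀ {x z} → x ≺ z → - x ≺ z
  -‿≺ p = ≼-≺-trans (-‿≼ ≼-refl) p

  -‿-≺ : ∀ {x y z} → x ≺ z → y ≺ z → x - y ≺ z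
  -‿-≺ p q = +-≺ p (-‿≺ q)

  sub-comm : ∀ x y → - (x - y) ≈ y - x
  sub-comm = solve 2 (λ x y → :- (x :- y) := y :- x) refl

  ≼-sub-comm : ∀ {x y z} → x - y ≼ z → y - x ≼ z
  ≼-sub-comm {x} {y} p = ≼-resp (sub-comm x y) refl (-‿≼ p)

  ≺-sub-comm : ∀ {x y z} → x - y ≺ z → y - x ≺ z
  ≺-sub-comm {x} {y} p = ≺-resp (sub-comm x y) refl (-‿≺ p)

  sub-telescope : ∀ x y z → (x - y) + (y - z) ≈ x - z
  sub-telescope = solve 3 (λ x y z → (x :- y) :+ (y :- z) := x :- z) refl

  ≼-sub-trans : ∀ {x y z g} → x - y ≼ g → y - z ≼ g → x - z ≼ g
  ≼-sub-trans {x} {y} {z} p q = ≼-resp (sub-telescope x y z) refl (+-≼ p q)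

  ≺-sub-trans : ∀ {x y z g} → x - y ≺ g → y - z ≺ g → x - z ≺ g
  ≺-sub-trans {x} {y} {z} p q = ≺-resp (sub-telescope x y z) refl (+-≺ p q)

  sub-self : ∀ x → x - x ≈ 0#
  sub-self = -‿inverseʳ

  sub-self-≺ : ∀ {x g} → ¬ g ≈ 0# → x - x ≺ g
  sub-self-≺ g≉0 = ≺-resp (sym (sub-self _)) refl (0≺ g≉0)

  -- Otherwise `y`, being the difference of `x + y` and `x`, would be smaller than itself.
  ≺⇒≼+ : ∀ {x y} → x ≺ y → y ≼ x + y
  ≺⇒≼+ {x} {y} p = by-contradiction λ q → ≺-irrefl
    (≺-resp (solve 2 (λ x y → (x :+ y) :- x := y) refl x y) refl (-‿-≺ (⊀⇒≺ q) p))

  ≺-sub⇒≼ : ∀ {x y} → x - y ≺ y → y ≼ x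
  ≺-sub⇒≼ {x} {y} p =
    ≼-resp refl (solve 2 (λ x y → (x :- y) :+ y := x) refl x y) (≺⇒≼+ p)

  *-≼ : ∀ {x y z w} → x ≼ y → z ≼ w → x * z ≼ y * w
  *-≼ {x} {y} {z} {w} (a , p , q) (b , r , s) = a * b , 𝒪-* p r , trans (*-cong q s)
    (solve 4 (λ a y b w → a :* y :* (b :* w) := a :* b :* (y :* w)) refl a y b w)

  *-≼ˡ : ∀ {x y} z → x ≼ y → z * x ≼ z * y
  *-≼ˡ z = *-≼ ≼-refl

  *-≼ʳ : ∀ {x y} z → x ≼ y → x * z ≼ y * z
  *-≼ʳ z p = *-≼ p ≼-refl

  *-≼-cancelʳ : ∀ {x y z} → ¬ z ≈ 0# → x * z ≼ y * z → x ≼ y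
  *-≼-cancelʳ {x} {y} {z} z≉0 (a , p , q) =
    a , p , *-cancelʳ z≉0 (trans q (sym (*-assoc a y z)))

  *-≼-cancelˡ : ∀ {x y z} → ¬ z ≈ 0# → z * x ≼ z * y → x ≼ y
  *-≼-cancelˡ z≉0 p = *-≼-cancelʳ z≉0 (≼-resp (*-comm _ _) (*-comm _ _) p)

  *-≺ʳ : ∀ {x y z} → ¬ z ≈ 0# → x ≺ y → x * z ≺ y * z
  *-≺ʳ z≉0 (p , q) = *-≼ʳ _ p , q ∘ *-≼-cancelʳ z≉0

  *-≺ˡ : ∀ {x y z} → ¬ z ≈ 0# → x ≺ y → z * x ≺ z * y
  *-≺ˡ z≉0 p = ≺-resp (*-comm _ _) (*-comm _ _) (*-≺ʳ z≉0 p)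

  𝒪⇒≼1 : ∀ {x} → 𝒪 x → x ≼ 1#
  𝒪⇒≼1 p = _ , p , sym (*-identityʳ _)

  ≼1⇒𝒪 : ∀ {x} → x ≼ 1# → 𝒪 x
  ≼1⇒𝒪 (a , p , q) = 𝒪-resp-≈ (sym (trans q (*-identityʳ a))) p

  ≼1-*ˡ : ∀ {x y z} → x ≼ 1# → y ≼ z → x * y ≼ z
  ≼1-*ˡ p q = ≼-resp refl (*-identityˡ _) (*-≼ p q)

  ≼1-*ʳ : ∀ {x y z} → x ≼ z → y ≼ 1# → x * y ≼ z
  ≼1-*ʳ p q = ≼-resp refl (*-identityʳ _) (*-≼ p q)

  ≽1-*ʳ : ∀ {x y z} → z ≼ x → 1# ≼ y → z ≼ x * y
  ≽1-*ʳ p q = ≼-resp (*-identityʳ _) refl (*-≼ p q)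

  ≽1-*ˡ : ∀ {x y z} → 1# ≼ x → z ≼ y → z ≼ x * y
  ≽1-*ˡ p q = ≼-resp (*-identityˡ _) refl (*-≼ p q)

-- Definable sets with parameters from `K`.

module Definability (em : ∀ {ℓ} → ExcludedMiddle ℓ) {u} (K : ValuedField u) where
  open ValuedField K hiding (zero)
  open Classical em
  open Solver commutativeRing
  open Order em K

  infixl 5 _▹ _▹[_]

  data Ctx : Set where
    ∅     : Ctx
    _▹    : Ctx → Ctx
    _▹[_] : Ctx → ℕ → Ctx

  ⟦_⟧ : Ctx → Set u
  ⟦ ∅ ⟧        = ⊤
  ⟦ Γ ▹ ⟧      = ⟦ Γ ⟧ × Carrier
  ⟦ Γ ▹[ n ] ⟧ = ⟦ Γ ⟧ × Vec Carrier n

  data Var : (Γ : Ctx) → (⟦ Γ ⟧ → Carrier) → Set u where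
    here    : ∀ {Γ} → Var (Γ ▹) proj₂
    there   : ∀ {Γ s} → Var Γ s → Var (Γ ▹) (s ∘ proj₁)
    here[_] : ∀ {Γ n} (i : Fin n) → Var (Γ ▹[ n ]) (λ e → lookup (proj₂ e) i)
    there[] : ∀ {Γ n s} → Var Γ s → Var (Γ ▹[ n ]) (s ∘ proj₁)

  infixl 6 _⊕_
  infixl 7 _⊗_

  data Poly (Γ : Ctx) : (⟦ Γ ⟧ → Carrier) → Set (lsuc u) where
    var   : ∀ {s} → Var Γ s → Poly Γ s
    const : ∀ k → Poly Γ (λ _ → k)
    _⊕_   : ∀ {s t} → Poly Γ s → Poly Γ t → Poly Γ (λ e → s e + t e)
    _⊗_   : ∀ {s t} → Poly Γ s → Poly Γ t → Poly Γ (λ e → s e * t e)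
    resp  : ∀ {s t} → (∀ e → s e ≈ t e) → Poly Γ s → Poly Γ t

  -- The index is the set itself, so definability of a predicate is shown by assembling a
  -- certificate along its own definition, and `resp` absorbs logical equivalences. Formulas of the
  -- language appear only in `Compilation`.
  data Def : (Γ : Ctx) → (⟦ Γ ⟧ → Set u) → Set (lsuc u) where
    eq   : ∀ {Γ s t} → Poly Γ s → Poly Γ t → Def Γ (λ e → s e ≈ t e)
    val  : ∀ {Γ s} → Poly Γ s → Def Γ (λ e → 𝒪 (s e))
    bot  : ∀ {Γ} → Def Γ (λ _ → Poly⊥.⊥)
    imp  : ∀ {Γ X Y} → Def Γ X → Def Γ Y → Def Γ (λ e → X e → Y e)
    univ : ∀ {Γ X} → Def (Γ ▹) X → Def Γ (λ e → ∀ x → X (e , x))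
    resp : ∀ {Γ X Y} → (∀ e → X e ⇔ Y e) → Def Γ X → Def Γ Y

  PolyMap : ∀ Γ Δ → (⟦ Γ ⟧ → ⟦ Δ ⟧) → Set (lsuc u)
  PolyMap Γ ∅          h = ⊤
  PolyMap Γ (Δ ▹)      h = PolyMap Γ Δ (proj₁ ∘ h) × Poly Γ (proj₂ ∘ h)
  PolyMap Γ (Δ ▹[ n ]) h =
    PolyMap Γ Δ (proj₁ ∘ h) × (∀ i → Poly Γ (λ e → lookup (proj₂ (h e)) i))

  wk : ∀ {Γ s} → Poly Γ s → Poly (Γ ▹) (s ∘ proj₁)
  wk (var v)    = var (there v)
  wk (const k)  = const k
  wk (p ⊕ q)    = wk p ⊕ wk q
  wk (p ⊗ q)    = wk p ⊗ wk q
  wk (resp f p) = resp (f ∘ proj₁) (wk p)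

  wk[] : ∀ {Γ n s} → Poly Γ s → Poly (Γ ▹[ n ]) (s ∘ proj₁)
  wk[] (var v)    = var (there[] v)
  wk[] (const k)  = const k
  wk[] (p ⊕ q)    = wk[] p ⊕ wk[] q
  wk[] (p ⊗ q)    = wk[] p ⊗ wk[] q
  wk[] (resp f p) = resp (f ∘ proj₁) (wk[] p)

  wkMap : ∀ {Γ} Δ {h} → PolyMap Γ Δ h → PolyMap (Γ ▹) Δ (h ∘ proj₁)
  wkMap ∅          pm       = tt
  wkMap (Δ ▹)      (pm , p) = wkMap Δ pm , wk p
  wkMap (Δ ▹[ n ]) (pm , p) = wkMap Δ pm , wk ∘ p

  wkMap[] : ∀ {Γ n} Δ {h} → PolyMap Γ Δ h → PolyMap (Γ ▹[ n ]) Δ (h ∘ proj₁)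
  wkMap[] ∅          pm       = tt
  wkMap[] (Δ ▹)      (pm , p) = wkMap[] Δ pm , wk[] p
  wkMap[] (Δ ▹[ n ]) (pm , p) = wkMap[] Δ pm , wk[] ∘ p

  idMap : ∀ Γ → PolyMap Γ Γ id
  idMap ∅          = tt
  idMap (Γ ▹)      = wkMap Γ (idMap Γ) , var here
  idMap (Γ ▹[ n ]) = wkMap[] Γ (idMap Γ) , λ i → var here[ i ]

  substVar : ∀ {Γ Δ h s} → PolyMap Γ Δ h → Var Δ s → Poly Γ (s ∘ h)
  substVar (pm , p) here        = p
  substVar (pm , p) (there v)   = substVar pm v
  substVar (pm , p) here[ i ]   = p i
  substVar (pm , p) (there[] v) = substVar pm v

  substPoly : ∀ {Γ Δ h s} → PolyMap Γ Δ h → Poly Δ s → Poly Γ (s ∘ h)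
  substPoly pm (var v)    = substVar pm v
  substPoly pm (const k)  = const k
  substPoly pm (p ⊕ q)    = substPoly pm p ⊕ substPoly pm q
  substPoly pm (p ⊗ q)    = substPoly pm p ⊗ substPoly pm q
  substPoly {h = h} pm (resp f p) = resp (f ∘ h) (substPoly pm p)

  substDef : ∀ {Γ Δ h X} → PolyMap Γ Δ h → Def Δ X → Def Γ (X ∘ h)
  substDef pm (eq p q)    = eq (substPoly pm p) (substPoly pm q)
  substDef pm (val p)     = val (substPoly pm p)
  substDef pm bot         = bot
  substDef pm (imp d d′)  = imp (substDef pm d) (substDef pm d′)
  substDef {Δ = Δ} pm (univ d) = univ (substDef (wkMap Δ pm , var here) d)
  substDef {h = h} pm (resp f d) = resp (f ∘ h) (substDef pm d)

  v₀ : ∀ {Γ} → Poly (Γ ▹) proj₂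
  v₀ = var here

  v₁ : ∀ {Γ} → Poly (Γ ▹ ▹) (proj₂ ∘ proj₁)
  v₁ = wk v₀

  v₂ : ∀ {Γ} → Poly (Γ ▹ ▹ ▹) (proj₂ ∘ proj₁ ∘ proj₁)
  v₂ = wk v₁

  block : ∀ {Γ n} i → Poly (Γ ▹[ n ]) (λ e → lookup (proj₂ e) i)
  block i = var here[ i ]

  infixl 6 _⊖_

  _⊖_ : ∀ {Γ s t} → Poly Γ s → Poly Γ t → Poly Γ (λ e → s e - t e)
  _⊖_ {s = s} {t} p q = resp
    (λ e → solve 2 (λ s t → s :+ (:- :1) :* t := s :- t) refl (s e) (t e))
    (p ⊕ const (- 1#) ⊗ q)

  polyCons : ∀ {Γ n s} {v : ⟦ Γ ⟧ → Vec Carrier n} → Poly Γ s →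
    (∀ i → Poly Γ (λ e → lookup (v e) i)) → ∀ i → Poly Γ (λ e → lookup (s e ∷ v e) i)
  polyCons p q zero    = p
  polyCons p q (suc i) = q i

  defNot : ∀ {Γ X} → Def Γ X → Def Γ (λ e → ¬ X e)
  defNot d = resp (λ e → mk⇔ (λ f x → case f x of λ ()) (λ f x → ⊥-elim (f x))) (imp d bot)

  defAnd : ∀ {Γ X Y} → Def Γ X → Def Γ Y → Def Γ (λ e → X e × Y e)
  defAnd d d′ = resp (λ e → mk⇔
    (λ f → by-contradiction λ g → f λ x y → g (x , y))
    (λ (x , y) f → f x y)) (defNot (imp d (defNot d′)))

  defOr : ∀ {Γ X Y} → Def Γ X → Def Γ Y → Def Γ (λ e → X e ⊎ Y e)
  defOr d d′ = resp (λ e → mk⇔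
    (λ f → by-contradiction λ g → g (inj₂ (f λ x → g (inj₁ x))))
    (λ { (inj₁ x) ¬x → ⊥-elim (¬x x) ; (inj₂ y) _ → y })) (imp (defNot d) d′)

  defEx : ∀ {Γ X} → Def (Γ ▹) X → Def Γ (λ e → ∃[ x ] X (e , x))
  defEx d = resp (λ e → mk⇔
    (λ f → by-contradiction λ g → f λ x y → g (x , y))
    (λ (x , y) f → f x y)) (defNot (univ (defNot d)))

  defAll[] : ∀ {Γ} n {X} → Def (Γ ▹[ n ]) X → Def Γ (λ e → ∀ v → X (e , v))
  defAll[] {Γ} zero d = resp (λ e → mk⇔ (λ { x [] → x }) (λ f → f []))
    (substDef {h = λ e → e , []} (idMap Γ , λ ()) d)
  defAll[] {Γ} (suc n) d = resp (λ e → mk⇔ (λ { f (x ∷ v) → f x v }) (λ f x v → f (x ∷ v)))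
    (univ (defAll[] n (substDef {h = λ ((e , x) , v) → e , x ∷ v}
      (wkMap[] Γ (wkMap Γ (idMap Γ)) ,
       polyCons (var (there[] here)) (λ i → var here[ i ])) d)))

  defEx[] : ∀ {Γ} n {X} → Def (Γ ▹[ n ]) X → Def Γ (λ e → ∃[ v ] X (e , v))
  defEx[] n d = resp (λ e → mk⇔
    (λ f → by-contradiction λ g → f λ x y → g (x , y))
    (λ (x , y) f → f x y)) (defNot (defAll[] n (defNot d)))

  defAllFin : ∀ {Γ n} {X : Fin n → ⟦ Γ ⟧ → Set u} →
    (∀ i → Def Γ (X i)) → Def Γ (λ e → ∀ i → X i e)
  defAllFin {n = zero} d = resp (λ e → mk⇔ (λ _ ()) (λ _ x → x)) (imp bot bot)
  defAllFin {n = suc n} d = resp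
    (λ e → mk⇔ (λ { (x , f) zero → x ; (x , f) (suc i) → f i }) (λ f → f zero , f ∘ suc))
    (defAnd (d zero) (defAllFin (d ∘ suc)))

  defAllBool : ∀ {Γ} {X : Bool → ⟦ Γ ⟧ → Set u} →
    (∀ b → Def Γ (X b)) → Def Γ (λ e → ∀ b → X b e)
  defAllBool d = resp
    (λ e → mk⇔ (λ { (x , y) true → x ; (x , y) false → y }) (λ f → f true , f false))
    (defAnd (d true) (d false))

  defExBool : ∀ {Γ} {X : Bool → ⟦ Γ ⟧ → Set u} →
    (∀ b → Def Γ (X b)) → Def Γ (λ e → ∃[ b ] X b e)
  defExBool d = resp
    (λ e → mk⇔ [ true ,_ , false ,_ ]′ (λ { (true , x) → inj₁ x ; (false , x) → inj₂ x }))
    (defOr (d true) (d false))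

  def≼ : ∀ {Γ s t} → Poly Γ s → Poly Γ t → Def Γ (λ e → s e ≼ t e)
  def≼ p q = defEx (defAnd (val (var here)) (eq (wk p) (var here ⊗ wk q)))

  def≺ : ∀ {Γ s t} → Poly Γ s → Poly Γ t → Def Γ (λ e → s e ≺ t e)
  def≺ p q = defAnd (def≼ p q) (defNot (def≼ q p))

  -- The inequality says that `x` and `y` differ from `d` and have the same leading term there. So
  -- `X` is a union of open balls away from the centres, and nothing is claimed at the centres
  -- themselves.
  Prepared : (Carrier → Set u) → Set u
  Prepared X = Σ[ c ∈ Carrier ] Σ[ cs ∈ List Carrier ]
    (∀ x y → All (λ d → x - y ≺ x - d) (c ∷ cs) → X x → X y)

  AllPrepared : Set (lsuc u)
  AllPrepared = ∀ {X} → Def (∅ ▹) X → Prepared (λ x → X (tt , x))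

-- Translation of certificates into formulas, and of leading terms into balls.

module LeadingTerms (em : ∀ {ℓ} → ExcludedMiddle ℓ) {u} (K : ValuedField u) where
  open ValuedField K hiding (zero)
  open Solver commutativeRing
  open Order em K

  ≺-sub⇒≈RV : ∀ {x y c} → x - y ≺ x - c → _≈RV_ K (rv K (x - c)) (rv K (y - c))
  ≺-sub⇒≈RV {x} {y} {c} p = inj₂ (≺⇒≉0 p , w≉0 , m , m≺1 , eq)
    where
    q : x - y ≺ y - c
    q = ≺-≼-trans p (≺-sub⇒≼ (≺-resp (solve 3 (λ x y c → :- (x :- y) := (y :- c) :- (x :- c))
          refl x y c) refl (-‿≺ p)))
    w≉0 : ¬ y - c ≈ 0#
    w≉0 = ≺⇒≉0 q
    m = (x - y) * (y - c) ⁻¹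
    m≺1 : m ≺ 1#
    m≺1 = ≺-resp refl (⁻¹-inverse w≉0) (*-≺ʳ (⁻¹-≉0 w≉0) q)
    eq : x - c ≈ (1# + m) * (y - c)
    eq = trans (sym (sub-telescope x y c)) (trans (+-congʳ (sym (divide w≉0)))
      (solve 2 (λ m w → m :* w :+ w := (:1 :+ m) :* w) refl m (y - c)))

module Compilation (em : ∀ {ℓ} → ExcludedMiddle ℓ) {u} {L : Language u} (M : Structure L)
                   (V V′ : IsValuedFieldStructure M) where
  open Language L
  K = IsValuedFieldStructure.valuedField V
  open ValuedField K hiding (zero)
  open Definability em K
  open Equivalence using (to; from)
  private
    module M = Structure M
    module K′ = ValuedField (IsValuedFieldStructure.valuedField V′)
    Holds : ∀ {n} → Vec Carrier n → RVFormula L n 0 → Set u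
    Holds ρ φ = SatisfiesRV M V′ ρ [] φ

  size : Ctx → ℕ
  size ∅          = 0
  size (Γ ▹)      = suc (size Γ)
  size (Γ ▹[ n ]) = n ℕ.+ size Γ

  toVec : ∀ {Γ} → ⟦ Γ ⟧ → Vec Carrier (size Γ)
  toVec {∅}        _       = []
  toVec {Γ ▹}      (e , x) = x ∷ toVec e
  toVec {Γ ▹[ n ]} (e , v) = v Vec.++ toVec e

  index : ∀ {Γ s} → Var Γ s → Σ[ i ∈ Fin (size Γ) ] ∀ e → lookup (toVec e) i ≡ s e
  index Var.here = zero , λ _ → ≡.refl
  index (Var.there v) = let i , p = index v in suc i , λ (e , _) → p e
  index {Γ ▹[ n ]} here[ i ] = i ↑ˡ size Γ , λ (e , v) → Vec.lookup-++ˡ v (toVec e) i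
  index {Γ ▹[ n ]} (there[] w) = let i , p = index w in n ↑ʳ i ,
    λ (e , v) → ≡.trans (Vec.lookup-++ʳ v (toVec e) i) (p e)

  constants : ∀ {Γ s} → Poly Γ s → List Carrier
  constants (var v)    = []
  constants (const k)  = k ∷ []
  constants (p ⊕ q)    = constants p List.++ constants q
  constants (p ⊗ q)    = constants p List.++ constants q
  constants (resp f p) = constants p

  parameters : ∀ {Γ X} → Def Γ X → List Carrier
  parameters (eq p q)   = constants p List.++ constants q
  parameters (val p)    = constants p
  parameters bot        = []
  parameters (imp d d′) = parameters d List.++ parameters d′
  parameters (univ d)   = parameters d
  parameters (resp f d) = parameters d

  module _ {n : ℕ} (b : Vec Carrier n) where

    Listed : List Carrier → Set u
    Listed = All (λ k → Σ[ i ∈ Fin n ] lookup b i ≡ k)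

    term : ∀ {Γ s} (p : Poly Γ s) → Listed (constants p) →
      Σ[ t ∈ Term L (size Γ ℕ.+ n) ] ∀ e → evalTerm M (toVec e Vec.++ b) t ≈ s e
    term (var v) _ = let i , p = index v in var (i ↑ˡ n) ,
      λ e → reflexive (≡.trans (Vec.lookup-++ˡ (toVec e) b i) (p e))
    term {Γ} (const k) ((i , p) ∷ []) = var (size Γ ↑ʳ i) ,
      λ e → reflexive (≡.trans (Vec.lookup-++ʳ (toVec e) b i) p)
    term (p ⊕ q) l =
      let l₁ , l₂ = All.++⁻ (constants p) l
          s , s≈ = term p l₁
          t , t≈ = term q l₂
      in app plus (s ∷ t ∷ []) , λ e → +-cong (s≈ e) (t≈ e)
    term (p ⊗ q) l =
      let l₁ , l₂ = All.++⁻ (constants p) l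
          s , s≈ = term p l₁
          t , t≈ = term q l₂
      in app times (s ∷ t ∷ []) , λ e → *-cong (s≈ e) (t≈ e)
    term (resp f p) l = let t , t≈ = term p l in t , λ e → trans (t≈ e) (f e)

    formula : ∀ {Γ X} (d : Def Γ X) → Listed (parameters d) →
      Σ[ φ ∈ RVFormula L (size Γ ℕ.+ n) 0 ] ∀ e → X e ⇔ Holds (toVec e Vec.++ b) φ
    formula (eq p q) l =
      let l₁ , l₂ = All.++⁻ (constants p) l
          s , s≈ = term p l₁
          t , t≈ = term q l₂
      in s ≐ t , λ e → mk⇔ (λ x → trans (s≈ e) (trans x (sym (t≈ e))))
                           (λ x → trans (sym (s≈ e)) (trans x (t≈ e)))
    formula (val p) l = let t , t≈ = term p l in rel valring (t ∷ []) , λ e → mk⇔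
      (M.relation-resp valring (sym (t≈ e) Pointwise.∷ Pointwise.[]))
      (M.relation-resp valring (t≈ e Pointwise.∷ Pointwise.[]))
    formula bot _ = bot , λ e → mk⇔ id id
    formula (imp d d′) l =
      let l₁ , l₂ = All.++⁻ (parameters d) l
          φ , f = formula d l₁
          ψ , g = formula d′ l₂
      in (φ ⇒ ψ) , λ e → mk⇔ (λ h x → to (g e) (h (from (f e) x)))
                             (λ h x → from (g e) (h (to (f e) x)))
    formula (univ d) l = let φ , f = formula d l in
      (all φ) , λ e → mk⇔ (λ h x → to (f (e , x)) (h x)) (λ h x → from (f (e , x)) (h x))
    formula (resp r d) l = let φ , f = formula d l in
      φ , λ e → mk⇔ (to (f e) ∘ from (r e)) (to (r e) ∘ from (f e))

  def⇒RVDefinable : ∀ {X} → Def (∅ ▹) X → RVDefinable M V′ (λ _ → ⊤) (λ x → X (tt , x))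
  def⇒RVDefinable d = _ , 0 , φ , b , [] , all⊤ b , λ x → f (tt , x)
    where
    b = Vec.fromList (parameters d)
    listed : ∀ ks → Listed (Vec.fromList ks) ks
    listed []       = []
    listed (k ∷ ks) = (zero , ≡.refl) ∷ All.map (λ (i , p) → suc i , p) (listed ks)
    φ = proj₁ (formula b d (listed (parameters d)))
    f = proj₂ (formula b d (listed (parameters d)))
    all⊤ : ∀ {n} (v : Vec Carrier n) → VecAll.All (λ _ → ⊤) v
    all⊤ []      = VecAll.[]
    all⊤ (x ∷ v) = tt VecAll.∷ all⊤ v

module Preparation (em : ∀ {ℓ} → ExcludedMiddle ℓ) {u} {L : Language u} (M : Structure L)
                   (V : IsValuedFieldStructure M) (hmin : ZeroHMinimal (Th M)) where
  private
    V′ = ZeroHMinimal.valued hmin M (λ _ p → p)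
    K′ = IsValuedFieldStructure.valuedField V′
    module K′ = ValuedField K′
    K = IsValuedFieldStructure.valuedField V
  open ValuedField K hiding (zero)
  open Order em K
  open Definability em K
  open Compilation em M V V′ using (def⇒RVDefinable)

  -- Subtraction is determined by addition, so the two valued field structures on `M` share it.
  sub-unique : ∀ x y → x K′.- y ≈ x - y
  sub-unique x y = trans (sym (trans (+-assoc _ y _) (trans (+-congˡ (-‿inverseʳ y)) (+-identityʳ _))))
    (+-congʳ (trans (K′.+-assoc x _ y) (trans (K′.+-congˡ (K′.-‿inverseˡ y)) (K′.+-identityʳ x))))

  prepared : AllPrepared
  prepared {X} d = go cs (λ x → Equivalence.to (cs-spec x))
    where
    open SetoidMembership setoid using (_∈_)
    result = ZeroHMinimal.prepare hmin M (λ _ p → p) (λ _ → ⊤) _ (def⇒RVDefinable d)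
    C = proj₁ result
    module P = OnePrepares (proj₂ (proj₂ result))
    cs = proj₁ P.finite
    cs-spec = proj₂ P.finite
    go : ∀ cs → (∀ x → C x → x ∈ cs) → Prepared (λ x → X (tt , x))
    go [] h = case h _ (proj₂ P.nonEmpty) of λ ()
    go (c ∷ cs) h = c , cs , λ x y close → Equivalence.to (P.prepares x y λ d Cd →
      LeadingTerms.≺-sub⇒≈RV em K′ (≺-resp (sym (sub-unique x y)) (sym (sub-unique x d))
        (lookupAll close (h d Cd))))
      where
      lookupAll : ∀ {x y d ds} → All (λ d → x - y ≺ x - d) ds → d ∈ ds → x - y ≺ x - d
      lookupAll (p ∷ _) (here q) = ≺-resp refl (+-congˡ (-‿cong (sym q))) p
      lookupAll (_ ∷ ps) (there q) = lookupAll ps q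

-- Radii, and sets covered by finitely many cosets.

module Radii (em : ∀ {ℓ} → ExcludedMiddle ℓ) {u} (K : ValuedField u) where
  open ValuedField K hiding (zero)
  open Order em K
  open Definability em K

  -- A definable final segment of the value group without least element,
  -- as a set of admissible radii.  Its complement is a convex subgroup of K.
  record IsRadii (Rad : Carrier → Set u) : Set (lsuc u) where
    field
      definable : Def (∅ ▹) (Rad ∘ proj₂)
      upward    : ∀ {g h} → Rad g → g ≼ h → Rad h
      below     : ∀ {g} → Rad g → ∃[ h ] Rad h × h ≺ g
      one       : Rad 1#

module Generic (em : ∀ {ℓ} → ExcludedMiddle ℓ) {u} (K : ValuedField u)
  (prepared : Definability.AllPrepared em K)
  {Rad : ValuedField.Carrier K → Set u} (isRadii : Radii.IsRadii em K Rad) where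
  open ValuedField K hiding (zero)
  open Classical em
  open Solver commutativeRing
  open Order em K
  open Definability em K
  open Radii em K
  open IsRadii isRadii

  defRad : ∀ {Γ s} → Poly Γ s → Def Γ (Rad ∘ s)
  defRad {s = s} p = substDef {h = λ e → tt , s e} (tt , p) definable

  Rad-resp : ∀ {g h} → g ≈ h → Rad g → Rad h
  Rad-resp p r = upward r (≼-reflexive p)

  Rad⇒≉0 : ∀ {g} → Rad g → ¬ g ≈ 0#
  Rad⇒≉0 r = let _ , _ , p = below r in ≺⇒≉0 p

  ¬Rad≺Rad : ∀ {x g} → ¬ Rad x → Rad g → x ≺ g
  ¬Rad≺Rad x g = ⊀⇒≺ (x ∘ upward g)

  ¬Rad-+ : ∀ {x y} → ¬ Rad x → ¬ Rad y → ¬ Rad (x + y)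
  ¬Rad-+ p q r = ≺-irrefl (+-≺ (¬Rad≺Rad p r) (¬Rad≺Rad q r))

  ¬Rad-neg : ∀ {x} → ¬ Rad x → ¬ Rad (- x)
  ¬Rad-neg p r = p (upward r (-‿≼ ≼-refl))

  ¬Rad-sub-comm : ∀ {x y} → ¬ Rad (x - y) → ¬ Rad (y - x)
  ¬Rad-sub-comm {x} {y} p r = ¬Rad-neg p (Rad-resp (sym (sub-comm x y)) r)

  ¬Rad-sub-trans : ∀ {x y z} → ¬ Rad (x - y) → ¬ Rad (y - z) → ¬ Rad (x - z)
  ¬Rad-sub-trans {x} {y} {z} p q r = ¬Rad-+ p q (Rad-resp (sym (sub-telescope x y z)) r)

  ¬Rad0 : ¬ Rad 0#
  ¬Rad0 r = Rad⇒≉0 r refl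

  min-Rad : ∀ {g h} → Rad g → Rad h → ∃[ k ] Rad k × k ≼ g × k ≼ h
  min-Rad {g} {h} p q with ≼-total g h
  ... | inj₁ r = g , p , ≼-refl , r
  ... | inj₂ r = h , q , r , ≼-refl

  min-below : ∀ {g h} → Rad g → Rad h → ∃[ k ] Rad k × k ≺ g × k ≺ h
  min-below p q =
    let m , r , s , t = min-Rad p q
        k , r′ , k≺m = below r
    in k , r′ , ≺-≼-trans k≺m s , ≺-≼-trans k≺m t

  Ball : Carrier → Carrier → Carrier → Set u
  Ball x g y = y - x ≺ g

  ball-centre : ∀ {x g} → Rad g → Ball x g x
  ball-centre r = sub-self-≺ (Rad⇒≉0 r)

  shift : ∀ x h → (x + h) - x ≈ h
  shift = solve 2 (λ x h → (x :+ h) :- x := h) refl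

  coset-≼ : ∀ {c y y′} → Rad (y - c) → ¬ Rad (y - y′) → y′ - c ≼ y - c
  coset-≼ {c} {y} {y′} p q = ≼-sub-trans (≼-sub-comm (≺⇒≼ (¬Rad≺Rad q p))) ≼-refl

  Covered : (Carrier → Set u) → List Carrier → Set u
  Covered S cs = ∀ x → S x → Any (λ c → ¬ Rad (x - c)) cs

  -- The sets of dimension zero. Points are distinguished only up to differences outside `Rad`, so
  -- finitely many cosets take the place of finitely many points.
  Small : (Carrier → Set u) → Set u
  Small S = ∃[ cs ] Covered S cs

  small-⊆ : ∀ {S T} → (∀ x → S x → T x) → Small T → Small S
  small-⊆ f (cs , h) = cs , λ x → h x ∘ f x

  small-∪ : ∀ {S T} → Small S → Small T → Small (λ x → S x ⊎ T x)
  small-∪ (cs , h) (ds , k) = cs List.++ ds , λ x →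
    [ Any.++⁺ˡ ∘ h x , Any.++⁺ʳ cs ∘ k x ]′

  all-or-any : ∀ {P : Carrier → Set u} cs → All P cs ⊎ Any (λ c → ¬ P c) cs
  all-or-any [] = inj₁ []
  all-or-any {P} (c ∷ cs) with em {P = P c} | all-or-any cs
  ... | no ¬p | _ = inj₂ (here ¬p)
  ... | yes p | inj₁ ps = inj₁ (p ∷ ps)
  ... | yes p | inj₂ q = inj₂ (there q)

  min-distance : ∀ x cs → All (λ c → Rad (x - c)) cs →
    ∃[ g ] Rad g × All (λ c → g ≼ x - c) cs
  min-distance x [] [] = 1# , one , []
  min-distance x (c ∷ cs) (p ∷ ps) =
    let g , r , q = min-distance x cs ps
        k , r′ , s , t = min-Rad r p
    in k , r′ , t ∷ All.map (≼-trans s) q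

  ContainsBall : (Carrier → Set u) → Set u
  ContainsBall X = ∃[ x ] ∃[ g ] Rad g × X x × (∀ y → Ball x g y → X y)

  -- If some point of the set has distances in `Rad` from all centres, preparation puts the ball of
  -- the least such distance into the set. Otherwise the cosets of the centres cover it.
  small⊎ball : ∀ {X} → Def (∅ ▹) X → let X′ = λ x → X (tt , x) in Small X′ ⊎ ContainsBall X′
  small⊎ball {X} d with prepared d
  ... | c , cs , prep with em {P = ∃[ x ] X (tt , x) × All (λ d → Rad (x - d)) (c ∷ cs)}
  ...   | no ¬p = inj₁ (c ∷ cs , λ x Xx → [ (λ q → ⊥-elim (¬p (x , Xx , q))) , id ]′ (all-or-any _))
  ...   | yes (x , Xx , away) =
    let g , r , q = min-distance x _ away
    in inj₂ (x , g , r , Xx , λ y b → prep x y (All.map (≺-≼-trans (≺-sub-comm b)) q) Xx)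

  -- The centres are treated one at a time. If `x` lies in the coset of `c`, it is moved by a radius
  -- `h` below `g`; the ball of radius `h` around the new point misses that coset.
  avoid-list : ∀ cs {x g} → Rad g → ∃[ x′ ] ∃[ g′ ] Rad g′ × (∀ y → Ball x′ g′ y →
    Ball x g y × All (λ c → Rad (y - c)) cs)
  avoid-list [] {x} {g} r = x , g , r , λ y b → b , []
  avoid-list (c ∷ cs) {x} {g} r =
    let x₁ , g₁ , r₁ , in₁ , away₁ = step
        x₂ , g₂ , r₂ , f = avoid-list cs r₁
    in x₂ , g₂ , r₂ , λ y b → let b₁ , away = f y b in in₁ y b₁ , away₁ y b₁ ∷ away
    where
    step : ∃[ x′ ] ∃[ g′ ] Rad g′ × (∀ y → Ball x′ g′ y → Ball x g y)
             × (∀ y → Ball x′ g′ y → Rad (y - c))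
    step with em {P = Rad (x - c)}
    ... | yes p = let k , r′ , s , t = min-Rad r p in
      x , k , r′ , (λ y b → ≺-≼-trans b s) ,
      λ y b → upward p (≼-resp refl (sub-telescope y x c) (≺⇒≼+ (≺-≼-trans b t)))
    ... | no ¬p = let h , r′ , h≺g = below r in
      x + h , h , r′ ,
      (λ y b → ≺-sub-trans (≺-trans b h≺g) (≺-resp (sym (shift x h)) refl h≺g)) ,
      λ y b → by-contradiction λ q → ¬Rad-sub-trans q (¬Rad-sub-comm ¬p)
        (upward r′ (≼-resp (shift x h) (sub-telescope y (x + h) x)
          (≺⇒≼+ (≺-resp refl (sym (shift x h)) b))))

  ball-not-small : ∀ {x g} → Rad g → ¬ Small (Ball x g)
  ball-not-small r (cs , h) =
    let x′ , g′ , r′ , f = avoid-list cs r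
        b , away = f x′ (ball-centre r′)
    in contra away (h x′ b)
    where
    contra : ∀ {P : Carrier → Set u} {cs} → All P cs → ¬ Any (λ c → ¬ P c) cs
    contra (p ∷ _)  (here q)  = q p
    contra (_ ∷ ps) (there q) = contra ps q

  uncover : ∀ {S d ds} → Covered S (d ∷ ds) → Covered (λ y → S y × Rad (y - d)) ds
  uncover h x (Sx , r) = case h x Sx of λ { (here q) → ⊥-elim (q r) ; (there q) → q }

  -- By `coset-≼` the distance to `c` has only one size on each coset, so there are finitely many
  -- sizes to compare.
  nearest-covered : ∀ {S} c cs → Covered S cs → (∀ y → S y → Rad (y - c)) → ∃ S →
    ∃[ y ] S y × (∀ y′ → S y′ → y - c ≼ y′ - c)
  nearest-covered c [] h _ (y , Sy) = case h y Sy of λ ()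
  nearest-covered {S} c (d ∷ ds) h away (y₀ , Sy₀) with em {P = ∃[ y ] S y × Rad (y - d)}
  ... | no ¬p = y₀ , Sy₀ , λ y′ Sy′ → coset-≼ (away y′ Sy′)
          (¬Rad-sub-trans (λ r → ¬p (y′ , Sy′ , r)) (¬Rad-sub-comm λ r → ¬p (y₀ , Sy₀ , r)))
  ... | yes (y₁ , Sy₁ , r₁) with nearest-covered c ds (uncover h) (λ y → away y ∘ proj₁) (y₁ , Sy₁ , r₁)
  ...   | y , (Sy , r) , least with em {P = ∃[ z ] S z × ¬ Rad (z - d) × z - c ≼ y - c}
  ...     | yes (z , Sz , ¬r , z≼y) = z , Sz , λ y′ Sy′ → case em {P = Rad (y′ - d)} of λ where
              (yes r′) → ≼-trans z≼y (least y′ (Sy′ , r′))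
              (no ¬r′) → coset-≼ (away y′ Sy′) (¬Rad-sub-trans ¬r′ (¬Rad-sub-comm ¬r))
  ...     | no ¬p = y , Sy , λ y′ Sy′ → case em {P = Rad (y′ - d)} of λ where
              (yes r′) → least y′ (Sy′ , r′)
              (no ¬r′) → ≺⇒≼ (⊀⇒≺ λ q → ¬p (y′ , Sy′ , ¬r′ , q))

  nearest : ∀ {S} c → Small S → (∀ y → S y → Rad (y - c)) → ∃ S →
    ∃[ y ] S y × (∀ y′ → S y′ → y - c ≼ y′ - c)
  nearest c (cs , h) = nearest-covered c cs h

  -- One coset is split off. The rest has a least distance `g₂` from it by `nearest`, and a
  -- separation `g₁` within itself by induction.
  separation-covered : ∀ {S} cs → Covered S cs →
    ∃[ g ] Rad g × (∀ y y′ → S y → S y′ → Rad (y - y′) → g ≼ y - y′)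
  separation-covered [] h = 1# , one , λ y _ Sy → case h y Sy of λ ()
  separation-covered {S} (d ∷ ds) h = g , r , sep
    where
    S′ : Carrier → Set u
    S′ y = S y × Rad (y - d)
    rest = separation-covered ds (uncover h)
    g₁ = proj₁ rest
    r₁ = proj₁ (proj₂ rest)
    sep₁ = proj₂ (proj₂ rest)
    distance : ∃[ g ] Rad g × (∀ y → S′ y → g ≼ y - d)
    distance with em {P = ∃ S′}
    ... | no ¬p = 1# , one , λ y Sy → ⊥-elim (¬p (y , Sy))
    ... | yes p = let y , (_ , r) , least = nearest d (ds , uncover h) (λ _ → proj₂) p in _ , r , least
    g₂ = proj₁ distance
    m = min-Rad r₁ (proj₁ (proj₂ distance))
    g = proj₁ m
    r = proj₁ (proj₂ m)
    g≼g₁ = proj₁ (proj₂ (proj₂ m))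
    g≼g₂ = proj₂ (proj₂ (proj₂ m))
    mixed : ∀ {y y′} → S′ y → ¬ Rad (y′ - d) → g ≼ y - y′
    mixed {y} {y′} (Sy , q) ¬q = ≼-trans g≼g₂ (≼-trans (proj₂ (proj₂ distance) y (Sy , q))
      (≼-resp refl (trans (+-comm _ _) (sub-telescope y d y′))
        (≺⇒≼+ (≺-sub-comm (¬Rad≺Rad ¬q q)))))
    sep : ∀ y y′ → S y → S y′ → Rad (y - y′) → g ≼ y - y′
    sep y y′ Sy Sy′ q with em {P = Rad (y - d)} | em {P = Rad (y′ - d)}
    ... | yes p | yes p′ = ≼-trans g≼g₁ (sep₁ y y′ (Sy , p) (Sy′ , p′) q)
    ... | yes p | no ¬p′ = mixed (Sy , p) ¬p′
    ... | no ¬p | yes p′ = ≼-resp refl (sub-comm y′ y) (neg-≽ (mixed (Sy′ , p′) ¬p))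
      where
      neg-≽ : ∀ {x z} → z ≼ x → z ≼ - x
      neg-≽ p = ≼-trans p (≼-‿ ≼-refl)
    ... | no ¬p | no ¬p′ = ⊥-elim (¬Rad-sub-trans ¬p (¬Rad-sub-comm ¬p′) q)

  separation : ∀ {S} → Small S →
    ∃[ g ] Rad g × (∀ y y′ → S y → S y′ → Rad (y - y′) → g ≼ y - y′)
  separation (cs , h) = separation-covered cs h

  Box : ∀ {n} → Vec Carrier n → Carrier → Vec Carrier n → Set u
  Box c g v = ∀ i → lookup v i - lookup c i ≺ g

  box-centre : ∀ {n} (c : Vec Carrier n) {g} → Rad g → Box c g c
  box-centre c r i = ball-centre r

  -- The sets grow as the radius shrinks. There are two of them at each radius because `Avoid` has
  -- to choose between two candidate points.
  record Family n : Set (lsuc u) where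
    field
      Z    : Bool → Vec Carrier n → Carrier → Set u
      def  : ∀ b → Def (∅ ▹[ n ] ▹) (λ ((_ , v) , g) → Z b v g)
      mono : ∀ {b v g h} → h ≼ g → Rad h → Z b v g → Z b v h

    Covers : Vec Carrier n → Carrier → Set u
    Covers c g = ∀ v → Box c g v → ∃[ b ] ∃[ h ] Rad h × Z b v h

    ContainsBox : Vec Carrier n → Carrier → Set u
    ContainsBox c g = ∃[ b ] ∃[ h ] ∃[ c′ ] ∃[ g′ ] Rad h × Rad g′ ×
      (∀ v → Box c′ g′ v → Box c g v × Z b v h)

  -- A category theorem, with unions over all radii in place of countable
  -- unions.
  Baire : ℕ → Set (lsuc u)
  Baire n = ∀ (F : Family n) c {g} → Rad g → Family.Covers F c g → Family.ContainsBox F c g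

  baire₀ : Baire 0
  baire₀ F [] {g} r cover = let b , h , r′ , z = cover [] λ () in
    b , h , [] , g , r′ , r , λ { [] _ → (λ ()) , z }

-- The category theorem for boxes.

module Dimension (em : ∀ {ℓ} → ExcludedMiddle ℓ) {u} (K : ValuedField u)
  (prepared : Definability.AllPrepared em K)
  {Rad : ValuedField.Carrier K → Set u} (isRadii : Radii.IsRadii em K Rad) where
  open ValuedField K hiding (zero)
  open Classical em
  open Order em K
  open Definability em K
  open Radii em K
  open IsRadii isRadii
  open Generic em K prepared isRadii

  defBall : ∀ {Γ x g y} → Poly Γ x → Poly Γ g → Poly Γ y →
    Def Γ (λ e → Ball (x e) (g e) (y e))
  defBall x g y = def≺ (y ⊖ x) g

  box-mono : ∀ {n} {c v : Vec Carrier n} {g h} → g ≼ h → Box c g v → Box c h v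
  box-mono p b i = ≺-≼-trans (b i) p

  Resolves : Carrier → Carrier → Carrier → Set u
  Resolves c ε d = Rad (d - c) → ε ≼ d - c

  resolution : ∀ c cs {g} → Rad g → ∃[ ε ] Rad ε × ε ≼ g × All (Resolves c ε) cs
  resolution c [] {g} r = g , r , ≼-refl , []
  resolution c (d ∷ cs) r with em {P = Rad (d - c)} | resolution c cs r
  ... | no ¬p | ε , rε , ε≼g , res = ε , rε , ε≼g , (⊥-elim ∘ ¬p) ∷ res
  ... | yes p | ε , rε , ε≼g , res =
    let m , rm , m≼ε , m≼d = min-Rad rε p
    in m , rm , ≼-trans m≼ε ε≼g , (λ _ → m≼d) ∷ All.map (λ f q → ≼-trans m≼ε (f q)) res

  -- A centre in the same coset as `x` would be as close to `c` as `x`, hence closer than `ε`. By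
  -- the choice of `ε` it would then lie in the coset of `c`, which `x` avoids.
  unresolved : ∀ {c x ε cs} → Rad (x - c) → x - c ≺ ε → All (Resolves c ε) cs →
    ¬ Any (λ d → ¬ Rad (x - d)) cs
  unresolved {c} rx x≺ε (res ∷ _) (here {d} ¬p) with em {P = Rad (d - c)}
  ... | no ¬q = ¬Rad-sub-trans ¬p ¬q rx
  ... | yes q = ≺-irrefl (≺-≼-trans x≺ε (≼-trans (res q) (coset-≼ rx ¬p)))
  unresolved rx x≺ε (_ ∷ res) (there q) = unresolved rx x≺ε res q

  module BaireBall
    (Z : Bool → Carrier → Carrier → Set u)
    (def : ∀ b → Def (∅ ▹ ▹) (λ ((_ , x) , h) → Z b x h))
    (mono : ∀ {b x g h} → h ≼ g → Rad h → Z b x g → Z b x h)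
    (c g : Carrier) (r : Rad g)
    (cover : ∀ x → Ball c g x → ∃[ b ] ∃[ h ] Rad h × Z b x h) where

    Goal : Set u
    Goal = ∃[ b ] ∃[ h ] ∃[ x ] ∃[ g′ ] Rad h × Rad g′ ×
      (∀ y → Ball x g′ y → Ball c g y × Z b y h)

    private
      S : Carrier → Carrier → Set u
      S h x = Ball c g x × ∃[ b ] Z b x h

      -- The points which are reached, at some radius, before any closer
      -- point of the ball.
      X : Carrier → Set u
      X x = Ball c g x × Rad (x - c) × ∃[ h ] Rad h × S h x ×
        (∀ y → Ball c g y → Rad (y - c) → y - c ≺ x - c → ¬ S h y)

      defZ : ∀ b {Γ s t} → Poly Γ s → Poly Γ t → Def Γ (λ e → Z b (s e) (t e))
      defZ b {s = s} {t} p q = substDef {h = λ e → (tt , s e) , t e} ((tt , p) , q) (def b)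

      defS : ∀ {Γ s t} → Poly Γ s → Poly Γ t → Def Γ (λ e → S (t e) (s e))
      defS p q = defAnd (defBall (const c) (const g) p) (defExBool λ b → defZ b p q)

      defX : Def (∅ ▹) (X ∘ proj₂)
      defX = defAnd (defBall (const c) (const g) v₀)
        (defAnd (defRad (v₀ ⊖ const c))
        (defEx (defAnd (defRad v₀) (defAnd (defS v₁ v₀)
          (univ (imp (defBall (const c) (const g) v₀) (imp (defRad (v₀ ⊖ const c))
            (imp (def≺ (v₀ ⊖ const c) (v₂ ⊖ const c)) (defNot (defS v₀ v₁))))))))))

      S-mono : ∀ {g h x} → h ≼ g → Rad h → S g x → S h x
      S-mono p r (b , _ , z) = b , _ , mono p r z

      closer : ∀ {ε} → Rad ε → ε ≼ g → ∃[ y ] Ball c g y × Rad (y - c) × y - c ≺ ε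
      closer r ε≼g =
        let h , r′ , h≺ε = below r
            y-c≺ε = ≺-resp (sym (shift c h)) refl h≺ε
        in c + h , ≺-≼-trans y-c≺ε ε≼g , Rad-resp (sym (shift c h)) r′ , y-c≺ε

      module _ (¬goal : ¬ Goal) where

        small-S : ∀ {h} → Rad h → Small (S h)
        small-S {h} rh = small-⊆ (λ { x (b , true , z) → inj₁ (b , z) ; x (b , false , z) → inj₂ (b , z) })
          (small-∪ (small true) (small false))
          where
          small : ∀ b → Small (λ x → Ball c g x × Z b x h)
          small b = [ id , (λ (x , g′ , r′ , _ , f) → ⊥-elim (¬goal (b , h , x , g′ , rh , r′ , f))) ]′
            (small⊎ball (defAnd (defBall (const c) (const g) v₀) (defZ b v₀ (const h))))

        -- On a small ball around `x₀` no point is closer to `c` than `x₀`. Fix `y` closer still,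
        -- reached at radius `hy`. A point of the ball reached before `y` is already reached at
        -- `hy`, so the whole ball lies in `S hy`, which is small.
        no-ball : ¬ ContainsBall X
        no-ball (x₀ , g₀ , r₀ , (x₀∈ , r₁ , _) , f) =
          case min-Rad r₀ r₁ of λ (g₁ , r₂ , g₁≼g₀ , g₁≼x₀) →
          case closer r₁ (≺⇒≼ x₀∈) of λ (y , y∈ , ry , y≺x₀) →
          case cover y y∈ of λ (b , hy , rhy , zy) →
          ball-not-small r₂ (small-⊆ (λ x bx →
            case f x (≺-≼-trans bx g₁≼g₀) of λ (x∈ , rx , h , rh , Sx , first) →
            let x₀≼x = ≼-resp refl (sub-telescope x x₀ c) (≺⇒≼+ (≺-≼-trans bx g₁≼x₀))
                ¬Sy = first y y∈ ry (≺-≼-trans y≺x₀ x₀≼x)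
            in case ≼-total h hy of λ where
                 (inj₁ h≼hy) → ⊥-elim (¬Sy (S-mono h≼hy rh (y∈ , b , zy)))
                 (inj₂ hy≼h) → S-mono hy≼h rhy Sx) (small-S rhy))

        -- Some `S h` has points closer to `c` than `ε`. The nearest of them belongs to `X`, but `ε`
        -- is too fine for the cosets that should cover `X`.
        not-small : ¬ Small X
        not-small (cs , covered) =
          case resolution c cs r of λ (ε , rε , ε≼g , far) →
          case closer rε ε≼g of λ (y , y∈ , ry , y≺ε) →
          case cover y y∈ of λ (b , h , rh , zy) →
          case nearest {λ y → S h y × Rad (y - c) × y - c ≺ ε} c
            (small-⊆ (λ _ → proj₁) (small-S rh)) (λ _ → proj₁ ∘ proj₂)
            (y , (y∈ , b , zy) , ry , y≺ε) of λ (x , (Sx , rx , x≺ε) , least) →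
          unresolved rx x≺ε far (covered x (proj₁ Sx , rx , h , rh , Sx , λ y′ y′∈ ry′ y′≺x Sy′ →
            proj₂ y′≺x (least y′ (Sy′ , ry′ , ≺-trans y′≺x x≺ε))))

    baire-ball : Goal
    baire-ball = by-contradiction λ ¬goal →
      [ not-small ¬goal , no-ball ¬goal ]′ (small⊎ball defX)

  -- On a smaller box the sets T v are uniformly separated, so two points
  -- closer than the separation cannot both be hit.
  module Avoid {n : ℕ} (baire : Baire n)
    (T : Vec Carrier n → Carrier → Set u)
    (def : Def (∅ ▹[ n ] ▹) (λ ((_ , v) , y) → T v y))
    (c : Vec Carrier n) {g : Carrier} (r : Rad g)
    (small : ∀ v → Box c g v → Small (T v)) where

    private
      defT : ∀ {Γ} {v : ⟦ Γ ⟧ → Vec Carrier n} {s} →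
        (∀ i → Poly Γ (λ e → lookup (v e) i)) → Poly Γ s → Def Γ (λ e → T (v e) (s e))
      defT {v = v} {s} p q = substDef {Δ = ∅ ▹[ n ] ▹} {h = λ e → (tt , v e) , s e} ((tt , p) , q) def

      separated : Family n
      separated = record
        { Z = λ _ v h → ∀ y y′ → T v y → T v y′ → Rad (y - y′) → h ≼ y - y′
        ; def = λ _ → univ (univ (imp (defT (wk ∘ wk ∘ wk ∘ block) v₁)
            (imp (defT (wk ∘ wk ∘ wk ∘ block) v₀)
            (imp (defRad (v₁ ⊖ v₀)) (def≼ v₂ (v₁ ⊖ v₀))))))
        ; mono = λ h≼g _ z y y′ Ty Ty′ r → ≼-trans h≼g (z y y′ Ty Ty′ r)
        }

    avoid : ∀ c₀ {g₀} → Rad g₀ → ∃[ y ] Ball c₀ g₀ y × ∃[ c′ ] ∃[ g′ ] Rad g′ ×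
      (∀ v → Box c′ g′ v → Box c g v × ¬ T v y)
    avoid c₀ {g₀} r₀ =
      case baire separated c r (λ v b → true , separation (small v b)) of
        λ (_ , h , c₁ , g₁ , rh , r₁ , sep) →
      case min-below rh r₀ of λ (k , rk , k≺h , k≺g₀) →
      -- Which of the two points `T v` misses may depend on `v`. A second application of the
      -- category theorem makes the choice constant on a box.
      case baire (missing k) c₁ r₁ (λ v bv → covers v (k≺h , rk) (proj₂ (sep v bv))) of
        λ (b , _ , c₂ , g₂ , _ , r₂ , miss) →
      pt k b , inBall b k≺g₀ , c₂ , g₂ , r₂ , λ v bv →
        case miss v bv of λ (bv₁ , ¬t) → proj₁ (sep v bv₁) , ¬t
      where
      pt : Carrier → Bool → Carrier
      pt k b = if b then c₀ else (c₀ + k)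
      missing : Carrier → Family n
      missing k = record
        { Z = λ b v _ → ¬ T v (pt k b)
        ; def = λ b → defNot (defT (wk ∘ block) (const (pt k b)))
        ; mono = λ _ _ z → z }
      covers : ∀ {h k} v → k ≺ h × Rad k →
        (∀ y y′ → T v y → T v y′ → Rad (y - y′) → h ≼ y - y′) →
        ∃[ b ] ∃[ h ] Rad h × ¬ T v (pt k b)
      covers {h} {k} v (k≺h , rk) sep with em {P = T v c₀}
      ... | no ¬t = true , 1# , one , ¬t
      ... | yes t₀ = false , 1# , one , λ t → ≺-irrefl (≺-≼-trans k≺h (≼-resp refl (shift c₀ k)
            (sep (c₀ + k) c₀ t t₀ (Rad-resp (sym (shift c₀ k)) rk))))
      inBall : ∀ b {k} → k ≺ g₀ → Ball c₀ g₀ (pt k b)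
      inBall true  _ = ball-centre r₀
      inBall false p = ≺-resp (sym (shift c₀ _)) refl p

  -- A Kuratowski-Ulam argument. `T v` collects the `y` around which no ball lies in the fibre over
  -- `v` at any single radius; by the one-dimensional case it contains no ball, so it is small.
  -- `Avoid` gives one `y` outside `T v` for all `v` in a box, and the category theorem in dimension
  -- `n` makes the radius around `y` independent of `v`.
  baire-suc : ∀ {n} → Baire n → Baire (suc n)
  baire-suc {n} baire F (c₀ ∷ c) {g} r cover =
    case Avoid.avoid baire T defT c r small c₀ r of λ (y , y∈ , c₁ , g₁ , r₁ , good) →
    case baire (fibres y) c₁ r₁ (λ v bv → by-contradiction λ ¬q → proj₂ (good v bv)
      (y∈ , λ b h rh z → ¬q (b , h , rh , z))) of λ (b , h , c₂ , g₂ , rh , r₂ , f) →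
    case min-Rad rh r₂ of λ (m , rm , m≼h , m≼g₂) →
    case min-Rad rm r of λ (k , rk , k≼m , k≼g) →
    b , h , y ∷ c₂ , k , rh , rk , λ { (y′ ∷ v) bv →
      case f v (box-mono {c = c₂} {v} (≼-trans k≼m m≼g₂) (bv ∘ suc)) of λ (bv₁ , z) →
      (λ { zero → ≺-sub-trans (≺-≼-trans (bv zero) k≼g) y∈ ; (suc i) → proj₁ (good v bv₁) i })
      , z y′ (≺-≼-trans (bv zero) (≼-trans k≼m m≼h)) }
    where
    open Family F

    defZ : ∀ b {Γ} {s} {v : ⟦ Γ ⟧ → Vec Carrier n} {t} → Poly Γ s →
      (∀ i → Poly Γ (λ e → lookup (v e) i)) → Poly Γ t → Def Γ (λ e → Z b (s e ∷ v e) (t e))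
    defZ b {s = s} {v} {t} p q p′ =
      substDef {Δ = ∅ ▹[ suc n ] ▹} {h = λ e → (tt , s e ∷ v e) , t e}
        ((tt , polyCons {v = v} p q) , p′) (def b)

    fibres : Carrier → Family n
    fibres y = record
      { Z = λ b v h → ∀ y′ → Ball y h y′ → Z b (y′ ∷ v) h
      ; def = λ b → univ (imp (defBall (const y) v₁ v₀) (defZ b v₀ (wk ∘ wk ∘ block) v₁))
      ; mono = λ h≼g rh z y′ by′ → mono h≼g rh (z y′ (≺-≼-trans by′ h≼g)) }

    T : Vec Carrier n → Carrier → Set u
    T v y = Ball c₀ g y × (∀ b h → Rad h → ¬ (∀ y′ → Ball y h y′ → Z b (y′ ∷ v) h))

    defT : Def (∅ ▹[ n ] ▹) (λ ((_ , v) , y) → T v y)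
    defT = defAnd (defBall (const c₀) (const g) v₀) (defAllBool λ b → univ (imp (defRad v₀)
      (defNot (univ (imp (defBall v₂ v₁ v₀) (defZ b v₀ (wk ∘ wk ∘ wk ∘ block) v₁))))))

    small : ∀ v → Box c g v → Small (T v)
    small v bv = [ id , no-ball ]′ (small⊎ball (substDef {Δ = ∅ ▹[ n ] ▹} {h = λ (_ , y) → (tt , v) , y}
                                  ((tt , λ i → const (lookup v i)) , v₀) defT))
      where
      no-ball : ContainsBall (T v) → Small (T v)
      no-ball (x , g′ , r′ , _ , f) =
        case BaireBall.baire-ball (λ b y h → Z b (y ∷ v) h)
          (λ b → defZ b v₁ (λ i → const (lookup v i)) v₀) mono x g′ r′
          (λ y by → cover (y ∷ v) λ { zero → proj₁ (f y by) ; (suc i) → bv i }) of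
          λ (b , h , y , g″ , rh , r″ , z) →
        case min-Rad rh r″ of λ (k , rk , k≼h , k≼g″) →
        ⊥-elim (proj₂ (f y (proj₁ (z y (ball-centre r″)))) b k rk λ y′ by′ →
          mono k≼h rk (proj₂ (z y′ (≺-≼-trans by′ k≼g″))))

  baire : ∀ n → Baire n
  baire zero    = baire₀
  baire (suc n) = baire-suc (baire n)

-- Images of maps close to the identity.

module Freezing (em : ∀ {ℓ} → ExcludedMiddle ℓ) {u} (K : ValuedField u)
  (prepared : Definability.AllPrepared em K)
  {Rad : ValuedField.Carrier K → Set u} (isRadii : Radii.IsRadii em K Rad) where
  open ValuedField K hiding (zero)
  open Classical em
  open Solver commutativeRing
  open Order em K
  open Definability em K
  open Radii em K
  open IsRadii isRadii
  open Generic em K prepared isRadii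
  open Dimension em K prepared isRadii

  -- Choose one preimage for each coset that meets the image. By injectivity the cosets of these
  -- preimages would cover the ball. A coset without preimage gets the default centre `0#`, which is
  -- never called upon.
  image-not-small : (Q : Carrier → Carrier → Set u) →
    (∀ {x y x′ y′} → Q x y → Q x′ y′ → ¬ Rad (y - y′) → ¬ Rad (x - x′)) →
    ∀ {x₀ g} → Rad g → (∀ x → Ball x₀ g x → ∃[ y ] Q x y) →
    ¬ Small (λ y → ∃[ x ] Ball x₀ g x × Q x y)
  image-not-small Q inj {x₀} {g} r total (cs , covered) =
    ball-not-small r (List.map pick cs , λ x bx → case total x bx of λ (y , Qxy) →
      Any.map⁺ (Any.map (pick-spec Qxy) (covered y (x , bx , Qxy))))
    where
    Near : Carrier → Carrier → Set u
    Near c x = ∃[ y ] Q x y × ¬ Rad (y - c)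
    pick : Carrier → Carrier
    pick c with em {P = ∃ (Near c)}
    ... | yes (x , _) = x
    ... | no _ = 0#
    pick-spec : ∀ {x y} → Q x y → ∀ {c} → ¬ Rad (y - c) → ¬ Rad (x - pick c)
    pick-spec {x} {y} Qxy {c} p with em {P = ∃ (Near c)}
    ... | yes (x′ , y′ , Q′ , p′) = inj Qxy Q′ (¬Rad-sub-trans p (¬Rad-sub-comm p′))
    ... | no ¬q = ⊥-elim (¬q (x , y , Qxy , p))

  -- Risometries at the scales of `Rad`: the change of the value agrees with the change of the
  -- argument up to something smaller. With `e` equal to `e′` it follows that the value is unique
  -- modulo the complement of `Rad`.
  Riso : ∀ {n} → (Vec Carrier n → Vec Carrier n → Set u) → Set u
  Riso R = ∀ {e c e′ c′ g} → R e c → R e′ c′ → Rad g →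
    (∀ i → lookup e i - lookup e′ i ≼ g) →
    ∀ i → (lookup c i - lookup c′ i) - (lookup e i - lookup e′ i) ≺ g

  -- R is the graph of a map close to the identity.  Fixing one coordinate of
  -- the value leaves a graph of the same kind, in one dimension less.
  module Step {m : ℕ} (R : Vec Carrier (suc m) → Vec Carrier (suc m) → Set u)
    (def : Def (∅ ▹[ suc m ] ▹[ suc m ]) (λ ((_ , e) , c) → R e c)) (riso : Riso R) where

    defR : ∀ {Γ s t} {v w : ⟦ Γ ⟧ → Vec Carrier m} →
      Poly Γ s → (∀ i → Poly Γ (λ e → lookup (v e) i)) →
      Poly Γ t → (∀ i → Poly Γ (λ e → lookup (w e) i)) →
      Def Γ (λ e → R (s e ∷ v e) (t e ∷ w e))
    defR {s = s} {t} {v} {w} p q p′ q′ =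
      substDef {Δ = ∅ ▹[ suc m ] ▹[ suc m ]} {h = λ e → (tt , s e ∷ v e) , t e ∷ w e}
        ((tt , polyCons {v = v} p q) , polyCons {v = w} p′ q′) def

    Q : Vec Carrier m → Carrier → Carrier → Set u
    Q e x y = ∃[ c ] R (x ∷ e) (y ∷ c)

    defQ : ∀ {Γ s t} {v : ⟦ Γ ⟧ → Vec Carrier m} →
      (∀ i → Poly Γ (λ e → lookup (v e) i)) → Poly Γ s → Poly Γ t →
      Def Γ (λ e → Q (v e) (s e) (t e))
    defQ {v = v} q p p′ = defEx[] m (defR {v = v ∘ proj₁} (wk[] p) (wk[] ∘ q) (wk[] p′) block)

    Q-inj : ∀ {e x y x′ y′} → Q e x y → Q e x′ y′ → ¬ Rad (y - y′) → ¬ Rad (x - x′)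
    Q-inj {e} {x} {y} {x′} {y′} (_ , R₁) (_ , R₂) ¬r r = ≺-irrefl (≺-resp
      (solve 2 (λ a b → b :- (b :- a) := a) refl (x - x′) (y - y′)) refl
      (-‿-≺ (¬Rad≺Rad ¬r r) (riso R₁ R₂ r
        (λ { zero → ≼-refl ; (suc i) → ≼-resp (sym (sub-self _)) refl 0≼ }) zero)))

    J : Vec Carrier m → Carrier → Set u
    J e y = ∃[ x ] Q e x y

    defJ : ∀ {Γ t} {v : ⟦ Γ ⟧ → Vec Carrier m} →
      (∀ i → Poly Γ (λ e → lookup (v e) i)) → Poly Γ t → Def Γ (λ e → J (v e) (t e))
    defJ {v = v} q p = defEx (defQ {v = v ∘ proj₁} (wk ∘ q) v₀ (wk p))

    module _ (x₀ : Carrier) {g : Carrier} (r : Rad g) where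

      T : Vec Carrier m → Carrier → Set u
      T e x = Ball x₀ g x × (∀ y → Q e x y → ∀ h → Rad h → ¬ (∀ y′ → Ball y h y′ → J e y′))

      defT : ∀ {Γ s} {v : ⟦ Γ ⟧ → Vec Carrier m} →
        (∀ i → Poly Γ (λ e → lookup (v e) i)) → Poly Γ s → Def Γ (λ e → T (v e) (s e))
      defT {v = v} q p = defAnd (defBall (const x₀) (const g) p)
        (univ (imp (defQ {v = v ∘ proj₁} (wk ∘ q) (wk p) v₀)
        (univ (imp (defRad v₀) (defNot (univ
          (imp (defBall (wk v₁) v₁ v₀)
            (defJ {v = v ∘ proj₁ ∘ proj₁ ∘ proj₁} (wk ∘ wk ∘ wk ∘ q) v₀))))))))

      -- The image of a ball inside `T e` is not small, hence contains a ball. The argument mapped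
      -- to the centre of that ball has an interior value, so it does not belong to `T e`.
      T-small : ∀ e → (∀ x → Ball x₀ g x → ∃[ y ] Q e x y) → Small (T e)
      T-small e total = [ id , no-ball ]′
        (small⊎ball (defT {v = λ _ → e} (λ i → const (lookup e i)) v₀))
        where
        no-ball : ContainsBall (T e) → Small (T e)
        no-ball (x₁ , g₁ , r₁ , _ , f) =
          [ (λ s → ⊥-elim (image-not-small (Q e) Q-inj r₁ (λ x bx → total x (proj₁ (f x bx))) s))
          , (λ (y₂ , g₂ , r₂ , (x₂ , bx₂ , Q₂) , f₂) →
              ⊥-elim (proj₂ (f x₂ bx₂) y₂ Q₂ g₂ r₂ λ y by →
                case f₂ y by of λ (x , _ , q) → x , q)) ]′
          (small⊎ball (defEx (defAnd (defBall (const x₁) (const g₁) v₀)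
            (defQ {v = λ _ → e} (λ i → const (lookup e i)) v₀ v₁))))

    module _ (x₀ : Carrier) (e₀ : Vec Carrier m) {g : Carrier} (r : Rad g)
      (total : ∀ e → Box (x₀ ∷ e₀) g e → ∃[ c ] R e c) where

      totalQ : ∀ e → Box e₀ g e → ∀ x → Ball x₀ g x → ∃[ y ] Q e x y
      totalQ e be x bx = case total (x ∷ e) (λ { zero → bx ; (suc i) → be i }) of λ where
        (y ∷ c , R₁) → y , c , R₁

      interior : Carrier → Family m
      interior x = record
        { Z = λ _ e h → ∃[ y ] Q e x y × (∀ y′ → Ball y h y′ → J e y′)
        ; def = λ _ → defEx (defAnd (defQ {v = proj₂ ∘ proj₁ ∘ proj₁} (wk ∘ wk ∘ block) (const x) v₀)
            (univ (imp (defBall v₁ (wk v₁) v₀)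
              (defJ {v = proj₂ ∘ proj₁ ∘ proj₁ ∘ proj₁} (wk ∘ wk ∘ wk ∘ block) v₀))))
        ; mono = λ { h≼g _ (y , q , f) → y , q , λ y′ by′ → f y′ (≺-≼-trans by′ h≼g) } }

      -- Some `x` is good for every `e` in a box, and on a smaller box a ball of uniform radius `h`
      -- around the value at `x` lies in `J e`. As `e` moves within `h` of `e₂`, the value at `x`
      -- moves by less than `h`, so the value `y₂` at `e₂` remains in `J e`.
      freeze : ∃[ y₀ ] ∃[ e₁ ] ∃[ g₁ ] Rad g₁ × (∀ e → Box e₁ g₁ e → J e y₀)
      freeze =
        case Avoid.avoid (baire m) (T x₀ r)
          (defT x₀ r {v = proj₂ ∘ proj₁} (wk ∘ block) v₀) e₀ r
          (λ e be → T-small x₀ r e (totalQ e be)) x₀ r of λ (x , x∈ , e₁ , g₁ , r₁ , good) →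
        case baire m (interior x) e₁ r₁ (λ e be → true , by-contradiction λ ¬p →
          case good e be of λ (be₀ , ¬t) → ¬t (x∈ , λ y q h rh f → ¬p (h , rh , y , q , f))) of
          λ (_ , h , e₂ , g₂ , rh , r₂ , f) →
        case min-Rad rh r₂ of λ (k , rk , k≼h , k≼g₂) →
        case proj₂ (f e₂ (box-centre e₂ r₂)) of λ (y₂ , (_ , R₂) , _) →
        y₂ , e₂ , k , rk , λ e be →
          case proj₂ (f e (box-mono {c = e₂} {e} k≼g₂ be)) of λ (y , (_ , R₁) , fy) →
          fy y₂ (≺-resp (solve 3 (λ a b x → (a :- b) :- (x :- x) := a :- b) refl y₂ y x) refl
            (riso R₂ R₁ rh (λ { zero → ≼-resp (sym (sub-self x)) refl 0≼
                              ; (suc i) → ≼-trans (≼-sub-comm (≺⇒≼ (be i))) k≼h }) zero))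

    frozen : Carrier → Vec Carrier m → Vec Carrier m → Set u
    frozen y e c = ∃[ x ] R (x ∷ e) (y ∷ c)

    frozen-def : ∀ y → Def (∅ ▹[ m ] ▹[ m ]) (λ ((_ , e) , c) → frozen y e c)
    frozen-def y = defEx (defR {v = proj₂ ∘ proj₁ ∘ proj₁} {w = proj₂ ∘ proj₁}
      v₀ (wk ∘ wk[] ∘ block) (const y) (wk ∘ block))

    frozen-riso : ∀ y → Riso (frozen y)
    frozen-riso y {e} {c} {e′} {c′} {g} (x , R₁) (x′ , R₂) r small i =
      riso R₁ R₂ r (λ { zero → x≼ ; (suc i) → small i }) (suc i)
      where
      x≼ : x - x′ ≼ g
      -- A change of `x` larger than `g` would be the largest change among the arguments. It would
      -- show in the first value, which is frozen.
      x≼ = by-contradiction λ p → let q = ⊀⇒≺ p in ≺-irrefl (≺-resp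
        (solve 2 (λ y d → :- ((y :- y) :- d) := d) refl y (x - x′)) refl
        (-‿≺ (riso R₁ R₂ (upward r (≺⇒≼ q))
          (λ { zero → ≼-refl ; (suc i) → ≼-trans (small i) (≺⇒≼ q) }) zero)))

  -- All coordinates of the value but the last are frozen one after the other. What remains is a map
  -- in one variable, whose image is not small and so contains a ball.
  line : ∀ n (R : Vec Carrier (suc n) → Vec Carrier (suc n) → Set u) →
    Def (∅ ▹[ suc n ] ▹[ suc n ]) (λ ((_ , e) , c) → R e c) → Riso R →
    ∀ e₀ {g} → Rad g → (∀ e → Box e₀ g e → ∃[ c ] R e c) →
    ∃[ c ] ∃[ y ] ∃[ h ] Rad h × (∀ y′ → Ball y h y′ → ∃[ e ] R e (c ∷ʳ y′))
  line zero R def riso (x₀ ∷ []) {g} r total =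
    [ (λ s → ⊥-elim (image-not-small (Q []) Q-inj r totalQ′ s))
    , (λ (y , h , rh , _ , f) → [] , y , h , rh , λ y′ by′ →
        case f y′ by′ of λ where (x , _ , [] , R₁) → x ∷ [] , R₁) ]′
    (small⊎ball (defEx (defAnd (defBall (const x₀) (const g) v₀)
      (defQ {v = λ _ → []} (λ ()) v₀ v₁))))
    where
    open Step R def riso
    totalQ′ : ∀ x → Ball x₀ g x → ∃[ y ] Q [] x y
    totalQ′ = totalQ x₀ [] r total [] λ ()
  line (suc n) R def riso (x₀ ∷ e₀) r total =
    case freeze x₀ e₀ r total of λ (y₀ , e₁ , g₁ , r₁ , f) →
    case line n (frozen y₀) (frozen-def y₀) (frozen-riso y₀) e₁ r₁
      (λ e be → case f e be of λ (x , c , R₁) → c , x , R₁) of λ (c , y , h , rh , k) →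
    y₀ ∷ c , y , h , rh , λ y′ by′ → case k y′ by′ of λ (e , x , R₁) → x ∷ e , R₁
    where
    open Step R def riso

-- Polynomials and their difference quotients.

module Polynomials (em : ∀ {ℓ} → ExcludedMiddle ℓ) {u} (K : ValuedField u) where
  open ValuedField K hiding (zero)
  open Solver commutativeRing
  open Order em K
  open Definability em K

  -- Constant coefficient first.
  ev : ∀ {n} → Vec Carrier n → Carrier → Carrier
  ev []      x = 0#
  ev (a ∷ v) x = a + x * ev v x

  -- The difference quotient, which is the derivative on the diagonal.
  dq : ∀ {n} → Vec Carrier n → Carrier → Carrier → Carrier
  dq []      y z = 0#
  dq (a ∷ v) y z = ev v y + z * dq v y z

  ev-sub : ∀ {n} (v : Vec Carrier n) y z → ev v y - ev v z ≈ (y - z) * dq v y z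
  ev-sub [] y z = trans (sub-self 0#) (sym (zeroʳ _))
  ev-sub (a ∷ v) y z = trans
    (solve 5 (λ a y z p q → (a :+ y :* p) :- (a :+ z :* q) := (y :- z) :* p :+ z :* (p :- q))
      refl a y z (ev v y) (ev v z))
    (trans (+-congˡ (*-congˡ (ev-sub v y z)))
      (solve 4 (λ y z p d → (y :- z) :* p :+ z :* ((y :- z) :* d) := (y :- z) :* (p :+ z :* d))
        refl y z (ev v y) (dq v y z)))

  ev-fromList : ∀ f x → evalPoly K f x ≈ ev (Vec.fromList f) x
  ev-fromList []      x = refl
  ev-fromList (a ∷ f) x = +-congˡ (*-congˡ (ev-fromList f x))

  polyEv : ∀ {Γ} n {v : ⟦ Γ ⟧ → Vec Carrier n} {y} →
    (∀ i → Poly Γ (λ e → lookup (v e) i)) → Poly Γ y → Poly Γ (λ e → ev (v e) (y e))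
  polyEv zero {v} {y} p q = resp (λ e → nil (v e)) (const 0#)
    where
    nil : ∀ {x} (w : Vec Carrier 0) → 0# ≈ ev w x
    nil [] = refl
  polyEv (suc n) {v} {y} p q = resp (λ e → cons (v e))
    (p zero ⊕ q ⊗ polyEv n {Vec.tail ∘ v} (λ i → resp (λ e → tail (v e) i) (p (suc i))) q)
    where
    cons : ∀ {x} (w : Vec Carrier (suc n)) → lookup w zero + x * ev (Vec.tail w) x ≈ ev w x
    cons (a ∷ w) = refl
    tail : ∀ (w : Vec Carrier (suc n)) i → lookup w (suc i) ≈ lookup (Vec.tail w) i
    tail (a ∷ w) i = refl

  private
    _∙_ = RawMonoidDefinitions._×_ +-rawMonoid

  weightedTail : ℕ → List Carrier → List Carrier
  weightedTail n []      = []
  weightedTail n (b ∷ g) = (n ∙ b) ∷ weightedTail (suc n) g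

  -- The local function in the definition of derivative cannot be named, but
  -- it can be inferred.
  private
    weightedTail-unique : (go : ℕ → List Carrier → List Carrier) → (∀ n → go n [] ≡ []) →
      (∀ n b g → go n (b ∷ g) ≡ (n ∙ b) ∷ go (suc n) g) → ∀ n f → go n f ≡ weightedTail n f
    weightedTail-unique go p q n [] = p n
    weightedTail-unique go p q n (b ∷ f) =
      ≡.trans (q n b f) (≡.cong ((n ∙ b) ∷_) (weightedTail-unique go p q (suc n) f))

    mutual
      go : ℕ → List Carrier → List Carrier
      go = _

      derivative-0 : ∀ f → derivative K (0# ∷ f) ≡ weightedTail 1 f
      derivative-0 f with 1
      ... | n = weightedTail-unique go (λ _ → ≡.refl) (λ _ _ _ → ≡.refl) n f

  derivative-∷ : ∀ c f → derivative K (c ∷ f) ≡ weightedTail 1 f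
  derivative-∷ c f = derivative-0 f

  ∙≈∙1* : ∀ n b → n ∙ b ≈ (n ∙ 1#) * b
  ∙≈∙1* zero    b = sym (zeroˡ b)
  ∙≈∙1* (suc n) b = trans (+-cong (sym (*-identityˡ b)) (∙≈∙1* n b)) (sym (distribʳ b _ _))

  evalPoly-weightedTail : ∀ n f a → evalPoly K (weightedTail n f) a ≈
    (n ∙ 1#) * ev (Vec.fromList f) a + a * dq (Vec.fromList f) a a
  evalPoly-weightedTail n [] a =
    sym (trans (+-cong (zeroʳ _) (zeroʳ _)) (+-identityʳ 0#))
  evalPoly-weightedTail n (b ∷ f) a = trans
    (+-cong (∙≈∙1* n b) (*-congˡ (evalPoly-weightedTail (suc n) f a)))
    (solve 5 (λ n b a p d → n :* b :+ a :* ((:1 :+ n) :* p :+ a :* d) :=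
                            n :* (b :+ a :* p) :+ a :* (p :+ a :* d))
      refl (n ∙ 1#) b a (ev (Vec.fromList f) a) (dq (Vec.fromList f) a a))

  evalPoly-derivative : ∀ f a → evalPoly K (derivative K f) a ≈ dq (Vec.fromList f) a a
  evalPoly-derivative []      a = refl
  evalPoly-derivative (c ∷ f) a = trans
    (reflexive (≡.cong (λ g → evalPoly K g a) (derivative-∷ c f)))
    (trans (evalPoly-weightedTail 1 f a)
      (+-congʳ (trans (*-congʳ (+-identityʳ 1#)) (*-identityˡ _))))

  infixr 8 _^^_

  _^^_ : Carrier → ℕ → Carrier
  x ^^ zero  = 1#
  x ^^ suc n = x * x ^^ n

  1≼^^ : ∀ {x} n → 1# ≼ x → 1# ≼ x ^^ n
  1≼^^ zero    p = ≼-refl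
  1≼^^ (suc n) p = ≽1-*ʳ p (1≼^^ n p)

  1^^ : ∀ n → 1# ^^ n ≈ 1#
  1^^ zero    = refl
  1^^ (suc n) = trans (*-identityˡ _) (1^^ n)

  -- 𝒮 g φ is read as "φ has size at most g".
  record IsSize (𝒮 : Carrier → (Carrier → Carrier) → Set u)
                (Bounded : Carrier → Set u) (M : Carrier) : Set (lsuc u) where
    field
      1≼M  : 1# ≼ M
      𝒮-cong  : ∀ {g φ ψ} → (∀ x → φ x ≈ ψ x) → 𝒮 g φ → 𝒮 g ψ
      𝒮-mono  : ∀ {g h φ} → g ≼ h → 𝒮 g φ → 𝒮 h φ
      𝒮-0     : ∀ {g} → 𝒮 g (λ _ → 0#)
      𝒮-+     : ∀ {g φ ψ} → 𝒮 g φ → 𝒮 g ψ → 𝒮 g (λ x → φ x + ψ x)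
      𝒮-*     : ∀ {g h φ ψ} → 𝒮 g φ → 𝒮 h ψ → 𝒮 (g * h) (λ x → φ x * ψ x)
      𝒮-const : ∀ {g k} → Bounded k → k ≼ g → 𝒮 (g * M) (λ _ → k)

    -- Each multiplication by the argument costs a factor `M`, and so does a constant. The notion of
    -- size is instantiated twice: by the value at one point, and by the coefficients modulo the
    -- minimal polynomial.
    ev-size : ∀ {n} (v : Vec Carrier n) {g} → (∀ i → Bounded (lookup v i)) →
      (∀ i → lookup v i ≼ g) → ∀ {φ} → 𝒮 M φ → 𝒮 (g * M ^^ suc n) (λ x → ev v (φ x))
    ev-size [] _ _ _ = 𝒮-0
    ev-size {suc n} (a ∷ v) {g} b p {φ} s = 𝒮-+
      (𝒮-mono (*-≼ˡ g (≽1-*ʳ ≼-refl (1≼^^ (suc n) 1≼M))) (𝒮-const (b zero) (p zero)))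
      (𝒮-mono (≼-reflexive (solve 3 (λ m g q → m :* (g :* q) := g :* (m :* q)) refl M g _))
        (𝒮-* s (ev-size v (b ∘ suc) (p ∘ suc) s)))

    dq-size : ∀ {n} (v : Vec Carrier n) {g} → (∀ i → Bounded (lookup v i)) →
      (∀ i → lookup v i ≼ g) → ∀ {φ ψ} → 𝒮 M φ → 𝒮 M ψ →
      𝒮 (g * M ^^ suc n) (λ x → dq v (φ x) (ψ x))
    dq-size [] _ _ _ _ = 𝒮-0
    dq-size {suc n} (a ∷ v) {g} b p {φ} {ψ} s t = 𝒮-+
      (𝒮-mono (*-≼ˡ g (≽1-*ˡ 1≼M ≼-refl)) (ev-size v (b ∘ suc) (p ∘ suc) s))
      (𝒮-mono (≼-reflexive (solve 3 (λ m g q → m :* (g :* q) := g :* (m :* q)) refl M g _))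
        (𝒮-* t (dq-size v (b ∘ suc) (p ∘ suc) s t)))

    dq-sub-size : ∀ {n} (v : Vec Carrier n) {g h} → (∀ i → Bounded (lookup v i)) →
      (∀ i → lookup v i ≼ g) → ∀ {φ ψ φ′ ψ′} → 𝒮 M φ → 𝒮 M ψ → 𝒮 M φ′ → 𝒮 M ψ′ →
      𝒮 h (λ x → φ x - φ′ x) → 𝒮 h (λ x → ψ x - ψ′ x) →
      𝒮 (h * (g * M ^^ suc n)) (λ x → dq v (φ x) (ψ x) - dq v (φ′ x) (ψ′ x))
    dq-sub-size [] _ _ _ _ _ _ _ _ = 𝒮-cong (λ _ → sym (sub-self 0#)) 𝒮-0
    dq-sub-size {suc n} (a ∷ v) {g} {h} b p {φ} {ψ} {φ′} {ψ′} s t s′ t′ d e =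
      𝒮-cong (λ x → trans (+-congʳ (+-congʳ (sym (ev-sub v (φ x) (φ′ x)))))
          (solve 6 (λ p p′ z z′ q q′ → ((p :- p′) :+ (z :- z′) :* q) :+ z′ :* (q :- q′) :=
                                       (p :+ z :* q) :- (p′ :+ z′ :* q′)) refl
            (ev v (φ x)) (ev v (φ′ x)) (ψ x) (ψ′ x) (dq v (φ x) (ψ x)) (dq v (φ′ x) (ψ′ x))))
        (𝒮-+ (𝒮-+ (grow (𝒮-* d (dq-size v (b ∘ suc) (p ∘ suc) s s′)))
                  (grow (𝒮-* e (dq-size v (b ∘ suc) (p ∘ suc) s t))))
          (𝒮-mono (≼-reflexive (solve 4 (λ m h g q → m :* (h :* (g :* q)) := h :* (g :* (m :* q)))
              refl M h g _))
            (𝒮-* t′ (dq-sub-size v (b ∘ suc) (p ∘ suc) s t s′ t′ d e))))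
      where
      grow : ∀ {χ} → 𝒮 (h * (g * M ^^ suc n)) χ → 𝒮 (h * (g * M ^^ suc (suc n))) χ
      grow = 𝒮-mono (*-≼ˡ h (*-≼ˡ g (≽1-*ˡ 1≼M ≼-refl)))

  pointwise : ∀ x {M} → 1# ≼ M → IsSize (λ g φ → φ x ≼ g) (λ _ → ⊤) M
  pointwise x p = record
    { 1≼M = p
    ; 𝒮-cong = λ f → ≼-resp (f x) refl
    ; 𝒮-mono = λ q r → ≼-trans r q
    ; 𝒮-0 = 0≼
    ; 𝒮-+ = +-≼
    ; 𝒮-* = *-≼
    ; 𝒮-const = λ _ q → ≽1-*ʳ q p
    }

  module _ {n : ℕ} (v : Vec Carrier n) (int : ∀ i → lookup v i ≼ 1#) where
    private
      module S = IsSize (pointwise 0# ≼-refl)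

      1*1^^ : ∀ m → 1# * 1# ^^ m ≈ 1#
      1*1^^ m = trans (*-identityˡ _) (1^^ m)

    dq≼1 : ∀ {x y} → x ≼ 1# → y ≼ 1# → dq v x y ≼ 1#
    dq≼1 p q = ≼-resp refl (1*1^^ (suc n)) (S.dq-size v _ int p q)

    dq-sub≼ : ∀ {x y x′ y′ g} → x ≼ 1# → y ≼ 1# → x′ ≼ 1# → y′ ≼ 1# →
      x - x′ ≼ g → y - y′ ≼ g → dq v x y - dq v x′ y′ ≼ g
    dq-sub≼ p q p′ q′ r s = ≼-resp refl (trans (*-congˡ (1*1^^ (suc n))) (*-identityʳ _))
      (S.dq-sub-size v _ int p q p′ q′ r s)

  -- A counterexample to Hensel's lemma, to be refuted.
  record Gap : Set u where
    field
      {degree} : ℕ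
      poly     : Vec Carrier degree
      integral : ∀ i → lookup poly i ≼ 1#
      a        : Carrier
      a≼1      : a ≼ 1#
      approx   : ev poly a ≺ 1#
      simple   : 1# ≼ dq poly a a
      rootless : ∀ {x} → x - a ≺ 1# → ¬ ev poly x ≈ 0#

  -- Newton approximation in a disc without a root.

  module RootlessDisc (gap : Gap) where
    open Gap gap
    open Radii em K

    F : Carrier → Carrier
    F = ev poly

    Disc : Carrier → Set u
    Disc x = x - a ≺ 1#

    disc≼1 : ∀ {x} → Disc x → x ≼ 1#
    disc≼1 {x} d = ≼-resp (solve 2 (λ x a → (x :- a) :+ a := x) refl x a) refl (+-≼ (≺⇒≼ d) a≼1)

    -- On the open disc the difference quotient differs from the derivative at `a` by less than 1.
    -- Consequently `F` preserves distances there.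
    dq-unit : ∀ {x y} → Disc x → Disc y → 1# ≼ dq poly x y
    dq-unit {x} {y} d e = ≼-trans simple (≺-sub⇒≼ (≺-≼-trans close simple))
      where
      ≼⇒ : ∀ {g} → g ≺ 1# → x - a ≼ g → y - a ≼ g → dq poly x y - dq poly a a ≺ 1#
      ≼⇒ g≺1 p q = ≼-≺-trans (dq-sub≼ poly integral (disc≼1 d) (disc≼1 e) a≼1 a≼1 p q) g≺1
      close : dq poly x y - dq poly a a ≺ 1#
      close = case ≼-total (x - a) (y - a) of λ where
        (inj₁ p) → ≼⇒ e p ≼-refl
        (inj₂ p) → ≼⇒ d ≼-refl p

    F-lipschitz : ∀ {x y} → Disc x → Disc y → F x - F y ≼ x - y
    F-lipschitz d e = ≼-resp (sym (ev-sub poly _ _)) refl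
      (≼1-*ʳ ≼-refl (dq≼1 poly integral (disc≼1 d) (disc≼1 e)))

    F-expanding : ∀ {x y} → Disc x → Disc y → x - y ≼ F x - F y
    F-expanding d e = ≼-resp refl (sym (ev-sub poly _ _)) (≽1-*ʳ ≼-refl (dq-unit d e))

    F≺1 : ∀ {x} → Disc x → F x ≺ 1#
    F≺1 {x} d = ≺-resp (solve 2 (λ p q → (p :- q) :+ q := p) refl (F x) (F a)) refl
      (+-≺ (≼-≺-trans (F-lipschitz d (sub-self-≺ 1≉0)) d) approx)

    -- `F y` is `F x` times a unit multiple of the difference of two quotients of `poly`. These
    -- agree up to `y - x`, which is at most `F x`.
    newton : ∀ {x} → Disc x → ∃[ y ] Disc y × F y ≼ F x * F x
    newton {x} d = y , disc-y , ≼-resp (sym Fy≈) refl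
      (*-≼ˡ (F x) (≼1-*ˡ w≼1 (≼-sub-comm (dq-sub≼ poly integral (disc≼1 disc-y) (disc≼1 d)
        (disc≼1 d) (disc≼1 d) y-x≼ (≼-resp (sym (sub-self x)) refl 0≼)))))
      where
      q = dq poly x x
      q≉0 : ¬ q ≈ 0#
      q≉0 p = 1≉0 (≼0⇒≈0 (≼-resp refl p (dq-unit d d)))
      w = q ⁻¹
      w≼1 : w ≼ 1#
      w≼1 = *-≼-cancelˡ q≉0 (≼-resp (sym (⁻¹-inverse q≉0)) (sym (*-identityʳ q)) (dq-unit d d))
      y = x - F x * w
      y-x : y - x ≈ - (F x * w)
      y-x = solve 2 (λ x h → (x :- h) :- x := :- h) refl x (F x * w)
      y-x≼ : y - x ≼ F x
      y-x≼ = ≼-resp (sym y-x) refl (-‿≼ (≼1-*ʳ ≼-refl w≼1))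
      disc-y : Disc y
      disc-y = ≺-resp (sub-telescope y x a) refl (+-≺ (≼-≺-trans y-x≼ (F≺1 d)) d)
      Fy≈ : F y ≈ F x * (w * (q - dq poly y x))
      Fy≈ = trans (solve 2 (λ p q → p := (p :- q) :+ q) refl (F y) (F x))
        (trans (+-cong (trans (ev-sub poly y x) (*-congʳ y-x))
                       (trans (sym (*-identityʳ (F x))) (*-congˡ (sym (⁻¹-inverse q≉0)))))
          (solve 4 (λ f w q r → (:- (f :* w)) :* r :+ f :* (q :* w) := f :* (w :* (q :- r)))
            refl (F x) w q (dq poly y x)))

    Rad : Carrier → Set u
    Rad g = ∃[ x ] Disc x × F x ≼ g

    Rad-F : ∀ {x} → Disc x → Rad (F x)
    Rad-F d = _ , d , ≼-refl

    Rad-* : ∀ {g h} → Rad g → Rad h → Rad (g * h)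
    Rad-* (x , d , p) (x′ , d′ , p′) with ≼-total (F x) (F x′)
    ... | inj₁ q = let y , e , r = newton d in y , e , ≼-trans r (*-≼ p (≼-trans q p′))
    ... | inj₂ q = let y , e , r = newton d′ in y , e , ≼-trans r (*-≼ (≼-trans q p) p′)

    isRadii : IsRadii Rad
    isRadii = record
      { definable = defEx (defAnd (def≺ (var here ⊖ const a) (const 1#))
          (def≼ (polyEv _ {λ _ → poly} (λ i → const (lookup poly i)) (var here)) (wk (var here))))
      ; upward = λ (x , d , p) q → x , d , ≼-trans p q
      -- `F x` is nonzero because the disc has no root, and it is below 1, so the Newton bound
      -- `F x * F x` is strictly smaller.
      ; below = λ (x , d , p) → let y , e , r = newton d in F y , Rad-F e , ≺-≼-trans
          (≼-≺-trans r (≺-resp refl (*-identityˡ _) (*-≺ʳ (rootless d) (F≺1 d)))) p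
      ; one = a , sub-self-≺ 1≉0 , ≺⇒≼ approx
      }

-- Germs at the missing root and its minimal polynomial.

module Germs (em : ∀ {ℓ} → ExcludedMiddle ℓ) {u} (K : ValuedField u)
  (prepared : Definability.AllPrepared em K)
  (gap : Polynomials.Gap em K) where
  open ValuedField K hiding (zero)
  open Classical em
  open Solver commutativeRing
  open Order em K
  open Radii em K
  open Polynomials em K
  open Gap gap
  open RootlessDisc gap
  open IsRadii isRadii
  open Generic em K prepared isRadii

  -- Germs at the missing root, which is approached as F tends to its infimum.
  Eventually : (Carrier → Set u) → Set u
  Eventually P = ∃[ x₀ ] Disc x₀ × (∀ x → Disc x → F x ≼ F x₀ → P x)

  eventually-map : ∀ {P Q} → (∀ {x} → Disc x → P x → Q x) → Eventually P → Eventually Q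
  eventually-map f (x₀ , d₀ , p) = x₀ , d₀ , λ x d q → f d (p x d q)

  eventually-× : ∀ {P Q} → Eventually P → Eventually Q → Eventually (λ x → P x × Q x)
  eventually-× (x₀ , d₀ , p) (x₁ , d₁ , q) with ≼-total (F x₀) (F x₁)
  ... | inj₁ r = x₀ , d₀ , λ x d s → p x d s , q x d (≼-trans s r)
  ... | inj₂ r = x₁ , d₁ , λ x d s → p x d (≼-trans s r) , q x d s

  eventually-always : ∀ {P : Carrier → Set u} → (∀ x → Disc x → P x) → Eventually P
  eventually-always p = a , sub-self-≺ 1≉0 , λ x d _ → p x d

  eventually-∃ : ∀ {P} → Eventually P → ∃[ x ] Disc x × P x
  eventually-∃ (x₀ , d₀ , p) = x₀ , d₀ , p x₀ d₀ ≼-refl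

  eventually-close : ∀ {g} → Rad g → Eventually (λ x → F x ≼ g)
  eventually-close (x₀ , d₀ , p) = x₀ , d₀ , λ x d q → ≼-trans q p

  -- Vanishing at the missing root, over the residue field of the coarsening.
  Null : (Carrier → Carrier) → Set u
  Null φ = ∀ g → Rad g → Eventually (λ x → φ x ≼ g)

  -- Membership in the valuation ring of the coarsening: `k` has a denominator in `Rad`.
  Bounded : Carrier → Set u
  Bounded k = ∃[ B ] Rad B × k * B ≼ 1#

  Bounded′ : (Carrier → Carrier) → Set u
  Bounded′ φ = ∃[ B ] Rad B × Eventually (λ x → φ x * B ≼ 1#)

  BoundedBelow : (Carrier → Carrier) → Set u
  BoundedBelow φ = ∃[ g ] Rad g × Eventually (λ x → g ≼ φ x)

  Lipschitz : (Carrier → Carrier) → Set u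
  Lipschitz φ = ∃[ B ] Rad B × (∀ x y → Disc x → Disc y → (φ x - φ y) * B ≼ x - y)

  null-cong : ∀ {φ ψ} → (∀ x → φ x ≈ ψ x) → Null φ → Null ψ
  null-cong f n g r = eventually-map (λ _ → ≼-resp (f _) refl) (n g r)

  null-+ : ∀ {φ ψ} → Null φ → Null ψ → Null (λ x → φ x + ψ x)
  null-+ m n g r = eventually-map (λ _ (p , q) → +-≼ p q) (eventually-× (m g r) (n g r))

  null-neg : ∀ {φ} → Null φ → Null (λ x → - φ x)
  null-neg n g r = eventually-map (λ _ → -‿≼) (n g r)

  null-sub : ∀ {φ ψ} → Null φ → Null ψ → Null (λ x → φ x - ψ x)
  null-sub m n = null-+ m (null-neg n)

  null-* : ∀ {φ ψ} → Bounded′ φ → Null ψ → Null (λ x → φ x * ψ x)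
  null-* {φ} {ψ} (B , rB , b) n g r = eventually-map
    (λ {x} _ (p , q) → *-≼-cancelʳ (Rad⇒≉0 rB) (≼-resp
      (solve 3 (λ a b c → (a :* b) :* c := a :* c :* b) refl (φ x) B (ψ x)) refl (≼1-*ˡ p q)))
    (eventually-× b (n (g * B) (Rad-* r rB)))

  null-const : ∀ {k} → ¬ Rad k → Null (λ _ → k)
  null-const ¬r g r = eventually-always λ _ _ → ≺⇒≼ (¬Rad≺Rad ¬r r)

  null-const⁻¹ : ∀ {k} → Null (λ _ → k) → ¬ Rad k
  null-const⁻¹ n r = let h , rh , h≺k = below r
                         _ , _ , k≼h = eventually-∃ (n h rh) in proj₂ h≺k k≼h

  null-small : ∀ {φ} → (∀ g → Rad g → ∀ x → Disc x → φ x ≼ g) → Null φ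
  null-small f g r = eventually-always (f g r)

  null-cancel : ∀ {φ ψ} → BoundedBelow φ → Null (λ x → φ x * ψ x) → Null ψ
  null-cancel (h , rh , b) n g r = eventually-map
    (λ _ (p , q) → *-≼-cancelˡ (Rad⇒≉0 rh) (≼-trans (*-≼ʳ _ p) q))
    (eventually-× b (n (h * g) (Rad-* rh r)))

  -- By the Lipschitz condition the absolute value is eventually constant.
  ¬null⇒boundedBelow : ∀ {φ} → Lipschitz φ → ¬ Null φ → BoundedBelow φ
  ¬null⇒boundedBelow {φ} (B , rB , lip) ¬n =
    case ¬∀⇒∃¬ ¬n of λ (g , ¬n′) →
    case em {P = Rad g} of λ where
      (no ¬r) → ⊥-elim (¬n′ (⊥-elim ∘ ¬r))
      (yes r) → go g r (λ e → ¬n′ λ _ → e) (Rad-* r rB)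
    where
    go : ∀ g → Rad g → ¬ Eventually (λ x → φ x ≼ g) → Rad (g * B) → BoundedBelow φ
    go g r ¬e (x₀ , d₀ , p) = g , r , x₀ , d₀ , λ x d q →
      by-contradiction λ g⋠φx → ¬e (x₀ , d₀ , λ y e s →
        ≼-resp (solve 2 (λ p q → (p :- q) :+ q := p) refl (φ y) (φ x)) refl
          (+-≼ (*-≼-cancelʳ (Rad⇒≉0 rB) (≼-trans (lip y x e d)
                 (≼-trans (F-expanding e d) (-‿-≼ (≼-trans s p) (≼-trans q p)))))
               (≺⇒≼ (⊀⇒≺ g⋠φx))))

  Rad⇒Bounded⁻¹ : ∀ {k} → Rad k → Bounded (k ⁻¹)
  Rad⇒Bounded⁻¹ {k} r = k , r , ≼-reflexive (trans (*-comm _ _) (⁻¹-inverse (Rad⇒≉0 r)))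

  ≼1⇒bounded : ∀ {k} → k ≼ 1# → Bounded k
  ≼1⇒bounded p = 1# , one , ≼-resp (sym (*-identityʳ _)) refl p

  bounded-≼ : ∀ {k l} → k ≼ l → Bounded l → Bounded k
  bounded-≼ p (B , r , q) = B , r , ≼-trans (*-≼ʳ B p) q

  bounded-max : ∀ {k l} → Bounded k → Bounded l → ∃[ m ] Bounded m × k ≼ m × l ≼ m
  bounded-max {k} {l} b c with ≼-total k l
  ... | inj₁ p = l , c , p , ≼-refl
  ... | inj₂ p = k , b , ≼-refl , p

  bounded-* : ∀ {k l} → Bounded k → Bounded l → Bounded (k * l)
  bounded-* {k} {l} (B , r , p) (C , s , q) = B * C , Rad-* r s ,
    ≼-resp (solve 4 (λ k b l c → (k :* b) :* (l :* c) := k :* l :* (b :* c)) refl k B l C) refl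
      (≼1-*ˡ p q)

  bounded-+ : ∀ {k l} → Bounded k → Bounded l → Bounded (k + l)
  bounded-+ b c = let _ , d , p , q = bounded-max b c in bounded-≼ (+-≼ p q) d

  bounded-neg : ∀ {k} → Bounded k → Bounded (- k)
  bounded-neg = bounded-≼ (-‿≼ ≼-refl)

  bounded-^^ : ∀ {k} n → Bounded k → Bounded (k ^^ n)
  bounded-^^ zero    b = ≼1⇒bounded ≼-refl
  bounded-^^ (suc n) b = bounded-* b (bounded-^^ n b)

  eventually-≼⇒Bounded′ : ∀ {φ g} → Bounded g → Eventually (λ x → φ x ≼ g) → Bounded′ φ
  eventually-≼⇒Bounded′ (B , r , q) e =
    B , r , eventually-map (λ _ p → ≼-trans (*-≼ʳ B p) q) e

  BoundedVec : ∀ {n} → Vec Carrier n → Set u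
  BoundedVec v = ∀ i → Bounded (lookup v i)

  common-bound : ∀ {n} (v : Vec Carrier n) → BoundedVec v →
    ∃[ g ] Bounded g × 1# ≼ g × (∀ i → lookup v i ≼ g)
  common-bound [] b = 1# , ≼1⇒bounded ≼-refl , ≼-refl , λ ()
  common-bound (k ∷ v) b =
    let g , bg , 1≼g , p = common-bound v (b ∘ suc)
        m , bm , q , r = bounded-max (b zero) bg
    in m , bm , ≼-trans 1≼g r , λ { zero → q ; (suc i) → ≼-trans (p i) r }

  private
    g*1^^ : ∀ g n → g * 1# ^^ n ≈ g
    g*1^^ g n = trans (*-congˡ (1^^ n)) (*-identityʳ g)

  ev≼ : ∀ {n} (v : Vec Carrier n) {g x} → (∀ i → lookup v i ≼ g) → x ≼ 1# → ev v x ≼ g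
  ev≼ {n} v {g} {x} p d = ≼-resp refl (g*1^^ g (suc n))
    (IsSize.ev-size (pointwise x ≼-refl) v _ p {λ x → x} d)

  dq≼ : ∀ {n} (v : Vec Carrier n) {g x y} → (∀ i → lookup v i ≼ g) → x ≼ 1# → y ≼ 1# →
    dq v x y ≼ g
  dq≼ {n} v {g} {x} {y} p d e = ≼-resp refl (g*1^^ g (suc n))
    (IsSize.dq-size (pointwise x ≼-refl) v _ p {λ x → x} {λ _ → y} d e)

  ev-bounded : ∀ {n} (v : Vec Carrier n) → BoundedVec v → Bounded′ (ev v)
  ev-bounded v b = let g , bg , _ , p = common-bound v b in
    eventually-≼⇒Bounded′ bg (eventually-always λ x d → ev≼ v p (disc≼1 d))

  ev-lipschitz : ∀ {n} (v : Vec Carrier n) → BoundedVec v → Lipschitz (ev v)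
  ev-lipschitz v b = let g , (B , r , q) , _ , p = common-bound v b in B , r , λ x y d e →
    ≼-resp (trans (sym (*-assoc _ _ B)) (*-congʳ (sym (ev-sub v x y)))) refl
      (≼1-*ʳ ≼-refl (≼-trans (*-≼ʳ B (dq≼ v p (disc≼1 d) (disc≼1 e))) q))

  ev-∷ʳ : ∀ {n} (v : Vec Carrier n) k x → ev (v ∷ʳ k) x ≈ ev v x + k * x ^^ n
  ev-∷ʳ [] k x = solve 2 (λ k x → k :+ x :* :0 := :0 :+ k :* :1) refl k x
  ev-∷ʳ (l ∷ v) k x = trans (+-congˡ (*-congˡ (ev-∷ʳ v k x)))
    (solve 5 (λ l x p k q → l :+ x :* (p :+ k :* q) := (l :+ x :* p) :+ k :* (x :* q))
      refl l x (ev v x) k _)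

  lookup-∷ʳ : ∀ {n} {P : Carrier → Set u} (v : Vec Carrier n) {k} →
    (∀ i → P (lookup v i)) → P k → ∀ i → P (lookup (v ∷ʳ k) i)
  lookup-∷ʳ []      p q zero    = q
  lookup-∷ʳ (l ∷ v) p q zero    = p zero
  lookup-∷ʳ {P = P} (l ∷ v) p q (suc i) = lookup-∷ʳ {P = P} v (p ∘ suc) q i

  lookup-∷ʳ⁻ : ∀ {n} {P : Carrier → Set u} (v : Vec Carrier n) {k} →
    (∀ i → P (lookup (v ∷ʳ k) i)) → (∀ i → P (lookup v i)) × P k
  lookup-∷ʳ⁻ []      p = (λ ()) , p zero
  lookup-∷ʳ⁻ {P = P} (l ∷ v) p = let q , r = lookup-∷ʳ⁻ {P = P} v (p ∘ suc) in
    (λ { zero → p zero ; (suc i) → q i }) , r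

  infixr 7 _·_

  _·_ : ∀ {n} → Carrier → Vec Carrier n → Vec Carrier n
  k · []      = []
  k · (l ∷ v) = k * l ∷ k · v

  lookup-· : ∀ {n} k (v : Vec Carrier n) i → lookup (k · v) i ≡ k * lookup v i
  lookup-· k (l ∷ v) zero    = ≡.refl
  lookup-· k (l ∷ v) (suc i) = lookup-· k v i

  ev-· : ∀ {n} k (v : Vec Carrier n) x → ev (k · v) x ≈ k * ev v x
  ev-· k []      x = sym (zeroʳ k)
  ev-· k (l ∷ v) x = trans (+-congˡ (*-congˡ (ev-· k v x)))
    (solve 4 (λ k l x p → k :* l :+ x :* (k :* p) := k :* (l :+ x :* p)) refl k l x (ev v x))

  -- The missing root is algebraic of degree n over the residue field of the
  -- coarsening of the valuation with maximal ideal the complement of Rad.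
  Annihilator : ℕ → Set u
  Annihilator n = Σ[ v ∈ Vec Carrier n ] BoundedVec v × Null (ev (v ∷ʳ 1#))

  -- Trailing coefficients outside `Rad` vanish in the residue field and are dropped. Division by
  -- the first one that does not gives a monic relation.
  reduce : ∀ m (v : Vec Carrier m) → BoundedVec v → Null (ev v) →
    (∀ i → ¬ Rad (lookup v i)) ⊎ (∃[ n ] n ℕ.< m × Annihilator n)
  reduce zero [] b n = inj₁ λ ()
  reduce (suc m) v b n with initLast v
  reduce (suc m) .(w ∷ʳ k) b n | w , k , ≡.refl with em {P = Rad k}
  ... | yes r = inj₂ (m , ℕ.n<1+n m , k ⁻¹ · w ,
      (λ i → ≡.subst Bounded (≡.sym (lookup-· (k ⁻¹) w i))
        (bounded-* (Rad⇒Bounded⁻¹ r) (proj₁ (lookup-∷ʳ⁻ {P = Bounded} w b) i))) ,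
      null-cong (λ x → trans (*-congˡ (ev-∷ʳ w k x)) (trans
          (solve 4 (λ i p k q → i :* (p :+ k :* q) := i :* p :+ (k :* i) :* q) refl (k ⁻¹) (ev w x) k _)
          (trans (+-cong (sym (ev-· (k ⁻¹) w x)) (*-congʳ (⁻¹-inverse (Rad⇒≉0 r))))
            (sym (ev-∷ʳ (k ⁻¹ · w) 1# x)))))
        (null-* (let B , rB , p = Rad⇒Bounded⁻¹ r in B , rB , eventually-always λ _ _ → p) n))
  ... | no ¬r = case reduce m w (proj₁ (lookup-∷ʳ⁻ {P = Bounded} w b))
        (null-cong (λ x → trans (+-congʳ (ev-∷ʳ w k x))
            (solve 2 (λ p q → (p :+ q) :- q := p) refl (ev w x) _))
          (null-sub n (null-small λ g r x d →
            ≼1-*ʳ (≺⇒≼ (¬Rad≺Rad ¬r r)) (power≼1 m (disc≼1 d))))) of λ where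
      (inj₁ small) → inj₁ (lookup-∷ʳ {P = λ k → ¬ Rad k} w small ¬r)
      (inj₂ (n , n<m , A)) → inj₂ (n , ℕ.m<n⇒m<1+n n<m , A)
    where
    power≼1 : ∀ m {x} → x ≼ 1# → x ^^ m ≼ 1#
    power≼1 zero    p = ≼-refl
    power≼1 (suc m) p = ≼1-*ˡ p (power≼1 m p)

  least : {P : ℕ → Set u} → ∃ P → ∃[ n ] P n × (∀ m → m ℕ.< n → ¬ P m)
  least {P} (n , p) = search n n ℕ.≤-refl p
    where
    search : ∀ k n → n ℕ.≤ k → P n → ∃[ n ] P n × (∀ m → m ℕ.< n → ¬ P m)
    search zero zero _ p = 0 , p , λ _ ()
    search (suc k) n n≤ p with em {P = ∃[ m ] m ℕ.< n × P m}
    ... | yes (m , m<n , q) = search k m (ℕ.≤-pred (ℕ.≤-trans m<n n≤)) q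
    ... | no ¬q = n , p , λ m m<n q → ¬q (m , m<n , q)

  -- `F` itself is `Null`, by the definition of `Rad`. Its coefficients cannot all lie outside
  -- `Rad`, as `F a` would then lie outside too.
  annihilator : ∃ Annihilator
  annihilator = case reduce degree poly (≼1⇒bounded ∘ integral) (λ g r → eventually-close r) of λ where
    (inj₁ small) → ⊥-elim (null-const⁻¹ {F a} (null-small λ g r _ _ →
      ev≼ poly (λ i → ≺⇒≼ (¬Rad≺Rad (small i) r)) a≼1) (Rad-F (sub-self-≺ 1≉0)))
    (inj₂ (n , _ , A)) → n , A

  ¬annihilator₀ : ¬ Annihilator 0
  ¬annihilator₀ ([] , _ , n) = null-const⁻¹
    (null-cong (λ x → solve 1 (λ x → :1 :+ x :* :0 := :1) refl x) n) one

  -- A linear relation would place the missing root at `- c`, in the disc. The value of `F` there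
  -- would be below every radius, although it is itself a radius and there is no least one.
  ¬annihilator₁ : ¬ Annihilator 1
  ¬annihilator₁ (c ∷ [] , _ , n) =
    case below one of λ (g , rg , g≺1) →
    case eventually-∃ (n′ g rg) of λ (x , dx , p) →
    let d₀ : Disc x₀
        d₀ = ≺-resp (sub-telescope x₀ x a) refl (+-≺ (≺-sub-comm (≼-≺-trans p g≺1)) dx)
    in case below (Rad-F d₀) of λ (h , rh , h≺F) →
       case eventually-∃ (eventually-× (n′ h rh) (eventually-close rh)) of λ (y , dy , q , q′) →
       ≺-irrefl (≼-≺-trans (≼-resp (solve 2 (λ p q → (p :- q) :+ q := p) refl (F x₀) (F y)) refl
         (+-≼ (≼-trans (F-lipschitz d₀ dy) (≼-sub-comm q)) q′)) h≺F)
    where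
    x₀ = - c
    n′ : Null (λ x → x - x₀)
    n′ = null-cong (λ x → solve 2 (λ c x → c :+ x :* (:1 :+ x :* :0) := x :- (:- c)) refl c x) n

  -- Minimality is stated as linear independence of the powers of the root below the degree, over
  -- the residue field. Indexing by `N-2` builds in that the degree is at least two.
  record MinimalPolynomial : Set u where
    field
      {N-2}   : ℕ
      coeffs  : Vec Carrier (suc (suc N-2))
      bounded : BoundedVec coeffs
      null    : Null (ev (coeffs ∷ʳ 1#))
      minimal : (w : Vec Carrier (suc (suc N-2))) → BoundedVec w → Null (ev w) →
                ∀ i → ¬ Rad (lookup w i)

  minimalPolynomial : MinimalPolynomial
  minimalPolynomial = case least annihilator of λ where
    (0 , A , _) → ⊥-elim (¬annihilator₀ A)
    (1 , A , _) → ⊥-elim (¬annihilator₁ A)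
    (suc (suc n) , (v , b , z) , min) → record
      { coeffs = v ; bounded = b ; null = z
      ; minimal = λ w bw nw → [ id , (λ (m , m<n , A) → ⊥-elim (min m m<n A)) ]′
          (reduce _ w bw nw) }

-- Linear dependence with normalised coefficients.

module LinearAlgebra (em : ∀ {ℓ} → ExcludedMiddle ℓ) {u} (K : ValuedField u) where
  open ValuedField K hiding (zero)
  open Classical em
  open Solver commutativeRing
  open Order em K

  combination : ∀ {m n} → Vec Carrier m → Vec (Vec Carrier n) m → Fin n → Carrier
  combination []       []       j = 0#
  combination (a ∷ as) (w ∷ ws) j = a * lookup w j + combination as ws j

  NonZero : ∀ {m} → Vec Carrier m → Set u
  NonZero a = ∃[ i ] ¬ lookup a i ≈ 0#

  to-front : ∀ {m n} (ws : Vec (Vec Carrier n) (suc m)) (k : Fin (suc m)) →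
    Σ[ rest ∈ Vec (Vec Carrier n) m ] ∀ c cs → ∃[ a ] (NonZero cs → NonZero a) ×
      (∀ j → combination a ws j ≈ c * lookup (lookup ws k) j + combination cs rest j)
  to-front (w ∷ ws) zero = ws , λ c cs → c ∷ cs , (λ (i , p) → suc i , p) , λ j → refl
  to-front {suc m} (w ∷ ws) (suc k) = let rest , f = to-front ws k in
    w ∷ rest , λ { c (d ∷ cs) → let a , nz , eq = f c cs in
      d ∷ a , (λ { (zero , p) → zero , p ; (suc i , p) → let i′ , p′ = nz (i , p) in suc i′ , p′ }) ,
      λ j → trans (+-congˡ (eq j)) (solve 3 (λ x y z → x :+ (y :+ z) := y :+ (x :+ z)) refl
        (d * lookup w j) (c * lookup (lookup ws k) j) (combination cs rest j)) }

  combination-map : ∀ {m n n′} (f : Vec Carrier n → Vec Carrier n′) j j₁ j₂ k →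
    (∀ w → lookup (f w) j ≈ lookup w j₁ - lookup w j₂ * k) →
    ∀ (a : Vec Carrier m) ws → combination a (Vec.map f ws) j ≈
      combination a ws j₁ - combination a ws j₂ * k
  combination-map f j j₁ j₂ k eq [] [] = solve 1 (λ k → :0 := :0 :- :0 :* k) refl k
  combination-map f j j₁ j₂ k eq (a ∷ as) (w ∷ ws) = trans
    (+-cong (*-congˡ (eq w)) (combination-map f j j₁ j₂ k eq as ws))
    (solve 6 (λ a x y k p q → a :* (x :- y :* k) :+ (p :- q :* k) :=
                              (a :* x :+ p) :- (a :* y :+ q) :* k)
      refl a (lookup w j₁) (lookup w j₂) k (combination as ws j₁) (combination as ws j₂))

  combination-0 : ∀ {m n} (a : Vec Carrier m) (ws : Vec (Vec Carrier n) m) j →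
    (∀ i → lookup (lookup ws i) j ≈ 0#) → combination a ws j ≈ 0#
  combination-0 []       []       j p = refl
  combination-0 (a ∷ as) (w ∷ ws) j p = trans
    (+-cong (trans (*-congˡ (p zero)) (zeroʳ a)) (combination-0 as ws j (p ∘ suc))) (+-identityʳ 0#)

  -- Gaussian elimination on the first coordinate. Where that coordinate vanishes throughout, one
  -- vector is set aside with coefficient zero.
  dependent : ∀ n (ws : Vec (Vec Carrier n) (suc n)) →
    ∃[ a ] NonZero a × (∀ j → combination a ws j ≈ 0#)
  dependent zero (w ∷ []) = 1# ∷ [] , (zero , 1≉0) , λ ()
  dependent (suc n) ws with em {P = ∃[ k ] ¬ lookup (lookup ws k) zero ≈ 0#}
  ... | yes (k , pivot≉0) =
    case to-front ws k of λ (rest , front) →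
    case dependent n (Vec.map elim rest) of λ (cs , nz , eq) →
    case front (- (combination cs rest zero * h ⁻¹)) cs of λ (a , nz′ , eq′) →
    a , nz′ nz , λ where
      zero → trans (eq′ zero) (trans (+-congʳ
          (trans (solve 3 (λ s i h → (:- (s :* i)) :* h := :- (s :* (h :* i))) refl
                   (combination cs rest zero) (h ⁻¹) h)
            (-‿cong (trans (*-congˡ (⁻¹-inverse pivot≉0)) (*-identityʳ _)))))
          (-‿inverseˡ _))
      (suc j) → trans (eq′ (suc j)) (trans
          (solve 4 (λ s i p t → (:- (s :* i)) :* p :+ t := t :- s :* (i :* p)) refl
            (combination cs rest zero) (h ⁻¹) (lookup pivot (suc j)) (combination cs rest (suc j)))
          (trans (sym (combination-map elim j (suc j) zero (h ⁻¹ * lookup pivot (suc j))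
            (λ w → reflexive (Vec.lookup∘tabulate _ j)) cs rest)) (eq j)))
    where
    pivot = lookup ws k
    h = lookup pivot zero
    elim : Vec Carrier (suc n) → Vec Carrier n
    elim w = Vec.tabulate λ j → lookup w (suc j) - lookup w zero * (h ⁻¹ * lookup pivot (suc j))
  dependent (suc n) (w ∷ ws) | no ¬pivot =
    case dependent n (Vec.map Vec.tail ws) of λ (a , (i , p) , eq) →
    0# ∷ a , (suc i , p) , λ where
      zero → trans (+-cong (zeroˡ _) (combination-0 a ws zero λ i →
        by-contradiction λ q → ¬pivot (suc i , q))) (+-identityʳ 0#)
      (suc j) → trans (+-cong (zeroˡ _) (sym (trans (combination-map Vec.tail j (suc j) zero 0# tail≈ a ws)
          (solve 2 (λ x y → x :- y :* :0 := x) refl (combination a ws (suc j)) (combination a ws zero)))))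
        (trans (+-identityˡ _) (eq j))
    where
    tail≈ : ∀ {n} {j : Fin n} (w : Vec Carrier (suc n)) →
      lookup (Vec.tail w) j ≈ lookup w (suc j) - lookup w zero * 0#
    tail≈ {j = j} (x ∷ w) = solve 2 (λ x y → x := x :- y :* :0) refl (lookup w j) x

  largest : ∀ {n} (a : Vec Carrier (suc n)) → ∃[ i ] (∀ j → lookup a j ≼ lookup a i)
  largest (x ∷ []) = zero , λ { zero → ≼-refl }
  largest (x ∷ y ∷ a) = case largest (y ∷ a) of λ (i , p) →
    case ≼-total x (lookup (y ∷ a) i) of λ where
      (inj₁ q) → suc i , λ { zero → q ; (suc j) → p j }
      (inj₂ q) → zero , λ { zero → ≼-refl ; (suc j) → ≼-trans (p j) q }

  -- Division by the largest coefficient makes the relation survive in the residue field of the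
  -- coarsening.
  primitive-dependent : ∀ n (ws : Vec (Vec Carrier n) (suc n)) →
    ∃[ a ] (∀ i → lookup a i ≼ 1#) × (∃[ i ] 1# ≼ lookup a i) × (∀ j → combination a ws j ≈ 0#)
  primitive-dependent n ws =
    case dependent n ws of λ (a , (i₀ , nz) , eq) →
    case largest a of λ (i , max) →
    scaled a i (λ p → nz (≼0⇒≈0 (≼-resp refl p (max i₀)))) max eq
    where
    scale : ∀ {m} k (a : Vec Carrier m) (ws : Vec (Vec Carrier n) m) j →
      combination (Vec.map (k *_) a) ws j ≈ k * combination a ws j
    scale k []       []       j = sym (zeroʳ k)
    scale k (a ∷ as) (w ∷ ws) j = trans (+-congˡ (scale k as ws j))
      (solve 4 (λ k a x p → (k :* a) :* x :+ k :* p := k :* (a :* x :+ p)) refl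
        k a (lookup w j) (combination as ws j))
    scaled : ∀ a i → ¬ lookup a i ≈ 0# → (∀ j → lookup a j ≼ lookup a i) →
      (∀ j → combination a ws j ≈ 0#) →
      ∃[ a ] (∀ i → lookup a i ≼ 1#) × (∃[ i ] 1# ≼ lookup a i) × (∀ j → combination a ws j ≈ 0#)
    scaled a i nz max eq = Vec.map (m ⁻¹ *_) a ,
      (λ j → ≼-resp (reflexive (≡.sym (Vec.lookup-map j _ a))) inv (*-≼ˡ (m ⁻¹) (max j))) ,
      (i , ≼-reflexive (trans (sym inv) (reflexive (≡.sym (Vec.lookup-map i _ a))))) ,
      λ j → trans (scale (m ⁻¹) a ws j) (trans (*-congˡ (eq j)) (zeroʳ _))
      where
      m = lookup a i
      inv : m ⁻¹ * m ≈ 1#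
      inv = trans (*-comm _ m) (⁻¹-inverse nz)

-- Arithmetic modulo the minimal polynomial.

module Representation (em : ∀ {ℓ} → ExcludedMiddle ℓ) {u} (K : ValuedField u)
  (prepared : Definability.AllPrepared em K)
  (gap : Polynomials.Gap em K)
  (units : Order.IntegersAreUnits em K)
  (μ : Germs.MinimalPolynomial em K prepared gap) where
  open ValuedField K hiding (zero)
  open Solver commutativeRing
  open Order em K
  open Radii em K
  open Polynomials em K
  open RootlessDisc gap
  open IsRadii isRadii
  open Generic em K prepared isRadii
  open Germs em K prepared gap
  open MinimalPolynomial μ public

  N : ℕ
  N = suc (suc N-2)

  infixl 6 _⊞_ _⊟_

  _⊞_ _⊟_ : ∀ {n} → Vec Carrier n → Vec Carrier n → Vec Carrier n
  []      ⊞ []      = []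
  (x ∷ v) ⊞ (y ∷ w) = x + y ∷ v ⊞ w
  []      ⊟ []      = []
  (x ∷ v) ⊟ (y ∷ w) = x - y ∷ v ⊟ w

  lookup-⊞ : ∀ {n} (v w : Vec Carrier n) i → lookup (v ⊞ w) i ≡ lookup v i + lookup w i
  lookup-⊞ (x ∷ v) (y ∷ w) zero    = ≡.refl
  lookup-⊞ (x ∷ v) (y ∷ w) (suc i) = lookup-⊞ v w i

  lookup-⊟ : ∀ {n} (v w : Vec Carrier n) i → lookup (v ⊟ w) i ≡ lookup v i - lookup w i
  lookup-⊟ (x ∷ v) (y ∷ w) zero    = ≡.refl
  lookup-⊟ (x ∷ v) (y ∷ w) (suc i) = lookup-⊟ v w i

  ev-⊞ : ∀ {n} (v w : Vec Carrier n) x → ev (v ⊞ w) x ≈ ev v x + ev w x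
  ev-⊞ [] [] x = sym (+-identityʳ 0#)
  ev-⊞ (k ∷ v) (l ∷ w) x = trans (+-congˡ (*-congˡ (ev-⊞ v w x)))
    (solve 5 (λ k l x p q → (k :+ l) :+ x :* (p :+ q) := (k :+ x :* p) :+ (l :+ x :* q))
      refl k l x (ev v x) (ev w x))

  ev-⊟ : ∀ {n} (v w : Vec Carrier n) x → ev (v ⊟ w) x ≈ ev v x - ev w x
  ev-⊟ [] [] x = sym (sub-self 0#)
  ev-⊟ (k ∷ v) (l ∷ w) x = trans (+-congˡ (*-congˡ (ev-⊟ v w x)))
    (solve 5 (λ k l x p q → (k :- l) :+ x :* (p :- q) := (k :+ x :* p) :- (l :+ x :* q))
      refl k l x (ev v x) (ev w x))

  boundedVec-⊞ : ∀ {n} {v w : Vec Carrier n} → BoundedVec v → BoundedVec w → BoundedVec (v ⊞ w)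
  boundedVec-⊞ {v = v} {w} p q i =
    ≡.subst Bounded (≡.sym (lookup-⊞ v w i)) (bounded-+ (p i) (q i))

  boundedVec-⊟ : ∀ {n} {v w : Vec Carrier n} → BoundedVec v → BoundedVec w → BoundedVec (v ⊟ w)
  boundedVec-⊟ {v = v} {w} p q i =
    ≡.subst Bounded (≡.sym (lookup-⊟ v w i)) (bounded-+ (p i) (bounded-neg (q i)))

  boundedVec-· : ∀ {n k} {v : Vec Carrier n} → Bounded k → BoundedVec v → BoundedVec (k · v)
  boundedVec-· {k = k} {v} p q i =
    ≡.subst Bounded (≡.sym (lookup-· k v i)) (bounded-* p (q i))

  0⃗ : ∀ {n} → Vec Carrier n
  0⃗ = Vec.replicate _ 0#

  lookup-0⃗ : ∀ {n} i → lookup (0⃗ {n}) i ≡ 0#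
  lookup-0⃗ i = Vec.lookup-replicate i 0#

  ev-0⃗ : ∀ n x → ev (0⃗ {n}) x ≈ 0#
  ev-0⃗ zero    x = refl
  ev-0⃗ (suc n) x = trans (+-identityˡ _) (trans (*-congˡ (ev-0⃗ n x)) (zeroʳ x))

  boundedVec-0⃗ : ∀ {n} → BoundedVec (0⃗ {n})
  boundedVec-0⃗ i = ≡.subst Bounded (≡.sym (lookup-0⃗ i)) (≼1⇒bounded 0≼)

  bounded′-const : ∀ {k} → Bounded k → Bounded′ (λ _ → k)
  bounded′-const (B , r , p) = B , r , eventually-always λ _ _ → p

  null-0 : Null (λ _ → 0#)
  null-0 = null-const ¬Rad0

  abstract
    bound : ∃[ b ] Rad b × b ≼ 1# × (∀ i → lookup coeffs i * b ≼ 1#)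
    bound = case common-bound coeffs bounded of λ (g , (B , rB , p) , _ , q) →
      case min-Rad rB one of λ (b , rb , b≼B , b≼1) →
      b , rb , b≼1 , λ i → ≼-trans (*-≼ (q i) b≼B) p

  b : Carrier
  b = proj₁ bound

  Rad-b : Rad b
  Rad-b = proj₁ (proj₂ bound)

  b≼1 : b ≼ 1#
  b≼1 = proj₁ (proj₂ (proj₂ bound))

  coeffs*b≼1 : ∀ i → lookup coeffs i * b ≼ 1#
  coeffs*b≼1 = proj₂ (proj₂ (proj₂ bound))

  Rad-^^ : ∀ {k} n → Rad k → Rad (k ^^ n)
  Rad-^^ zero    r = one
  Rad-^^ (suc n) r = Rad-* r (Rad-^^ n r)

  ^^≼1 : ∀ {k} n → k ≼ 1# → k ^^ n ≼ 1#
  ^^≼1 zero    p = ≼-refl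
  ^^≼1 (suc n) p = ≼1-*ˡ p (^^≼1 n p)

  -- Multiplication by the variable modulo the minimal polynomial.
  TimesX : Vec Carrier N → Vec Carrier N → Set u
  TimesX z z′ = BoundedVec z′ × (∀ g → (∀ i → lookup z i ≼ g) → ∀ i → lookup z′ i * b ≼ g) ×
    Null (λ x → x * ev z x - ev z′ x)

  -- The coefficients are shifted, and `k` times the monic relation removes the overflowing power.
  -- The common denominator `b` of the relation measures the loss.
  times-x : ∀ z → BoundedVec z → ∃ (TimesX z)
  times-x z bz = split (initLast z)
    where
    module _ (w : Vec Carrier (suc N-2)) (k : Carrier) (bz : BoundedVec (w ∷ʳ k)) where
      z′ : Vec Carrier N
      z′ = (0# ∷ w) ⊟ k · coeffs

      bw : BoundedVec w
      bw = proj₁ (lookup-∷ʳ⁻ {P = Bounded} w bz)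

      bk : Bounded k
      bk = proj₂ (lookup-∷ʳ⁻ {P = Bounded} w bz)

      lookup-z′ : ∀ i → lookup z′ i ≡ lookup (0# ∷ w) i - k * lookup coeffs i
      lookup-z′ i = ≡.trans (lookup-⊟ (0# ∷ w) (k · coeffs) i)
        (≡.cong (λ y → lookup (0# ∷ w) i - y) (lookup-· k coeffs i))

      bounds : ∀ g → (∀ i → lookup (w ∷ʳ k) i ≼ g) → ∀ i → lookup z′ i * b ≼ g
      bounds g p i = ≼-resp
        (trans (solve 4 (λ x k c b → x :* b :- k :* (c :* b) := (x :- k :* c) :* b) refl
                 (lookup (0# ∷ w) i) k (lookup coeffs i) b)
               (*-congʳ (reflexive (≡.sym (lookup-z′ i))))) refl
        (-‿-≼ (≼1-*ʳ (first i) b≼1) (≼1-*ʳ (proj₂ (lookup-∷ʳ⁻ {P = _≼ g} w p)) (coeffs*b≼1 i)))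
        where
        first : ∀ i → lookup (0# ∷ w) i ≼ g
        first zero    = 0≼
        first (suc i) = proj₁ (lookup-∷ʳ⁻ {P = _≼ g} w p) i

      identity : ∀ x → k * ev (coeffs ∷ʳ 1#) x ≈ x * ev (w ∷ʳ k) x - ev z′ x
      identity x = trans (*-congˡ (ev-∷ʳ coeffs 1# x)) (trans
        (solve 5 (λ k m q x w → k :* (m :+ :1 :* (x :* q)) :=
            x :* (w :+ k :* q) :- ((:0 :+ x :* w) :- k :* m)) refl k (ev coeffs x) _ x (ev w x))
        (+-cong (*-congˡ (sym (ev-∷ʳ w k x))) (-‿cong (trans (+-congˡ (-‿cong (sym (ev-· k coeffs x))))
          (sym (ev-⊟ (0# ∷ w) (k · coeffs) x))))))

      timesX : TimesX (w ∷ʳ k) z′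
      timesX = boundedVec-⊟ {v = 0# ∷ w} {k · coeffs}
          (λ { zero → ≼1⇒bounded 0≼ ; (suc i) → bw i }) (boundedVec-· {v = coeffs} bk bounded) ,
        bounds , null-cong identity (null-* (bounded′-const bk) null)

    split : (∃[ w ] ∃[ k ] z ≡ w ∷ʳ k) → ∃ (TimesX z)
    split (w , k , ≡.refl) = z′ w k bz , timesX w k bz

  -- Horner's scheme in `y`: each of the `m` multiplications by the variable may lose a factor `b`.
  product : ∀ m (y : Vec Carrier m) (z : Vec Carrier N) → BoundedVec y → BoundedVec z →
    ∃[ t ] BoundedVec t ×
    (∀ g h → (∀ i → lookup y i ≼ g) → (∀ i → lookup z i ≼ h) → ∀ i → lookup t i * b ^^ m ≼ g * h) ×
    Null (λ x → ev y x * ev z x - ev {N} t x)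
  product zero [] z by bz = 0⃗ , boundedVec-0⃗ ,
    (λ g h _ _ i → ≼-resp (trans (sym (zeroˡ _)) (*-congʳ (reflexive (≡.sym (lookup-0⃗ i))))) refl 0≼) ,
    null-cong (λ x → trans (sym (sub-self 0#)) (+-cong (sym (zeroˡ _)) (-‿cong (sym (ev-0⃗ N x))))) null-0
  product (suc m) (k ∷ y) z by bz =
    case times-x z bz of λ (z′ , bz′ , le′ , n′) →
    case product m y z′ (by ∘ suc) bz′ of λ (t , bt , le , n) →
    k · z ⊞ t , boundedVec-⊞ {v = k · z} (boundedVec-· {v = z} (by zero) bz) bt ,
    (λ g h p q i → ≼-resp
      (trans (sym (distribʳ _ _ _)) (*-congʳ (reflexive (≡.sym (≡.trans (lookup-⊞ (k · z) t i)
        (≡.cong (_+ lookup t i) (lookup-· k z i))))))) refl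
      (+-≼ (≼1-*ʳ (*-≼ (p zero) (q i)) (^^≼1 (suc m) b≼1))
        (≼-resp (solve 3 (λ t c b → t :* c :* b := t :* (b :* c)) refl (lookup t i) (b ^^ m) b)
                (trans (*-assoc g _ b) (*-congˡ (divide (Rad⇒≉0 Rad-b))))
          (*-≼ʳ b (le g (h * b ⁻¹) (p ∘ suc) (λ i → *-≼-cancelʳ (Rad⇒≉0 Rad-b)
            (≼-resp refl (sym (divide (Rad⇒≉0 Rad-b))) (le′ h q i))) i))))) ,
    null-cong (λ x → trans
        (solve 6 (λ k z x y z′ t → y :* (x :* z :- z′) :+ (y :* z′ :- t) :=
                                   (k :+ x :* y) :* z :- (k :* z :+ t)) refl
          k (ev z x) x (ev y x) (ev z′ x) (ev t x))
        (+-congˡ (-‿cong (trans (+-congʳ (sym (ev-· k z x))) (sym (ev-⊞ (k · z) t x))))))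
      (null-+ (null-* (ev-bounded y (by ∘ suc)) n′) n)

  κ : Carrier
  κ = b ^^ N

  Rad-κ : Rad κ
  Rad-κ = Rad-^^ N Rad-b

  κ≼1 : κ ≼ 1#
  κ≼1 = ^^≼1 N b≼1

  -- φ agrees at the missing root with a polynomial of degree below N whose
  -- coefficients are at most κ g; the factor κ makes this submultiplicative.
  Rep : Carrier → (Carrier → Carrier) → Set u
  Rep g φ = Σ[ z ∈ Vec Carrier N ] BoundedVec z × (∀ i → lookup z i ≼ κ * g) ×
    Null (λ x → φ x - ev z x)

  rep-bounded : ∀ {g φ} → Rep g φ → Bounded′ φ
  rep-bounded {φ = φ} (z , bz , _ , n) =
    case common-bound z bz of λ (G , bG , 1≼G , p) →
    eventually-≼⇒Bounded′ bG (eventually-map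
      (λ {x} d q → ≼-resp (solve 2 (λ p q → (p :- q) :+ q := p) refl (φ x) (ev z x)) refl
        (+-≼ (≼-trans q 1≼G) (ev≼ z p (disc≼1 d)))) (n 1# one))

  rep-null : ∀ {g φ} → Null φ → Rep g φ
  rep-null n = 0⃗ , boundedVec-0⃗ , (λ i → ≼-resp (reflexive (≡.sym (lookup-0⃗ i))) refl 0≼) ,
    null-cong (λ x → sym (trans (+-congˡ (trans (-‿cong (ev-0⃗ N x)) -0≈0)) (+-identityʳ _))) n
    where
    -0≈0 : - 0# ≈ 0#
    -0≈0 = solve 0 (:- :0 := :0) refl

  rep-cong : ∀ {g φ ψ} → (∀ x → φ x ≈ ψ x) → Rep g φ → Rep g ψ
  rep-cong f (z , bz , le , n) = z , bz , le , null-cong (λ x → +-congʳ (f x)) n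

  rep-mono : ∀ {g h φ} → g ≼ h → Rep g φ → Rep h φ
  rep-mono p (z , bz , le , n) = z , bz , (λ i → ≼-trans (le i) (*-≼ˡ κ p)) , n

  rep-+ : ∀ {g φ ψ} → Rep g φ → Rep g ψ → Rep g (λ x → φ x + ψ x)
  rep-+ {φ = φ} {ψ} (y , by , le , n) (z , bz , le′ , n′) =
    y ⊞ z , boundedVec-⊞ {v = y} by bz ,
    (λ i → ≼-resp (reflexive (≡.sym (lookup-⊞ y z i))) refl (+-≼ (le i) (le′ i))) ,
    null-cong (λ x → trans
      (solve 4 (λ p q y z → (p :- y) :+ (q :- z) := (p :+ q) :- (y :+ z)) refl (φ x) (ψ x) (ev y x) (ev z x))
      (+-congˡ (-‿cong (sym (ev-⊞ y z x))))) (null-+ n n′)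

  rep-* : ∀ {g h φ ψ} → Rep g φ → Rep h ψ → Rep (g * h) (λ x → φ x * ψ x)
  rep-* {g} {h} {φ} {ψ} (y , by , le , n) rψ@(z , bz , le′ , n′) =
    case product N y z by bz of λ (t , bt , le″ , n″) →
    t , bt ,
    (λ i → *-≼-cancelʳ (Rad⇒≉0 Rad-κ) (≼-resp refl
      (solve 3 (λ k g h → k :* g :* (k :* h) := k :* (g :* h) :* k) refl κ g h)
      (le″ (κ * g) (κ * h) le le′ i))) ,
    null-cong (λ x → solve 5 (λ p q y z t → (q :* (p :- y) :+ y :* (q :- z)) :+ (y :* z :- t) :=
        p :* q :- t) refl (φ x) (ψ x) (ev y x) (ev z x) (ev t x))
      (null-+ (null-+ (null-* (rep-bounded {h} {ψ} rψ) n) (null-* (ev-bounded y by) n′)) n″)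

  private
    κ⁻¹-cancel : ∀ k → κ * (k * κ ⁻¹) ≈ k
    κ⁻¹-cancel k = trans (*-comm κ _) (divide (Rad⇒≉0 Rad-κ))

    1≼κ⁻¹ : 1# ≼ κ ⁻¹
    1≼κ⁻¹ = *-≼-cancelˡ (Rad⇒≉0 Rad-κ)
      (≼-resp (sym (*-identityʳ κ)) (sym (⁻¹-inverse (Rad⇒≉0 Rad-κ))) κ≼1)

  rep-vec : ∀ {g} (w : Vec Carrier N) → BoundedVec w → (∀ i → lookup w i ≼ g) → Rep (g * κ ⁻¹) (ev w)
  rep-vec {g} w bw p = w , bw , (λ i → ≼-resp refl (sym (κ⁻¹-cancel g)) (p i)) ,
    null-cong (λ x → sym (sub-self _)) null-0

  rep-const : ∀ {g k} → Bounded k → k ≼ g → Rep (g * κ ⁻¹) (λ _ → k)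
  rep-const {g} {k} bk p = rep-cong (λ x → trans (+-congˡ (trans (*-congˡ (ev-0⃗ (suc N-2) x)) (zeroʳ x))) (+-identityʳ k))
    (rep-vec (k ∷ 0⃗) (λ { zero → bk ; (suc i) → boundedVec-0⃗ i })
      (λ { zero → p ; (suc i) → ≼-resp (reflexive (≡.sym (lookup-0⃗ i))) refl 0≼ }))

  x⃗ : Vec Carrier N
  x⃗ = 0# ∷ 1# ∷ 0⃗

  ev-x⃗ : ∀ x → ev x⃗ x ≈ x
  ev-x⃗ x = trans (+-identityˡ _) (trans (*-congˡ (trans (+-congˡ
    (trans (*-congˡ (ev-0⃗ N-2 x)) (zeroʳ x))) (+-identityʳ 1#))) (*-identityʳ x))

  boundedVec-x⃗ : BoundedVec x⃗
  boundedVec-x⃗ zero          = ≼1⇒bounded 0≼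
  boundedVec-x⃗ (suc zero)    = ≼1⇒bounded ≼-refl
  boundedVec-x⃗ (suc (suc i)) = boundedVec-0⃗ i

  rep-id : Rep (κ ⁻¹) (λ x → x)
  rep-id = rep-cong ev-x⃗ (rep-mono (≼-reflexive (*-identityˡ _)) (rep-vec x⃗ boundedVec-x⃗ λ where
    zero          → 0≼
    (suc zero)    → ≼-refl
    (suc (suc i)) → ≼-resp (reflexive (≡.sym (lookup-0⃗ i))) refl 0≼))

  isSize : ∀ {M} → κ ⁻¹ ≼ M → IsSize Rep Bounded M
  isSize {M} p = record
    { 1≼M = ≼-trans 1≼κ⁻¹ p
    ; 𝒮-cong = rep-cong
    ; 𝒮-mono = rep-mono
    ; 𝒮-0 = rep-null null-0
    ; 𝒮-+ = rep-+
    ; 𝒮-* = λ {g} {h} {φ} {ψ} → rep-* {g} {h} {φ} {ψ}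
    ; 𝒮-const = λ {g} bk q → rep-mono (*-≼ˡ g p) (rep-const bk q)
    }

  rep-neg : ∀ {g φ} → Rep g φ → Rep g (λ x → - φ x)
  rep-neg {g} {φ} (z , bz , le , n) = - 1# · z , boundedVec-· {v = z} (bounded-neg (≼1⇒bounded ≼-refl)) bz ,
    (λ i → ≼-resp (reflexive (≡.sym (lookup-· (- 1#) z i))) refl (≼1-*ˡ (-‿≼ ≼-refl) (le i))) ,
    null-cong (λ x → trans (solve 2 (λ p z → :- (p :- z) := (:- p) :- (:- :1) :* z) refl (φ x) (ev z x))
      (+-congˡ (-‿cong (sym (ev-· (- 1#) z x))))) (null-neg n)

  rep-pointwise : ∀ {g φ} → Rad g → Rep g φ → Eventually (λ x → φ x ≼ g)
  rep-pointwise {g} {φ} r (z , bz , le , n) = eventually-map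
    (λ {x} d q → ≼-resp (solve 2 (λ p q → (p :- q) :+ q := p) refl (φ x) (ev z x)) refl
      (+-≼ q (ev≼ z (λ i → ≼-trans (le i) (≼1-*ˡ κ≼1 ≼-refl)) (disc≼1 d)))) (n g r)

  -- By minimality two representatives of one germ differ by coefficients outside `Rad`, so a bound
  -- on one passes to the other.
  coefficients≼ : ∀ {g φ} w → BoundedVec w → Rad g → Rep g φ → Null (λ x → ev w x - φ x) →
    ∀ i → lookup w i ≼ κ * g
  coefficients≼ {g} {φ} w bw r (z , bz , le , n) n′ i =
    ≼-resp (solve 2 (λ p q → (p :- q) :+ q := p) refl (lookup w i) (lookup z i)) refl
      (+-≼ (≺⇒≼ (¬Rad≺Rad (≡.subst (¬_ ∘ Rad) (lookup-⊟ w z i) (minimal (w ⊟ z)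
          (boundedVec-⊟ {v = w} bw bz) (null-cong (λ x → trans
            (solve 3 (λ w p z → (w :- p) :+ (p :- z) := w :- z) refl (ev w x) (φ x) (ev z x))
            (sym (ev-⊟ w z x))) (null-+ n′ n)) i)) (Rad-* Rad-κ r))) (le i))

  vec-boundedBelow : ∀ w → BoundedVec w → ∀ i → Rad (lookup w i) → BoundedBelow (ev w)
  vec-boundedBelow w bw i r = ¬null⇒boundedBelow (ev-lipschitz w bw) λ n → minimal w bw n i r

-- The inverse of the derivative at the missing root.

module Derivative (em : ∀ {ℓ} → ExcludedMiddle ℓ) {u} (K : ValuedField u)
  (prepared : Definability.AllPrepared em K)
  (gap : Polynomials.Gap em K)
  (units : Order.IntegersAreUnits em K)
  (μ : Germs.MinimalPolynomial em K prepared gap) where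
  open ValuedField K hiding (zero)
  open Solver commutativeRing
  open Order em K
  open Radii em K
  open Polynomials em K
  open RootlessDisc gap
  open IsRadii isRadii
  open Generic em K prepared isRadii
  open Germs em K prepared gap
  open LinearAlgebra em K
  open Representation em K prepared gap units μ

  private
    _∙_ = RawMonoidDefinitions._×_ +-rawMonoid

  f⃗ : Vec Carrier (suc N)
  f⃗ = coeffs ∷ʳ 1#

  boundedVec-f⃗ : BoundedVec f⃗
  boundedVec-f⃗ = lookup-∷ʳ {P = Bounded} coeffs bounded (≼1⇒bounded ≼-refl)

  D : Carrier → Carrier
  D x = dq f⃗ x x

  dvec : ∀ {n} → Vec Carrier (suc n) → Vec Carrier n
  dvec (a ∷ [])    = []
  dvec (a ∷ b ∷ v) = (b ∷ v) ⊞ (0# ∷ dvec (b ∷ v))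

  ev-dvec : ∀ {n} (v : Vec Carrier (suc n)) x → ev (dvec v) x ≈ dq v x x
  ev-dvec (a ∷ [])    x = sym (trans (+-identityˡ _) (zeroʳ x))
  ev-dvec (a ∷ b ∷ v) x = trans (ev-⊞ (b ∷ v) (0# ∷ dvec (b ∷ v)) x)
    (+-congˡ (trans (+-identityˡ _) (*-congˡ (ev-dvec (b ∷ v) x))))

  boundedVec-dvec : ∀ {n} (v : Vec Carrier (suc n)) → BoundedVec v → BoundedVec (dvec v)
  boundedVec-dvec (a ∷ [])    p ()
  boundedVec-dvec (a ∷ b ∷ v) p = boundedVec-⊞ {v = b ∷ v} {0# ∷ dvec (b ∷ v)} (p ∘ suc)
    (λ { zero → ≼1⇒bounded 0≼ ; (suc i) → boundedVec-dvec (b ∷ v) (p ∘ suc) i })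

  lookup-last : ∀ {n} (v : Vec Carrier n) k → lookup (v ∷ʳ k) (fromℕ n) ≡ k
  lookup-last []      k = ≡.refl
  lookup-last (a ∷ v) k = lookup-last v k

  dvec-last : ∀ {n} (v : Vec Carrier (suc n)) → lookup (dvec (v ∷ʳ 1#)) (fromℕ n) ≈ suc n ∙ 1#
  dvec-last (a ∷ [])    = refl
  dvec-last {suc n} (a ∷ b ∷ v) = trans
    (reflexive (lookup-⊞ ((b ∷ v) ∷ʳ 1#) (0# ∷ dvec ((b ∷ v) ∷ʳ 1#)) (suc (fromℕ n))))
    (+-cong (reflexive (lookup-last (b ∷ v) 1#)) (dvec-last (b ∷ v)))

  -- Separability: the leading coefficient of the derivative is the integer `N`, a unit, so by
  -- minimality the derivative does not vanish at the root.
  D-boundedBelow : BoundedBelow D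
  D-boundedBelow = case vec-boundedBelow (dvec f⃗) (boundedVec-dvec f⃗ boundedVec-f⃗) (fromℕ _)
      (upward one (≼-resp refl (sym (dvec-last coeffs)) (units (suc N-2)))) of λ (g , r , e) →
    g , r , eventually-map (λ _ → ≼-resp refl (ev-dvec f⃗ _)) e

  linear : ∀ {m n} → Vec Carrier m → Vec (Vec Carrier n) m → Vec Carrier n
  linear []       []       = 0⃗
  linear (a ∷ as) (w ∷ ws) = a · w ⊞ linear as ws

  lookup-linear : ∀ {m n} (a : Vec Carrier m) (ws : Vec (Vec Carrier n) m) j →
    lookup (linear a ws) j ≡ combination a ws j
  lookup-linear []       []       j = lookup-0⃗ j
  lookup-linear (a ∷ as) (w ∷ ws) j = ≡.trans (lookup-⊞ (a · w) (linear as ws) j)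
    (≡.cong₂ _+_ (lookup-· a w j) (lookup-linear as ws j))

  ev-zero : ∀ {n} (v : Vec Carrier n) → (∀ i → lookup v i ≈ 0#) → ∀ x → ev v x ≈ 0#
  ev-zero []      p x = refl
  ev-zero (a ∷ v) p x = trans (+-cong (p zero) (trans (*-congˡ (ev-zero v (p ∘ suc) x)) (zeroʳ x)))
    (+-identityʳ 0#)

  Powers : ∀ {m} → (Carrier → Carrier) → (Carrier → Carrier) → Vec (Vec Carrier N) m → Set u
  Powers {m} ψ φ ws = (a : Vec Carrier m) → BoundedVec a →
    Null (λ x → ψ x * ev a (φ x) - ev (linear a ws) x)

  -- The rows represent `ψ`, `ψ φ`, `ψ φ²` and so on, with `ψ` as an accumulator.
  powers : ∀ m {ψ φ g h} → Rep g ψ → Rep h φ → ∃ (Powers {m} ψ φ)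
  powers zero rψ rφ = [] , λ { [] _ → null-cong (λ x →
    trans (sym (sub-self 0#)) (+-cong (sym (zeroʳ _)) (-‿cong (sym (ev-0⃗ N x))))) null-0 }
  powers (suc m) {ψ} {φ} {g} {h} rψ@(w , _ , _ , n) rφ =
    case powers m {λ x → ψ x * φ x} {φ} (rep-* {g} {h} {ψ} {φ} rψ rφ) rφ of λ (ws , p) →
    w ∷ ws , λ { (a ∷ as) ba → null-cong (λ x → trans
        (solve 6 (λ a s w p e l → a :* (s :- w) :+ (s :* p :* e :- l) :=
                                  s :* (a :+ p :* e) :- (a :* w :+ l)) refl
          a (ψ x) (ev w x) (φ x) (ev as (φ x)) (ev (linear as ws) x))
        (+-congˡ (-‿cong (trans (+-congʳ (sym (ev-· a w x))) (sym (ev-⊞ (a · w) (linear as ws) x))))))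
      (null-+ (null-* (bounded′-const (ba zero)) n) (p as (ba ∘ suc))) }

  -- By linear dependence of the powers of φ.
  annihilating : ∀ {g φ} → Rep g φ → Σ[ a ∈ Vec Carrier (suc N) ]
    (∀ i → lookup a i ≼ 1#) × (∃[ i ] 1# ≼ lookup a i) × Null (λ x → ev a (φ x))
  annihilating {g} {φ} rφ =
    case powers (suc N) {λ _ → 1#} {φ} (rep-const (≼1⇒bounded ≼-refl) ≼-refl) rφ of λ (ws , p) →
    case primitive-dependent N ws of λ (a , a≼1 , unit , zeros) →
    a , a≼1 , unit , null-cong (λ x → trans (+-cong (*-identityˡ _) (-‿cong
        (ev-zero (linear a ws) (λ j → trans (reflexive (lookup-linear a ws j)) (zeros j)) x)))
        (solve 1 (λ p → p :- :0 := p) refl _))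
      (p a (≼1⇒bounded ∘ a≼1))

  Inverse : (Carrier → Carrier) → Set u
  Inverse φ = Σ[ j ∈ Vec Carrier N ] BoundedVec j × Null (λ x → 1# - φ x * ev j x)

  -- If the constant coefficient is in `Rad`, solving the relation for it expresses the inverse as a
  -- polynomial in `φ`. If not, it is negligible, and a factor `φ` can be cancelled because `φ` is
  -- bounded below.
  inverse-of : ∀ {m φ M} → BoundedBelow φ → κ ⁻¹ ≼ M → Rep M φ →
    (a : Vec Carrier m) → BoundedVec a → (∃[ i ] Rad (lookup a i)) → Null (λ x → ev a (φ x)) →
    Inverse φ
  inverse-of bb κ⁻¹≼M rφ [] _ (() , _) _
  inverse-of {φ = φ} {M} bb κ⁻¹≼M rφ (a ∷ as) ba (i , r) n with em {P = Rad a}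
  ... | yes ra = invert
    where
    ψ : Carrier → Carrier
    ψ x = - (a ⁻¹ * ev as (φ x))
    invert : Inverse φ
    invert = case common-bound as (ba ∘ suc) of λ (G , _ , _ , p) →
      case rep-neg (rep-* {φ = λ _ → a ⁻¹} {ψ = λ x → ev as (φ x)}
             (rep-const (Rad⇒Bounded⁻¹ ra) ≼-refl)
             (IsSize.ev-size (isSize κ⁻¹≼M) as (ba ∘ suc) p rφ)) of λ (j , bj , _ , nj) →
      j , bj , null-cong (λ x → trans (+-congʳ (distribˡ (a ⁻¹) a _)) (trans
          (+-congʳ (+-congʳ (trans (*-comm _ a) (⁻¹-inverse (Rad⇒≉0 ra)))))
          (solve 5 (λ o i p e j → (o :+ i :* (p :* e)) :+ p :* ((:- (i :* e)) :- j) := o :- p :* j)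
            refl 1# (a ⁻¹) (φ x) (ev as (φ x)) (ev j x))))
        (null-+ (null-* (bounded′-const (Rad⇒Bounded⁻¹ ra)) n)
                (null-* (rep-bounded {M} {φ} rφ) nj))
  ... | no ¬ra = inverse-of bb κ⁻¹≼M rφ as (ba ∘ suc) (later i r)
      (null-cancel bb (null-cong (λ x → solve 2 (λ a p → (a :+ p) :- a := p) refl a _)
        (null-sub n (null-const ¬ra))))
    where
    later : ∀ i → Rad (lookup (a ∷ as) i) → ∃[ i ] Rad (lookup as i)
    later zero    r = ⊥-elim (¬ra r)
    later (suc i) r = i , r

  D-inverse : Inverse D
  D-inverse =
    case bounded-max (Rad⇒Bounded⁻¹ Rad-κ) (proj₁ (proj₂ bound-dvec)) of λ (M , _ , p , q) →
    let repD : Rep (M * κ ⁻¹) D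
        repD = rep-cong (ev-dvec f⃗) (rep-vec (dvec f⃗) bd (λ i → ≼-trans (proj₂ (proj₂ (proj₂ bound-dvec)) i) q))
    in case annihilating repD of λ (a , a≼1 , (i , u) , n) →
    inverse-of {φ = D} {M = M * κ ⁻¹} D-boundedBelow
      (≽1-*ˡ (≼-trans (proj₁ (proj₂ (proj₂ bound-dvec))) q) ≼-refl)
      repD a (≼1⇒bounded ∘ a≼1) (i , upward one u) n
    where
    bd : BoundedVec (dvec f⃗)
    bd = boundedVec-dvec f⃗ boundedVec-f⃗
    bound-dvec = common-bound (dvec f⃗) bd

-- Minimal polynomials of elements near the missing root.

module Conjugates (em : ∀ {ℓ} → ExcludedMiddle ℓ) {u} (K : ValuedField u)
  (prepared : Definability.AllPrepared em K)
  (gap : Polynomials.Gap em K)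
  (units : Order.IntegersAreUnits em K)
  (μ : Germs.MinimalPolynomial em K prepared gap) where
  open ValuedField K hiding (zero)
  open Classical em
  open Solver commutativeRing
  open Order em K
  open Definability em K
  open Radii em K
  open Polynomials em K
  open RootlessDisc gap
  open IsRadii isRadii
  open Generic em K prepared isRadii
  open Freezing em K prepared isRadii
  open Germs em K prepared gap
  open LinearAlgebra em K
  open Representation em K prepared gap units μ
  open Derivative em K prepared gap units μ

  -- `ρ` bounds the coordinates `e` and `ρ′` the corrections `c`. `C` is the cost of multiplying by
  -- `j`, `M` bounds the variable and the elements `g e`, and `G` bounds the coefficients of f; `Ω`
  -- dominates the products of these in all error terms. `ρ′Ω≺1` makes the errors relatively small,
  -- `ρ′Ω≺δ` keeps difference quotients of f + c near the derivative of f, and `ρΩ≼bρ′` leaves room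
  -- for dividing by a leading coefficient of size at least `b`.
  record Scale (j : Vec Carrier N) : Set u where
    field
      C M G ρ ρ′ δ : Carrier
    Ω : Carrier
    Ω = C * (C * (G * M ^^ suc (suc N)))
    field
      1≼C    : 1# ≼ C
      κ⁻¹≼M  : κ ⁻¹ ≼ M
      C≼M    : C ≼ M
      1≼G    : 1# ≼ G
      f⃗≼G    : ∀ i → lookup f⃗ i ≼ G
      rep-j* : ∀ {g} (w : Vec Carrier N) → BoundedVec w → (∀ i → lookup w i ≼ g) → Rep (g * C) (λ x → ev j x * ev w x)
      Rad-ρ  : Rad ρ
      Rad-ρ′ : Rad ρ′
      ρ≼1    : ρ ≼ 1#
      ρ≼ρ′   : ρ ≼ ρ′
      ρ′≼1   : ρ′ ≼ 1#
      ρ′Ω≺1  : ρ′ * Ω ≺ 1#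
      ρ′Ω≺δ  : ρ′ * Ω ≺ δ
      ρΩ≼bρ′ : ρ * Ω ≼ b * ρ′
      δ≼D    : Eventually (λ x → δ ≼ D x)

  private
    bκ⁻¹ : Bounded (κ ⁻¹)
    bκ⁻¹ = Rad⇒Bounded⁻¹ Rad-κ

  module _ {j : Vec Carrier N} (bj : BoundedVec j) {s : Carrier} (j≼s : ∀ i → lookup j i ≼ s)
           {C M G B δ : Carrier} (s≼C : s * κ ⁻¹ * κ ⁻¹ ≼ C) (1≼C : 1# ≼ C)
           (κ⁻¹≼M : κ ⁻¹ ≼ M) (C≼M : C ≼ M) (1≼G : 1# ≼ G) (f⃗≼G : ∀ i → lookup f⃗ i ≼ G)
           (ΩB≼1 : C * (C * (G * M ^^ suc (suc N))) * B ≼ 1#)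
           (δ≼D : Eventually (λ x → δ ≼ D x)) where
    private
      Ω : Carrier
      Ω = C * (C * (G * M ^^ suc (suc N)))

      Ω≉0 : ¬ Ω ≈ 0#
      Ω≉0 p = 1≉0 (≼0⇒≈0 (≼-resp refl p
        (≽1-*ˡ 1≼C (≽1-*ˡ 1≼C (≽1-*ˡ 1≼G (1≼^^ (suc (suc N)) (≼-trans 1≼C C≼M)))))))

      rep-product : ∀ {g} (w : Vec Carrier N) → BoundedVec w → (∀ i → lookup w i ≼ g) →
        Rep (g * C) (λ x → ev j x * ev w x)
      rep-product {g} w bw p = rep-mono
        (≼-trans (≼-reflexive (solve 4 (λ s k g l → s :* k :* (g :* l) := g :* (s :* k :* l)) refl
          s (κ ⁻¹) g (κ ⁻¹))) (*-≼ˡ g s≼C))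
        (rep-* {φ = ev j} {ev w} (rep-vec j bj j≼s) (rep-vec w bw p))

      ρ′Ω≺ : ∀ {ρ′ t} → ρ′ ≺ B * t → ρ′ * Ω ≺ t
      ρ′Ω≺ {t = t} p = ≺-≼-trans (*-≺ʳ Ω≉0 p)
        (≼-resp (solve 3 (λ o b t → (o :* b) :* t := b :* t :* o) refl Ω B t) refl
          (≼1-*ˡ ΩB≼1 ≼-refl))

      ρΩ≼ : ∀ {ρ ρ′} → ρ ≼ b * ρ′ * B → ρ * Ω ≼ b * ρ′
      ρΩ≼ {ρ′ = ρ′} p = ≼-trans (*-≼ʳ Ω p)
        (≼-resp (solve 3 (λ o b r → (o :* b) :* r := r :* b :* o) refl Ω B (b * ρ′)) refl
          (≼1-*ˡ ΩB≼1 ≼-refl))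

      mkScale : ∀ {ρ ρ′} → Rad ρ → Rad ρ′ → ρ′ ≼ 1# → ρ ≼ ρ′ → ρ′ ≺ B → ρ′ ≺ B * δ → ρ ≼ b * ρ′ * B → Scale j
      mkScale {ρ} {ρ′} rρ rρ′ ρ′≼1 ρ≼ρ′ ρ′≺B ρ′≺Bδ ρ≼bρ′B = record
        { C = C ; M = M ; G = G ; ρ = ρ ; ρ′ = ρ′ ; δ = δ
        ; 1≼C = 1≼C ; κ⁻¹≼M = κ⁻¹≼M ; C≼M = C≼M ; 1≼G = 1≼G ; f⃗≼G = f⃗≼G
        ; rep-j* = rep-product
        ; Rad-ρ = rρ ; Rad-ρ′ = rρ′
        ; ρ≼1 = ≼-trans ρ≼ρ′ ρ′≼1 ; ρ≼ρ′ = ρ≼ρ′ ; ρ′≼1 = ρ′≼1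
        ; ρ′Ω≺1 = ρ′Ω≺ (≺-resp refl (sym (*-identityʳ B)) ρ′≺B)
        ; ρ′Ω≺δ = ρ′Ω≺ ρ′≺Bδ ; ρΩ≼bρ′ = ρΩ≼ ρ≼bρ′B
        ; δ≼D = δ≼D
        }

    chooseRadii : Rad B → Rad δ → Scale j
    chooseRadii rB rδ =
      case min-below rB (Rad-* rB rδ) of λ (r , rr , r≺B , r≺Bδ) →
      case min-Rad rr one of λ (ρ′ , rρ′ , ρ′≼r , ρ′≼1) →
      case min-Rad rρ′ (Rad-* (Rad-* Rad-b rρ′) rB) of λ (ρ , rρ , ρ≼ρ′ , ρ≼bρ′B) →
      mkScale rρ rρ′ ρ′≼1 ρ≼ρ′ (≼-≺-trans ρ′≼r r≺B) (≼-≺-trans ρ′≼r r≺Bδ) ρ≼bρ′B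

  scale : ∀ j → BoundedVec j → Scale j
  scale j bj =
    case common-bound j bj of λ (s , bs , _ , j≼s) →
    case bounded-max (bounded-* (bounded-* bs bκ⁻¹) bκ⁻¹) (≼1⇒bounded ≼-refl) of λ (C , bC , s≼C , 1≼C) →
    case bounded-max bκ⁻¹ bC of λ (M , bM , κ⁻¹≼M , C≼M) →
    case common-bound f⃗ boundedVec-f⃗ of λ (G , bG , 1≼G , f⃗≼G) →
    case D-boundedBelow of λ (δ , rδ , δ≼D) →
    case bounded-* bC (bounded-* bC (bounded-* bG (bounded-^^ (suc (suc N)) bM))) of λ (B , rB , ΩB≼1) →
    chooseRadii bj j≼s s≼C 1≼C κ⁻¹≼M C≼M 1≼G f⃗≼G ΩB≼1 δ≼D rB rδ

  module Relation (j : Vec Carrier N) (j-inverse : Null (λ x → 1# - D x * ev j x))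
                  (S : Scale j) where
    open Scale S

    1≼M : 1# ≼ M
    1≼M = ≼-trans 1≼C C≼M

    module RepSize = IsSize (isSize κ⁻¹≼M)

    CM≼Ω : C * M ^^ suc N ≼ Ω
    CM≼Ω = *-≼ˡ C (≽1-*ˡ 1≼C (≽1-*ˡ 1≼G (≽1-*ˡ 1≼M ≼-refl)))

    C≼Ω : C ≼ Ω
    C≼Ω = ≼-trans (≽1-*ʳ ≼-refl (1≼^^ (suc N) 1≼M)) CM≼Ω

    1≼Ω : 1# ≼ Ω
    1≼Ω = ≼-trans 1≼C C≼Ω

    -- At the missing root r, g e is an element of K(r) close to r, and Φ e c
    -- is the value there of f + c.
    h g : Vec Carrier N → Carrier → Carrier
    h e x = ev j x * ev e x
    g e x = x - h e x

    Φ : Vec Carrier N → Vec Carrier N → Carrier → Carrier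
    Φ e c x = ev f⃗ (g e x) + ev c (g e x)

    R : Vec Carrier N → Vec Carrier N → Set u
    R e c = (∀ i → lookup e i ≼ ρ) × (∀ i → lookup c i ≼ ρ′) × Null (Φ e c)

    -- `Null` quantifies over elements of `K` only: a radius, a starting point, and the points
    -- beyond it. These quantifiers are written out here.
    defR : Def (∅ ▹[ N ] ▹[ N ]) (λ ((_ , e) , c) → R e c)
    defR = defAnd (defAllFin λ i → def≼ (var (there[] here[ i ])) (const ρ))
      (defAnd (defAllFin λ i → def≼ (var here[ i ]) (const ρ′))
      (univ (imp (defRad (var here)) (defEx (defAnd (disc (var here)) (univ (imp (disc (var here))
        (imp (def≼ (F-poly (var here)) (F-poly (wk (var here))))
          (def≼ (polyEv _ {λ _ → f⃗} (λ i → const (lookup f⃗ i)) g-poly ⊕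
                 polyEv N {proj₂ ∘ proj₁ ∘ proj₁ ∘ proj₁} (λ i → wk (wk (wk (var here[ i ])))) g-poly)
            (wk (wk (var here))))))))))))
      where
      disc : ∀ {Γ s} → Poly Γ s → Def Γ (Disc ∘ s)
      disc p = def≺ (p ⊖ const (Polynomials.Gap.a gap)) (const 1#)
      F-poly : ∀ {Γ s} → Poly Γ s → Poly Γ (F ∘ s)
      F-poly p = polyEv _ {λ _ → Polynomials.Gap.poly gap} (λ i → const _) p
      g-poly : Poly (∅ ▹[ N ] ▹[ N ] ▹ ▹ ▹) (λ (((((_ , e) , c) , _) , _) , x) → g e x)
      g-poly = var here ⊖ polyEv N {λ _ → j} (λ i → const (lookup j i)) (var here) ⊗
        polyEv N {proj₂ ∘ proj₁ ∘ proj₁ ∘ proj₁ ∘ proj₁} (λ i → wk (wk (wk (var (there[] here[ i ]))))) (var here)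

    small-bounded : ∀ {s} → s ≼ 1# → (w : Vec Carrier N) → (∀ i → lookup w i ≼ s) → BoundedVec w
    small-bounded p w q i = ≼1⇒bounded (≼-trans (q i) p)

    rep-h : ∀ e → (∀ i → lookup e i ≼ ρ) → Rep (ρ * C) (h e)
    rep-h e p = rep-j* e (small-bounded ρ≼1 e p) p

    rep-g-x : ∀ e → (∀ i → lookup e i ≼ ρ) → Rep (ρ * C) (λ x → g e x - x)
    rep-g-x e p = rep-cong (λ x → solve 2 (λ x h → :- h := (x :- h) :- x) refl x (h e x))
      (rep-neg (rep-h e p))

    rep-x : Rep M (λ x → x)
    rep-x = rep-mono κ⁻¹≼M rep-id

    rep-g : ∀ e → (∀ i → lookup e i ≼ ρ) → Rep M (g e)
    rep-g e p = rep-cong (λ x → solve 2 (λ g x → (g :- x) :+ x := g) refl (g e x) x)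
      (rep-+ (rep-mono (≼-trans (≼1-*ˡ ρ≼1 ≼-refl) C≼M) (rep-g-x e p)) rep-x)

    module _ {e c e′ c′ : Vec Carrier N} (eρ : ∀ i → lookup e i ≼ ρ) (cρ : ∀ i → lookup c i ≼ ρ′) (n : Null (Φ e c))
             (eρ′ : ∀ i → lookup e′ i ≼ ρ) (cρ′ : ∀ i → lookup c′ i ≼ ρ′) (n′ : Null (Φ e′ c′)) where
      private
        Δe Δc w : Vec Carrier N
        Δe = e ⊟ e′
        Δc = c ⊟ c′
        w  = Δc ⊟ Δe

        be : BoundedVec Δe
        be = boundedVec-⊟ {v = e} {e′} (small-bounded ρ≼1 e eρ) (small-bounded ρ≼1 e′ eρ′)

        bc : BoundedVec Δc
        bc = boundedVec-⊟ {v = c} {c′} (small-bounded ρ′≼1 c cρ) (small-bounded ρ′≼1 c′ cρ′)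

        q₁ q₂ q₃ E : Carrier → Carrier
        q₁ x = dq f⃗ (g e x) (g e′ x)
        q₂ x = dq c (g e x) (g e′ x)
        q₃ x = dq Δc (g e′ x) x
        E x = (ev j x * ev Δe x * (q₁ x - D x) + ev j x * ev Δe x * q₂ x) + h e′ x * q₃ x

        -- The two arguments differ by `j` times `Δe`, up to sign. Replacing the quotient `q₁` by
        -- `D`, and `D` times `j` by 1, turns the change of f into the change of `e`. `E` gathers
        -- the errors: the replacement of `q₁`, the variation of `c`, and the evaluation of `Δc` at
        -- `x` in place of `g e′ x`.
        identity : ∀ x → (Φ e c x - Φ e′ c′ x) - ev Δe x * (1# - D x * ev j x) ≈ ev w x - E x
        identity x = trans (+-congʳ step₁) (trans (+-congˡ (-‿cong (*-congʳ (ev-⊟ e e′ x))))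
          (trans (solve 9 (λ x j e e′ d q₁ q₂ q₃ c →
              (((x :- j :* e) :- (x :- j :* e′)) :* q₁ :+ (((x :- j :* e) :- (x :- j :* e′)) :* q₂ :+
                (c :+ ((x :- j :* e′) :- x) :* q₃))) :- (e :- e′) :* (:1 :- d :* j) :=
              (c :- (e :- e′)) :- ((j :* (e :- e′) :* (q₁ :- d) :+ j :* (e :- e′) :* q₂) :+
                                   j :* e′ :* q₃)) refl
              x (ev j x) (ev e x) (ev e′ x) (D x) (q₁ x) (q₂ x) (q₃ x) (ev Δc x))
          (+-cong (trans (+-congˡ (-‿cong (sym (ev-⊟ e e′ x)))) (sym (ev-⊟ Δc Δe x)))
            (-‿cong (+-congʳ (+-cong (*-congʳ (*-congˡ (sym (ev-⊟ e e′ x))))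
                                     (*-congʳ (*-congˡ (sym (ev-⊟ e e′ x))))))))))
          where
          y = g e x
          y′ = g e′ x
          step₁ : Φ e c x - Φ e′ c′ x ≈ (y - y′) * q₁ x + ((y - y′) * q₂ x + (ev Δc x + (y′ - x) * q₃ x))
          step₁ = trans
            (solve 5 (λ p q r s t → (p :+ q) :- (r :+ t) := (p :- r) :+ ((q :- s) :+ (s :- t))) refl
              (ev f⃗ y) (ev c y) (ev f⃗ y′) (ev c y′) (ev c′ y′))
            (+-cong (ev-sub f⃗ y y′) (+-cong (ev-sub c y y′)
              (trans (sym (ev-⊟ c c′ y′)) (trans
                (solve 2 (λ p q → p := q :+ (p :- q)) refl (ev Δc y′) (ev Δc x))
                (+-congˡ (ev-sub Δc y′ x))))))

        null-w-E : Null (λ x → ev w x - E x)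
        null-w-E = null-cong identity (null-sub (null-sub n n′) (null-* (ev-bounded Δe be) j-inverse))

      module _ {s : Carrier} (rs : Rad s) (Δe≼ : ∀ i → lookup Δe i ≼ s) (Δc≼ : ∀ i → lookup Δc i ≼ s) where
        private
          grow₁ : s * C * (ρ * C * (G * M ^^ suc (suc N))) ≼ s * (ρ′ * Ω)
          grow₁ = ≼-resp (solve 4 (λ s c r g → s :* (r :* (c :* (c :* g))) := s :* c :* (r :* c :* g)) refl
            s C ρ (G * M ^^ suc (suc N))) refl (*-≼ˡ s (*-≼ʳ Ω ρ≼ρ′))

          grow₂ : s * C * (ρ′ * M ^^ suc N) ≼ s * (ρ′ * Ω)
          grow₂ = ≼-resp (solve 4 (λ s c r m → s :* (r :* (c :* m)) := s :* c :* (r :* m)) refl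
            s C ρ′ (M ^^ suc N)) refl (*-≼ˡ s (*-≼ˡ ρ′ CM≼Ω))

          grow₃ : ρ * C * (s * M ^^ suc N) ≼ s * (ρ′ * Ω)
          grow₃ = ≼-resp (solve 4 (λ s c r m → s :* (r :* (c :* m)) := r :* c :* (s :* m)) refl
            s C ρ (M ^^ suc N)) refl (*-≼ˡ s (*-≼ ρ≼ρ′ CM≼Ω))

          rep-Δ : Rep (s * C) (λ x → ev j x * ev Δe x)
          rep-Δ = rep-j* Δe be Δe≼

          rep₁ : Rep (s * (ρ′ * Ω)) (λ x → ev j x * ev Δe x * (q₁ x - D x))
          rep₁ = rep-mono grow₁ (rep-* {φ = λ x → ev j x * ev Δe x} {λ x → q₁ x - D x} rep-Δ
            (RepSize.dq-sub-size f⃗ boundedVec-f⃗ f⃗≼G {g e} {g e′} {λ x → x} {λ x → x}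
              (rep-g e eρ) (rep-g e′ eρ′) rep-x rep-x (rep-g-x e eρ) (rep-g-x e′ eρ′)))

          rep₂ : Rep (s * (ρ′ * Ω)) (λ x → ev j x * ev Δe x * q₂ x)
          rep₂ = rep-mono grow₂ (rep-* {φ = λ x → ev j x * ev Δe x} {q₂} rep-Δ
            (RepSize.dq-size c (small-bounded ρ′≼1 c cρ) cρ {g e} {g e′} (rep-g e eρ) (rep-g e′ eρ′)))

          rep₃ : Rep (s * (ρ′ * Ω)) (λ x → h e′ x * q₃ x)
          rep₃ = rep-mono grow₃ (rep-* {φ = h e′} {q₃} (rep-h e′ eρ′)
            (RepSize.dq-size Δc bc Δc≼ {g e′} {λ x → x} (rep-g e′ eρ′) rep-x))

          rep-E : Rep (s * (ρ′ * Ω)) E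
          rep-E = rep-+ (rep-+ rep₁ rep₂) rep₃

        -- Every term of `E` has size at most `s` times `ρ′ * Ω`, which is below `s`.
        difference≺ : ∀ i → lookup w i ≺ s
        difference≺ i = ≼-≺-trans (≼-trans (coefficients≼ w (boundedVec-⊟ {v = Δc} {Δe} bc be)
            (Rad-* rs (upward Rad-ρ′ (≽1-*ʳ ≼-refl 1≼Ω))) rep-E null-w-E i) (≼1-*ˡ κ≼1 ≼-refl))
          (≺-resp refl (*-identityʳ s) (*-≺ˡ (Rad⇒≉0 rs) ρ′Ω≺1))

      -- Were some Δc larger than every Δe, the largest would differ from the
      -- corresponding Δe by less than itself.
      Δc≼Δe : ∀ {s} → Rad s → (∀ i → lookup Δe i ≼ s) → ∀ i → lookup Δc i ≼ s
      Δc≼Δe {s} rs Δe≼ i = case largest Δc of λ (m , max) →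
        ≼-trans (max i) (by-contradiction λ ¬p →
          let s≺ = ⊀⇒≺ ¬p in ≺-irrefl (≺-resp
            (solve 2 (λ p q → (p :- q) :+ q := p) refl (lookup Δc m) (lookup Δe m)) refl
            (+-≺ (≺-resp (reflexive (lookup-⊟ Δc Δe m)) refl
                   (difference≺ (upward rs (≺⇒≼ s≺)) (λ i → ≼-trans (Δe≼ i) (≺⇒≼ s≺)) max m))
                 (≼-≺-trans (Δe≼ m) s≺))))

    riso : Riso R
    riso {e} {c} {e′} {c′} {s} (eρ , cρ , n) (eρ′ , cρ′ , n′) rs small i = ≺-resp
      (reflexive (≡.trans (lookup-⊟ (c ⊟ c′) (e ⊟ e′) i)
        (≡.cong₂ _-_ (lookup-⊟ c c′ i) (lookup-⊟ e e′ i)))) refl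
      (difference≺ {e} {c} {e′} {c′} eρ cρ n eρ′ cρ′ n′ rs Δe≼
        (Δc≼Δe {e} {c} {e′} {c′} eρ cρ n eρ′ cρ′ n′ rs Δe≼) i)
      where
      Δe≼ : ∀ i → lookup (e ⊟ e′) i ≼ s
      Δe≼ i = ≼-resp (reflexive (≡.sym (lookup-⊟ e e′ i))) refl (small i)

    -- The minimal polynomial of g e is a small perturbation of f.
    total : ∀ e → Box 0⃗ ρ e → ∃[ c ] R e c
    total e be = case annihilating (rep-g e eρ) of λ (a , a≼1 , unit , n) → split a (initLast a) a≼1 unit n
      where
      eρ : ∀ i → lookup e i ≼ ρ
      eρ i = ≼-resp (solve 1 (λ p → p :- :0 := p) refl (lookup e i)) refl
        (≼-resp (+-congˡ (-‿cong (reflexive (lookup-0⃗ i)))) refl (≺⇒≼ (be i)))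

      module _ (a : Vec Carrier N) (k : Carrier) (a≼1 : ∀ i → lookup (a ∷ʳ k) i ≼ 1#)
               (unit : ∃[ i ] 1# ≼ lookup (a ∷ʳ k) i) (n : Null (λ x → ev (a ∷ʳ k) (g e x))) where
        bounded-a : BoundedVec a
        bounded-a = proj₁ (lookup-∷ʳ⁻ {P = Bounded} a (≼1⇒bounded ∘ a≼1))

        bounded-k : Bounded k
        bounded-k = proj₂ (lookup-∷ʳ⁻ {P = Bounded} a (≼1⇒bounded ∘ a≼1))

        -- The remainder of the annihilator of `g e` modulo f. It is small at the root, since `g e`
        -- is close to it, and so its coefficients are small.
        w : Vec Carrier N
        w = a ⊟ k · coeffs

        ev-w : ∀ y → ev w y ≈ ev (a ∷ʳ k) y - k * ev f⃗ y
        ev-w y = trans (ev-⊟ a (k · coeffs) y) (trans (+-congˡ (-‿cong (ev-· k coeffs y))) (trans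
          (solve 4 (λ a k c p → a :- k :* c := (a :+ k :* p) :- k :* (c :+ :1 :* p)) refl
            (ev a y) k (ev coeffs y) _)
          (sym (+-cong (ev-∷ʳ a k y) (-‿cong (*-congˡ (ev-∷ʳ coeffs 1# y)))))))

        E : Carrier → Carrier
        E x = h e x * dq (a ∷ʳ k) (g e x) x

        rep-E : Rep (ρ * Ω) E
        rep-E = rep-mono (≼-trans
            (≼-reflexive (solve 3 (λ r c m → r :* c :* (:1 :* m) := r :* (c :* m)) refl ρ C (M ^^ suc (suc N))))
            (*-≼ˡ ρ (*-≼ˡ C (≽1-*ˡ 1≼C (≽1-*ˡ 1≼G ≼-refl)))))
          (rep-* {φ = h e} {λ x → dq (a ∷ʳ k) (g e x) x} (rep-h e eρ)
            (RepSize.dq-size (a ∷ʳ k) (≼1⇒bounded ∘ a≼1) a≼1 {g e} {λ x → x} (rep-g e eρ) rep-x))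

        null-w-E : Null (λ x → ev w x - E x)
        null-w-E = null-cong (λ x → trans
            (+-congʳ (trans (solve 2 (λ p q → p := q :+ (p :- q)) refl (ev (a ∷ʳ k) (g e x)) (ev (a ∷ʳ k) x))
              (+-congˡ (ev-sub (a ∷ʳ k) (g e x) x))))
            (trans (solve 6 (λ p x h q k f → (p :+ ((x :- h) :- x) :* q) :- k :* f :=
                                            (p :- k :* f) :- h :* q) refl
                (ev (a ∷ʳ k) x) x (h e x) (dq (a ∷ʳ k) (g e x) x) k (ev f⃗ x))
              (+-congʳ (sym (ev-w x)))))
          (null-sub n (null-* (bounded′-const bounded-k) null))

        Rad-ρΩ : Rad (ρ * Ω)
        Rad-ρΩ = upward Rad-ρ (≽1-*ʳ ≼-refl 1≼Ω)

        ρΩ≺1 : ρ * Ω ≺ 1#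
        ρΩ≺1 = ≼-≺-trans (*-≼ʳ Ω ρ≼ρ′) ρ′Ω≺1

        w≼ : ∀ i → lookup w i ≼ ρ * Ω
        w≼ i = ≼-trans (coefficients≼ w
            (boundedVec-⊟ {v = a} {k · coeffs} bounded-a (boundedVec-· {v = coeffs} bounded-k bounded))
            Rad-ρΩ rep-E null-w-E i) (≼1-*ˡ κ≼1 ≼-refl)

        -- Otherwise every coefficient would be smaller than 1.
        b≼k : b ≼ k
        b≼k = by-contradiction λ ¬p → let k≺b = ⊀⇒≺ ¬p in
          ≺-irrefl (≼-≺-trans (proj₂ unit)
            (lookup-∷ʳ {P = _≺ 1#} a (λ i → ≺-resp (a≈ i) refl (+-≺ (≼-≺-trans (w≼ i) ρΩ≺1) (kμ≺1 k≺b i)))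
              (≺-≼-trans k≺b b≼1) (proj₁ unit)))
          where
          a≈ : ∀ i → lookup w i + k * lookup coeffs i ≈ lookup a i
          a≈ i = trans (+-congʳ (reflexive (≡.trans (lookup-⊟ a (k · coeffs) i)
            (≡.cong (λ y → lookup a i - y) (lookup-· k coeffs i)))))
            (solve 2 (λ p q → (p :- q) :+ q := p) refl (lookup a i) _)
          kμ≺1 : k ≺ b → ∀ i → k * lookup coeffs i ≺ 1#
          kμ≺1 k≺b i with em {P = lookup coeffs i ≈ 0#}
          ... | yes p = ≺-resp (sym (trans (*-congˡ p) (zeroʳ k))) refl (0≺ 1≉0)
          ... | no ¬p = ≺-≼-trans (*-≺ʳ ¬p k≺b) (≼-resp (*-comm _ b) refl (coeffs*b≼1 i))

        Rad-k : Rad k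
        Rad-k = upward Rad-b b≼k

        -- Chosen so that f + c is the annihilator divided by its leading coefficient `k`.
        c : Vec Carrier N
        c = k ⁻¹ · w

        c≼ : ∀ i → lookup c i ≼ ρ′
        c≼ i = *-≼-cancelˡ (Rad⇒≉0 Rad-k) (≼-trans (≼-resp eq′ refl (w≼ i))
            (≼-trans ρΩ≼bρ′ (*-≼ʳ ρ′ b≼k)))
          where
          eq′ : lookup w i ≈ k * lookup c i
          eq′ = trans (trans (sym (*-identityˡ _)) (trans (*-congʳ (sym (⁻¹-inverse (Rad⇒≉0 Rad-k))))
            (*-assoc k _ _))) (*-congˡ (reflexive (≡.sym (lookup-· (k ⁻¹) w i))))

        null-Φ : Null (Φ e c)
        null-Φ = null-cong (λ x → sym (trans (+-congˡ (trans (ev-· (k ⁻¹) w (g e x)) (*-congˡ (ev-w (g e x)))))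
            (trans (solve 4 (λ f i p k → f :+ i :* (p :- k :* f) := i :* p :+ (:1 :- k :* i) :* f) refl
                (ev f⃗ (g e x)) (k ⁻¹) (ev (a ∷ʳ k) (g e x)) k)
              (trans (+-congˡ (trans (*-congʳ (trans (+-congˡ (-‿cong (⁻¹-inverse (Rad⇒≉0 Rad-k)))) (sub-self 1#)))
                (zeroˡ _))) (+-identityʳ _)))))
          (null-* (bounded′-const (Rad⇒Bounded⁻¹ Rad-k)) n)

      split : ∀ a → (∃[ a′ ] ∃[ k ] a ≡ a′ ∷ʳ k) → (∀ i → lookup a i ≼ 1#) →
        (∃[ i ] 1# ≼ lookup a i) → Null (λ x → ev a (g e x)) → ∃[ c ] R e c
      split _ (a , k , ≡.refl) a≼1 unit n = c a k a≼1 unit n , eρ ,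
        c≼ a k a≼1 unit n , null-Φ a k a≼1 unit n

-- An exact root in `K` close to the missing root.

module Contradiction (em : ∀ {ℓ} → ExcludedMiddle ℓ) {u} (K : ValuedField u)
  (prepared : Definability.AllPrepared em K)
  (gap : Polynomials.Gap em K)
  (units : Order.IntegersAreUnits em K)
  (μ : Germs.MinimalPolynomial em K prepared gap) where
  open ValuedField K hiding (zero)
  open Classical em
  open Solver commutativeRing
  open Order em K
  open Radii em K
  open Polynomials em K
  open RootlessDisc gap
  open IsRadii isRadii
  open Generic em K prepared isRadii
  open Freezing em K prepared isRadii
  open Germs em K prepared gap
  open Representation em K prepared gap units μ
  open Derivative em K prepared gap units μ
  open Conjugates em K prepared gap units μ

  boundedBelow-cong : ∀ {φ ψ} → BoundedBelow φ → Null (λ x → ψ x - φ x) → BoundedBelow ψ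
  boundedBelow-cong {φ} {ψ} (s , rs , e) n = case below rs of λ (t , rt , t≺s) →
    s , rs , eventually-map (λ {x} _ (p , q) → by-contradiction λ ψ≺s → ≺-irrefl (≼-≺-trans p
        (≺-resp (solve 2 (λ p q → q :- (q :- p) := p) refl (φ x) (ψ x)) refl
          (-‿-≺ (⊀⇒≺ ψ≺s) (≼-≺-trans q t≺s)))))
      (eventually-× e (n t rt))

  ^^-≼ : ∀ {x y} n → x ≼ y → x ^^ n ≼ y ^^ n
  ^^-≼ zero    p = ≼-refl
  ^^-≼ (suc n) p = *-≼ p (^^-≼ n p)

  module _ (j : Vec Carrier N) (j-inverse : Null (λ x → 1# - D x * ev j x)) (S : Scale j) where
    open Scale S
    open Relation j j-inverse S

    Rad-ρC : Rad (ρ * C)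
    Rad-ρC = upward Rad-ρ (≽1-*ʳ ≼-refl 1≼C)

    ρC≺1 : ρ * C ≺ 1#
    ρC≺1 = ≼-≺-trans (*-≼ ρ≼ρ′ C≼Ω) ρ′Ω≺1

    -- The coefficient of the variable in `h e` is below 1 and cannot cancel the 1 in `x⃗`. This is
    -- what keeps `g e` away from zero and outside `K`.
    representative : ∀ e → (∀ i → lookup e i ≼ ρ) → Σ[ w ∈ Vec Carrier N ] BoundedVec w ×
      1# ≼ lookup w (suc zero) × Null (λ x → g e x - ev w x)
    representative e eρ = case rep-h e eρ of λ (z , bz , le , n) →
      x⃗ ⊟ z , boundedVec-⊟ {v = x⃗} {z} boundedVec-x⃗ bz ,
      ≼-resp refl (reflexive (≡.sym (lookup-⊟ x⃗ z (suc zero)))) (≺-sub⇒≼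
        (≺-resp (solve 2 (λ o z → :- z := (o :- z) :- o) refl 1# (lookup z (suc zero))) refl
          (-‿≺ (≼-≺-trans (≼-trans (le (suc zero)) (≼1-*ˡ κ≼1 ≼-refl)) ρC≺1)))) ,
      null-cong (λ x → trans (solve 3 (λ h z x → :- (h :- z) := (x :- h) :- (x :- z)) refl (h e x) (ev z x) x)
        (+-congˡ (-‿cong (sym (trans (ev-⊟ x⃗ z x) (+-congʳ (ev-x⃗ x))))))) (null-neg n)

    g-boundedBelow : ∀ e → (∀ i → lookup e i ≼ ρ) → BoundedBelow (g e)
    g-boundedBelow e eρ = case representative e eρ of λ (w , bw , u , n) →
      boundedBelow-cong {ev w} {g e} (vec-boundedBelow w bw (suc zero) (upward one u)) n

    ¬null-g-z : ∀ e → (∀ i → lookup e i ≼ ρ) → ∀ {z} → z ≼ 1# → ¬ Null (λ x → g e x - z)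
    ¬null-g-z e eρ {z} z≼1 n = case representative e eρ of λ (w , bw , u , n′) →
      minimal (w ⊟ (z ∷ 0⃗))
        (boundedVec-⊟ {v = w} {z ∷ 0⃗} bw (λ { zero → ≼1⇒bounded z≼1 ; (suc i) → boundedVec-0⃗ i }))
        (null-cong (λ x → trans
            (solve 3 (λ g z w → (g :- z) :- (g :- w) := w :- z) refl (g e x) z (ev w x))
            (sym (trans (ev-⊟ w (z ∷ 0⃗) x) (+-congˡ (-‿cong
              (trans (+-congˡ (trans (*-congˡ (ev-0⃗ (suc N-2) x)) (zeroʳ x))) (+-identityʳ z)))))))
          (null-sub n n′))
        (suc zero) (upward one (≼-resp refl
          (trans (solve 1 (λ p → p := p :- :0) refl _) (reflexive (≡.sym (lookup-⊟ w (z ∷ 0⃗) (suc zero))))) u))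

    module _ (e : Vec Carrier N) (eρ : ∀ i → lookup e i ≼ ρ)
             (c : Vec Carrier N) (cρ : ∀ i → lookup c i ≼ ρ′) (n : Null (Φ e c))
             (e₁ : Vec Carrier N) (x : Carrier) (dx : Disc x) (Fx≼ρ : F x ≼ ρ) (hx≼ : h e₁ x ≼ ρ * C)
             (root : ev f⃗ (g e₁ x) + ev c (g e₁ x) ≈ 0#) where
      private
        z : Carrier
        z = g e₁ x

        ρ≼ρC : ρ ≼ ρ * C
        ρ≼ρC = ≽1-*ʳ ≼-refl 1≼C

        z≼1 : z ≼ 1#
        z≼1 = -‿-≼ (disc≼1 dx) (≼-trans hx≼ (≺⇒≼ ρC≺1))

        Q : Carrier → Carrier
        Q x′ = dq f⃗ (g e x′) z + dq c (g e x′) z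

        Q-D≼ : ∀ {x′} → Disc x′ → F x′ ≼ ρ → h e x′ ≼ ρ * C → Q x′ - D x′ ≼ ρ′ * Ω
        Q-D≼ {x′} d p q = ≼-resp
          (solve 3 (λ a b c → (a :- c) :+ b := (a :+ b) :- c) refl
            (dq f⃗ (g e x′) z) (dq c (g e x′) z) (D x′)) refl
          (+-≼ (≼-trans (P.dq-sub-size f⃗ _ f⃗≼G {g e} {λ _ → z} {λ x → x} {λ x → x} g≼M z≼M x′≼M x′≼M
                   (≼-resp (solve 2 (λ x h → :- h := (x :- h) :- x) refl x′ (h e x′)) refl (-‿≼ q)) z-x′≼)
                 (≼-resp (solve 3 (λ r c k → r :* (c :* k) := r :* c :* k) refl ρ C _) refl
                   (*-≼ ρ≼ρ′ (≽1-*ˡ 1≼C ≼-refl))))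
               (≼-trans (P.dq-size c _ cρ {g e} {λ _ → z} g≼M z≼M)
                 (*-≼ˡ ρ′ (≼-trans (≽1-*ˡ 1≼C ≼-refl) CM≼Ω))))
          where
          module P = IsSize (pointwise x′ 1≼M)
          x′≼M : x′ ≼ M
          x′≼M = ≼-trans (disc≼1 d) 1≼M
          g≼M : g e x′ ≼ M
          g≼M = ≼-trans (-‿-≼ (disc≼1 d) (≼-trans q (≺⇒≼ ρC≺1))) 1≼M
          z≼M : z ≼ M
          z≼M = ≼-trans z≼1 1≼M
          z-x′≼ : z - x′ ≼ ρ * C
          z-x′≼ = ≼-sub-trans
            (≼-resp (solve 2 (λ x h → :- h := (x :- h) :- x) refl x (h e₁ x)) refl (-‿≼ hx≼))
            (≼-trans (F-expanding dx d) (≼-trans (-‿-≼ Fx≼ρ p) ρ≼ρC))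

        Q-boundedBelow : BoundedBelow Q
        Q-boundedBelow = δ , upward Rad-ρ′ (≼-trans (≽1-*ʳ ≼-refl 1≼Ω) (≺⇒≼ ρ′Ω≺δ)) ,
          eventually-map (λ {x′} d (δ≼ , p , q) → by-contradiction λ Q≺δ → ≺-irrefl (≼-≺-trans δ≼
              (≺-resp (solve 2 (λ p q → q :- (q :- p) := p) refl (D x′) (Q x′)) refl
                (-‿-≺ (⊀⇒≺ Q≺δ) (≼-≺-trans (Q-D≼ d p q) ρ′Ω≺δ)))))
            (eventually-× δ≼D (eventually-× (eventually-close Rad-ρ) (rep-pointwise Rad-ρC (rep-h e eρ))))

      -- Both `g e` and `z` are roots of f + c, so `(g e - z)` times `Q` is null. The factor `Q` is
      -- close to the derivative and hence bounded below, so `g e` would coincide at the missing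
      -- root with the element `z` of `K`.
      exact-root-contradiction : ⊥
      exact-root-contradiction = ¬null-g-z e eρ z≼1 (null-cancel {Q} Q-boundedBelow
        (null-cong (λ x′ → trans (trans
            (trans (solve 1 (λ p → p := p :- :0) refl _) (+-congˡ (-‿cong (sym root))))
            (solve 4 (λ a b c d → (a :+ b) :- (c :+ d) := (a :- c) :+ (b :- d)) refl
              (ev f⃗ (g e x′)) (ev c (g e x′)) (ev f⃗ z) (ev c z)))
            (trans (+-cong (ev-sub f⃗ (g e x′) z) (ev-sub c (g e x′) z))
              (solve 3 (λ a p q → a :* p :+ a :* q := (p :+ q) :* a) refl (g e x′ - z)
                (dq f⃗ (g e x′) z) (dq c (g e x′) z)))) n))

    -- Move along the line so as to make an approximate root exact.
    module _ (c : Vec Carrier (suc N-2)) (y γ : Carrier) (rγ : Rad γ)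
             (onLine : ∀ y′ → Ball y γ y′ → ∃[ e ] R e (c ∷ʳ y′)) where

      perturb : ∀ e → R e (c ∷ʳ y) → ⊥
      perturb e (eρ , cρ , n) =
        case g-boundedBelow e eρ of λ (η , rη , η≼g) →
        -- The value of f + c at the approximate root has to be so small that division by the power
        -- of the root, at least that of `η`, leaves less than `γ`.
        case below (Rad-* rγ (Rad-^^ (suc N-2) rη)) of λ (t , rt , t≺) →
        case eventually-∃ (eventually-× η≼g (eventually-× (n t rt)
          (eventually-× (eventually-close Rad-ρ) (rep-pointwise Rad-ρC (rep-h e eρ))))) of
          λ (x , dx , η≼gx , Φ≼t , Fx≼ρ , hx≼) →
        at e x dx (≼-≺-trans Φ≼t t≺) (upward (Rad-^^ (suc N-2) rη) (^^-≼ (suc N-2) η≼gx))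
          (^^-≼ (suc N-2) η≼gx) Fx≼ρ hx≼
        where
        at : ∀ e x {η} → Disc x → Φ e (c ∷ʳ y) x ≺ γ * η → Rad (g e x ^^ suc N-2) →
          η ≼ g e x ^^ suc N-2 → F x ≼ ρ → h e x ≼ ρ * C → ⊥
        at e x {η} dx Φ≺ rz η≼ Fx≼ρ hx≼ =
          case onLine (y + τ) (≺-resp (sym (shift y τ)) refl τ≺γ) of λ (e₂ , e₂ρ , c₂ρ , n₂) →
          exact-root-contradiction e₂ e₂ρ (c ∷ʳ (y + τ)) c₂ρ n₂ e x dx Fx≼ρ hx≼ root
          where
          z = g e x
          zm = z ^^ suc N-2
          P = Φ e (c ∷ʳ y) x
          -- The leading coefficient of c multiplies `zm`, so changing it by `τ` cancels the value
          -- `P`.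
          τ = - (P * zm ⁻¹)
          τzm : τ * zm ≈ - P
          τzm = trans (solve 3 (λ p i z → (:- (p :* i)) :* z := :- (p :* i :* z)) refl P (zm ⁻¹) zm)
            (-‿cong (divide (Rad⇒≉0 rz)))
          τ≺γ : τ ≺ γ
          τ≺γ = ⊀⇒≺ λ γ≼τ → ≺-irrefl (≼-≺-trans (≼-trans (*-≼ γ≼τ η≼)
            (≼-trans (≼-reflexive τzm) (-‿≼ ≼-refl))) Φ≺)
          root : ev f⃗ z + ev (c ∷ʳ (y + τ)) z ≈ 0#
          root = trans (+-congˡ (ev-∷ʳ c (y + τ) z)) (trans
            (solve 5 (λ f c y t m → f :+ (c :+ (y :+ t) :* m) := (f :+ (c :+ y :* m)) :+ t :* m) refl
              (ev f⃗ z) (ev c z) y τ zm)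
            (trans (+-cong (+-congˡ (sym (ev-∷ʳ c y z))) τzm) (-‿inverseʳ P)))

    contradiction : ⊥
    contradiction = case line (suc N-2) R defR (λ {e c e′ c′} → riso {e} {c} {e′} {c′}) 0⃗ Rad-ρ total of λ (c , y , γ , rγ , onLine) →
      case onLine y (ball-centre rγ) of λ (e , Re) → perturb c y γ rγ onLine e Re

-- Hensel's lemma from the absence of gaps.

module NoGap (em : ∀ {ℓ} → ExcludedMiddle ℓ) {u} (K : ValuedField u)
  (prepared : Definability.AllPrepared em K)
  (units : Order.IntegersAreUnits em K) where

  no-gap : ¬ Polynomials.Gap em K
  no-gap gap = contradiction j (proj₂ (proj₂ D-inverse)) (scale j (proj₁ (proj₂ D-inverse)))
    where
    μ = Germs.minimalPolynomial em K prepared gap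
    open Derivative em K prepared gap units μ using (D-inverse)
    open Conjugates em K prepared gap units μ using (scale)
    open Contradiction em K prepared gap units μ using (contradiction)
    j = proj₁ D-inverse

module StructureLevel (em : ∀ {ℓ} → ExcludedMiddle ℓ) {u} (K : ValuedField u)
  (prepared : Definability.AllPrepared em K)
  (equiChar : EquiCharacteristicZero K) where
  open ValuedField K hiding (zero)
  open Classical em
  open Solver commutativeRing
  open Order em K
  open Polynomials em K

  private
    _∙_ = RawMonoidDefinitions._×_ +-rawMonoid

  residue-∙ : ∀ n → proj₁ (RawMonoidDefinitions._×_ (RawRing.+-rawMonoid (residueField K)) n (1# , 𝒪-1))
    ≡ n ∙ 1#
  residue-∙ zero    = ≡.refl
  residue-∙ (suc n) = ≡.cong (1# +_) (residue-∙ n)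

  -- A positive integer of size below 1 would vanish in the residue field.
  units : ∀ n → 1# ≼ suc n ∙ 1#
  units n = by-contradiction λ ¬p → proj₂ equiChar n (≺-resp
    (trans (reflexive (≡.sym (residue-∙ (suc n)))) (solve 1 (λ p → p := p :- :0) refl _)) refl (⊀⇒≺ ¬p))

  henselian : Henselian K
  henselian f a f∈𝒪 a∈𝒪 approx (_ , simple) = by-contradiction λ rootless →
    NoGap.no-gap em K prepared units record
      { poly = Vec.fromList f
      ; integral = integral f∈𝒪
      ; a = a
      ; a≼1 = 𝒪⇒≼1 a∈𝒪
      ; approx = ≺-resp (ev-fromList f a) refl approx
      ; simple = ≼-resp refl (evalPoly-derivative f a) simple
      ; rootless = λ {x} d root → rootless (x ,
          ≼1⇒𝒪 (≼-resp (solve 2 (λ x a → (x :- a) :+ a := x) refl x a) refl (+-≼ (≺⇒≼ d) (𝒪⇒≼1 a∈𝒪))) ,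
          trans (ev-fromList f x) root , d)
      }
    where
    integral : ∀ {f} → All 𝒪 f → ∀ i → lookup (Vec.fromList f) i ≼ 1#
    integral (p ∷ _)  zero    = 𝒪⇒≼1 p
    integral (_ ∷ ps) (suc i) = integral ps i

theorem2p7p2 : (∀ {ℓ} → ExcludedMiddle ℓ) →
    ∀ {u} {L : Language u} (K : Structure L) (V : IsValuedFieldStructure K) →
    EquiCharacteristicZero (IsValuedFieldStructure.valuedField V) →
    ZeroHMinimal (Th K) →
    Henselian (IsValuedFieldStructure.valuedField V)
theorem2p7p2 em K V equiChar hmin =
  StructureLevel.henselian em (IsValuedFieldStructure.valuedField V)
    (Preparation.prepared em K V hmin) equiChar
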